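{- Let $d \geq 2$ and $n \geq d$ be integers with $(d,n) \neq (2,2)$. Let $\psi : \mathbb{R}_{>0} \to \mathbb{R}_{>0}$ be a function such that $\psi(u) = o(u)$ as $u \to \infty$. Then \[ \lim_{A \to \infty} \frac{\# \{ V \in \mathbb{V}_{d,n}(A) : \mathfrak{M}(V) > \psi(\|\mathbf{a}_V\|) \}}{\# \mathbb{V}_{d,n}(A)} = 1. \]
   Context: For an integer $N \geq 1$, $\|\cdot\|$ denotes the Euclidean norm on $\mathbb{R}^N$, and $\mathbb{Z}^N_{\mathrm{prim}}$ denotes the set of $(c_1,\dots,c_N) \in \mathbb{Z}^N$ with $\gcd(c_1,\dots,c_N)=1$. Let $N_{d,n} = \binom{n+d}{d}$ be the number of monomials of degree $d$ in $n+1$ variables. Degree $d$ hypersurfaces in $\mathbb{P}^n$ defined over $\mathbb{Q}$ are parametrized (via their coefficient vectors, monomials listed in lexicographic order) by $\mathbb{V}_{d,n} = \mathbb{P}^{N_{d,n}-1}(\mathbb{Q})$. For $V \in \mathbb{V}_{d,n}$, $\mathbf{a}_V \in \mathbb{Z}^{N_{d,n}}_{\mathrm{prim}}$ denotes either of the two primitive coefficient vectors of $V$, and for $A \geq 1$, $\mathbb{V}_{d,n}(A) = \{V \in \mathbb{V}_{d,n} : \|\mathbf{a}_V\| \leq A\}$. For $x \in \mathbb{P}^n(\mathbb{Q})$, write $x = (x_0 : \dots : x_n)$ with $\mathbf{x} = (x_0,\dots,x_n) \in \mathbb{Z}^{n+1}_{\mathrm{prim}}$ and set $H(x) = \|\mathbf{x}\|^{n+1-d}$.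 For $V \in \mathbb{V}_{d,n}$, $\mathfrak{M}(V) = \min_{x \in V(\mathbb{Q})} H(x)$ if $V(\mathbb{Q}) \neq \emptyset$ and $\mathfrak{M}(V) = \infty$ otherwise. -}

module Defs where

import Algebra.Definitions.RawSemiring
open import Data.Fin.Base using (Fin; zero; suc; cast)
open import Data.Integer.Base as ℤ using (ℤ; +_; 0ℤ)
import Data.Integer.Properties as ℤP
open import Data.List.Base as List using (List; []; _∷_; _++_; length)
import Data.List.Membership.Setoid as Membership
open import Data.List.Properties using (length-map; length-++)
import Data.List.Relation.Unary.Unique.Setoid as UniqueSetoid
open import Data.Nat.Base as ℕ using (ℕ; zero; suc; z≤n; s≤s; _∸_)
open import Data.Nat.Combinatorics using (_C_; nCn≡1; nCk+nC[k+1]≡[n+1]C[k+1])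
open import Data.Nat.Divisibility using (_∣_; divides; ∣-trans)
open import Data.Nat.GCD using (gcd; gcd[m,n]∣m; gcd[m,n]∣n; c*gcd[m,n]≡gcd[cm,cn])
import Data.Nat.Properties as ℕP
open import Data.Nat.Tactic.RingSolver using (solve-∀)
open import Data.Product.Base using (Σ; ∃; ∃₂; _×_; _,_; proj₁; proj₂)
open import Data.Rational.Base as ℚ using (ℚ; 0ℚ; 1ℚ; ½; ∣_∣; toℚᵘ)
import Data.Rational.Properties as ℚP
open import Data.Rational.Solver using (module +-*-Solver)
import Data.Rational.Unnormalised.Base as ℚᵘ
import Data.Rational.Unnormalised.Properties as ℚᵘP
open import Data.Sum.Base using (inj₁; inj₂)
open import Data.Vec.Base as Vec using (Vec)
open import Data.Vec.Functional as Vector using (Vector)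
open import Function.Base using (_∘_)
open import Function.Bundles using (Func; _⇔_)
open import Level using (0ℓ)
open import Relation.Binary.Bundles using (Setoid)
open import Relation.Binary.PropositionalEquality using (_≡_; _≢_; refl; sym; trans; cong; cong₂; subst; subst₂; module ≡-Reasoning)
open import Relation.Nullary.Decidable.Core using (yes; no)
open import Relation.Nullary.Negation.Core using (¬_; contradiction)
open import Relation.Unary using (Pred)

open Algebra.Definitions.RawSemiring ℚ.+-*-rawSemiring using (sum; product; _^_)

record ℝ : Set where
  field
    seq    : ℕ → ℚ
    cauchy : ∀ ε → 0ℚ ℚ.< ε →
             ∃ λ N → ∀ i j → N ℕ.≤ i → N ℕ.≤ j → ∣ seq i ℚ.- seq j ∣ ℚ.< ε
open ℝ public

infix 4 _≈ᴿ_ _<ᴿ_ _≤ᴿ_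

_≈ᴿ_ : ℝ → ℝ → Set
x ≈ᴿ y = ∀ ε → 0ℚ ℚ.< ε →
         ∃ λ N → ∀ i → N ℕ.≤ i → ∣ seq x i ℚ.- seq y i ∣ ℚ.< ε

_<ᴿ_ : ℝ → ℝ → Set
x <ᴿ y = ∃ λ ε → 0ℚ ℚ.< ε × ∃ λ N → ∀ i → N ℕ.≤ i → seq x i ℚ.+ ε ℚ.≤ seq y i

_≤ᴿ_ : ℝ → ℝ → Set
x ≤ᴿ y = ¬ (y <ᴿ x)

private
  half : ∀ {ε} → 0ℚ ℚ.< ε → 0ℚ ℚ.< ½ ℚ.* ε
  half {ε} 0<ε = subst (ℚ._< ½ ℚ.* ε) (ℚP.*-zeroʳ ½) (ℚP.*-monoʳ-<-pos ½ 0<ε)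

  halves : ∀ ε → ½ ℚ.* ε ℚ.+ ½ ℚ.* ε ≡ ε
  halves ε = trans (sym (ℚP.*-distribʳ-+ ε ½ ½)) (ℚP.*-identityˡ ε)

  ∣p-p∣≡0 : ∀ p → ∣ p ℚ.- p ∣ ≡ 0ℚ
  ∣p-p∣≡0 p = cong ∣_∣ (ℚP.+-inverseʳ p)

  swap : ∀ p q → q ℚ.- p ≡ ℚ.- (p ℚ.- q)
  swap = solve 2 (λ p q → q :- p := :- (p :- q)) refl
    where open +-*-Solver

  ∣-∣-sym : ∀ p q → ∣ p ℚ.- q ∣ ≡ ∣ q ℚ.- p ∣
  ∣-∣-sym p q = sym (trans (cong ∣_∣ (swap p q)) (ℚP.∣-p∣≡∣p∣ (p ℚ.- q)))

  via : ∀ p q r → p ℚ.- r ≡ (p ℚ.- q) ℚ.+ (q ℚ.- r)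
  via = solve 3 (λ p q r → p :- r := (p :- q) :+ (q :- r)) refl
    where open +-*-Solver

  triangle : ∀ p q r → ∣ p ℚ.- r ∣ ℚ.≤ ∣ p ℚ.- q ∣ ℚ.+ ∣ q ℚ.- r ∣
  triangle p q r = subst (λ t → ∣ t ∣ ℚ.≤ ∣ p ℚ.- q ∣ ℚ.+ ∣ q ℚ.- r ∣) (sym (via p q r))
    (ℚP.∣p+q∣≤∣p∣+∣q∣ (p ℚ.- q) (q ℚ.- r))

  <-halves : ∀ {p q r} ε → r ℚ.≤ p ℚ.+ q → p ℚ.< ½ ℚ.* ε → q ℚ.< ½ ℚ.* ε → r ℚ.< ε
  <-halves {r = r} ε r≤p+q p<ε/2 q<ε/2 =
    subst (r ℚ.<_) (halves ε) (ℚP.≤-<-trans r≤p+q (ℚP.+-mono-< p<ε/2 q<ε/2))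

ℝ-setoid : Setoid 0ℓ 0ℓ
ℝ-setoid = record
  { Carrier       = ℝ
  ; _≈_           = _≈ᴿ_
  ; isEquivalence = record
    { refl  = λ {x} ε 0<ε → 0 , λ i _ → subst (ℚ._< ε) (sym (∣p-p∣≡0 (seq x i))) 0<ε
    ; sym   = λ {x} {y} x≈y ε 0<ε → let N , x≈y = x≈y ε 0<ε in
        N , λ i N≤i → subst (ℚ._< ε) (∣-∣-sym (seq x i) (seq y i)) (x≈y i N≤i)
    ; trans = λ {x} {y} {z} x≈y y≈z ε 0<ε →
        let M , x≈y = x≈y (½ ℚ.* ε) (half 0<ε)
            N , y≈z = y≈z (½ ℚ.* ε) (half 0<ε)
        in M ℕ.⊔ N , λ i M⊔N≤i → <-halves ε (triangle (seq x i) (seq y i) (seq z i))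
             (x≈y i (ℕP.m⊔n≤o⇒m≤o M N M⊔N≤i)) (y≈z i (ℕP.m⊔n≤o⇒n≤o M N M⊔N≤i))
    }
  }

fromℚ : ℚ → ℝ
fromℚ q .seq _        = q
fromℚ q .cauchy ε 0<ε = 0 , λ _ _ _ _ → subst (ℚ._< ε) (sym (∣p-p∣≡0 q)) 0<ε

private
  0<1+∣p∣ : ∀ p → 0ℚ ℚ.< 1ℚ ℚ.+ ∣ p ∣
  0<1+∣p∣ p = ℚP.+-mono-<-≤ (ℚP.positive⁻¹ 1ℚ) (ℚP.0≤∣p∣ p)

  bounded : ∀ x → ∃ λ B → 0ℚ ℚ.< B × ∃ λ N → ∀ i → N ℕ.≤ i → ∣ seq x i ∣ ℚ.≤ B
  bounded x =
    let N , close = cauchy x 1ℚ (ℚP.positive⁻¹ 1ℚ)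
        a = seq x N
        split = λ b → solve 2 (λ a b → b := (b :- a) :+ a) refl a b
    in 1ℚ ℚ.+ ∣ a ∣ , 0<1+∣p∣ a , N , λ i N≤i →
      subst (λ t → ∣ t ∣ ℚ.≤ 1ℚ ℚ.+ ∣ a ∣) (sym (split (seq x i)))
        (ℚP.≤-trans (ℚP.∣p+q∣≤∣p∣+∣q∣ (seq x i ℚ.- a) a)
          (ℚP.+-monoˡ-≤ ∣ a ∣ (ℚP.<⇒≤ (close i N N≤i ℕP.≤-refl))))
    where open +-*-Solver

  -- δ B ε is ε / (2B)
  module Shrink (B ε : ℚ) (0<B : 0ℚ ℚ.< B) (0<ε : 0ℚ ℚ.< ε) where
    instance
      B-pos : ℚ.Positive B
      B-pos = ℚ.positive 0<B
      B-nonZero : ℚ.NonZero B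
      B-nonZero = ℚP.pos⇒nonZero B
      B-nonNeg : ℚ.NonNegative B
      B-nonNeg = ℚP.pos⇒nonNeg B
      1/B-pos : ℚ.Positive (ℚ.1/ B)
      1/B-pos = ℚP.1/pos⇒pos B

    δ : ℚ
    δ = ℚ.1/ B ℚ.* (½ ℚ.* ε)

    0<δ : 0ℚ ℚ.< δ
    0<δ = subst (ℚ._< δ) (ℚP.*-zeroʳ (ℚ.1/ B)) (ℚP.*-monoʳ-<-pos (ℚ.1/ B) (half 0<ε))

    B*δ : B ℚ.* δ ≡ ½ ℚ.* ε
    B*δ = trans (sym (ℚP.*-assoc B (ℚ.1/ B) (½ ℚ.* ε)))
         (trans (cong (ℚ._* (½ ℚ.* ε)) (ℚP.*-inverseʳ B)) (ℚP.*-identityˡ (½ ℚ.* ε)))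

    shrink : ∀ p q → ∣ p ∣ ℚ.≤ B → ∣ q ∣ ℚ.< δ → ∣ p ℚ.* q ∣ ℚ.< ½ ℚ.* ε
    shrink p q p≤B q<δ = subst₂ ℚ._<_ (sym (ℚP.∣p*q∣≡∣p∣*∣q∣ p q)) B*δ
      (ℚP.≤-<-trans
        (ℚP.*-monoʳ-≤-nonNeg ∣ q ∣ {{ℚ.nonNegative (ℚP.0≤∣p∣ q)}} p≤B)
        (ℚP.*-monoʳ-<-pos B q<δ))

infixl 7 _*ᴿ_
infixr 8 _^ᴿ_

_*ᴿ_ : ℝ → ℝ → ℝ
(x *ᴿ y) .seq i        = seq x i ℚ.* seq y i
(x *ᴿ y) .cauchy ε 0<ε =
  let B , 0<B , K , x≤B = bounded x
      C , 0<C , L , y≤C = bounded y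
      module X = Shrink B ε 0<B 0<ε
      module Y = Shrink C ε 0<C 0<ε
      M , x-close = cauchy x Y.δ Y.0<δ
      N , y-close = cauchy y X.δ X.0<δ
      k = (K ℕ.⊔ L) ℕ.⊔ (M ℕ.⊔ N)
      KL = λ {i} (k≤i : k ℕ.≤ i) → ℕP.m⊔n≤o⇒m≤o (K ℕ.⊔ L) (M ℕ.⊔ N) k≤i
      MN = λ {i} (k≤i : k ℕ.≤ i) → ℕP.m⊔n≤o⇒n≤o (K ℕ.⊔ L) (M ℕ.⊔ N) k≤i
  in k , λ i j k≤i k≤j →
    let xi = seq x i ; xj = seq x j ; yi = seq y i ; yj = seq y j
        eq : xi ℚ.* yi ℚ.- xj ℚ.* yj ≡ xi ℚ.* (yi ℚ.- yj) ℚ.+ yj ℚ.* (xi ℚ.- xj)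
        eq = solve 4 (λ a b c d → a :* b :- c :* d := a :* (b :- d) :+ d :* (a :- c)) refl xi yi xj yj
    in <-halves ε
         (subst (λ t → ∣ t ∣ ℚ.≤ ∣ xi ℚ.* (yi ℚ.- yj) ∣ ℚ.+ ∣ yj ℚ.* (xi ℚ.- xj) ∣) (sym eq)
           (ℚP.∣p+q∣≤∣p∣+∣q∣ (xi ℚ.* (yi ℚ.- yj)) (yj ℚ.* (xi ℚ.- xj))))
         (X.shrink xi (yi ℚ.- yj) (x≤B i (ℕP.m⊔n≤o⇒m≤o K L (KL k≤i)))
           (y-close i j (ℕP.m⊔n≤o⇒n≤o M N (MN k≤i)) (ℕP.m⊔n≤o⇒n≤o M N (MN k≤j))))
         (Y.shrink yj (xi ℚ.- xj) (y≤C j (ℕP.m⊔n≤o⇒n≤o K L (KL k≤j)))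
           (x-close i j (ℕP.m⊔n≤o⇒m≤o M N (MN k≤i)) (ℕP.m⊔n≤o⇒m≤o M N (MN k≤j))))
  where open +-*-Solver

_^ᴿ_ : ℝ → ℕ → ℝ
x ^ᴿ zero  = fromℚ 1ℚ
x ^ᴿ suc k = x *ᴿ x ^ᴿ k

-- isqrt m = ⌊√m⌋
isqrt : ℕ → ℕ
isqrt zero    = zero
isqrt (suc m) with suc (isqrt m) ℕ.* suc (isqrt m) ℕP.≤? suc m
... | yes _ = suc (isqrt m)
... | no  _ = isqrt m

isqrt-lower : ∀ m → isqrt m ℕ.* isqrt m ℕ.≤ m
isqrt-lower zero    = z≤n
isqrt-lower (suc m) with suc (isqrt m) ℕ.* suc (isqrt m) ℕP.≤? suc m
... | yes p = p
... | no  _ = ℕP.m≤n⇒m≤1+n (isqrt-lower m)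

isqrt-upper : ∀ m → m ℕ.< suc (isqrt m) ℕ.* suc (isqrt m)
isqrt-upper zero    = s≤s z≤n
isqrt-upper (suc m) with suc (isqrt m) ℕ.* suc (isqrt m) ℕP.≤? suc m
... | yes _ = ℕP.≤-<-trans (isqrt-upper m) (ℕP.*-mono-< (ℕP.n<1+n (suc (isqrt m))) (ℕP.n<1+n (suc (isqrt m))))
... | no  p = ℕP.≰⇒> p

private
  square-cancel-< : ∀ {a b} → a ℕ.* a ℕ.< b ℕ.* b → a ℕ.< b
  square-cancel-< {a} {b} a²<b² with b ℕP.≤? a
  ... | yes b≤a = contradiction (ℕP.<-≤-trans a²<b² (ℕP.*-mono-≤ b≤a b≤a)) (ℕP.<-irrefl refl)
  ... | no  b≰a = ℕP.≰⇒> b≰a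

  /-mono-< : ∀ a b s t → a ℕ.* suc t ℕ.< b ℕ.* suc s → + a ℚ./ suc s ℚ.< + b ℚ./ suc t
  /-mono-< a b s t at<bs = ℚP.toℚᵘ-cancel-<
    (ℚᵘP.<-respˡ-≃ (ℚᵘP.≃-sym (ℚP.toℚᵘ-fromℚᵘ (ℚᵘ.mkℚᵘ (+ a) s)))
    (ℚᵘP.<-respʳ-≃ (ℚᵘP.≃-sym (ℚP.toℚᵘ-fromℚᵘ (ℚᵘ.mkℚᵘ (+ b) t)))
    (ℚᵘ.*<* (subst₂ ℤ._<_ (ℤP.pos-* a (suc t)) (ℤP.pos-* b (suc s)) (ℤ.+<+ at<bs)))))

  /-suc : ∀ b t → + suc b ℚ./ suc t ≡ + b ℚ./ suc t ℚ.+ + 1 ℚ./ suc t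
  /-suc b t = ℚP.toℚᵘ-injective (begin
    toℚᵘ (+ suc b ℚ./ suc t)                          ≈⟨ ℚP.toℚᵘ-fromℚᵘ (ℚᵘ.mkℚᵘ (+ suc b) t) ⟩
    ℚᵘ.mkℚᵘ (+ suc b) t                               ≈⟨ ℚᵘ.*≡* (trans (sym (ℤP.pos-* (suc b) (suc t ℕ.* suc t)))
                                                          (trans (cong +_ (lemma b (suc t))) (main))) ⟩
    ℚᵘ.mkℚᵘ (+ b) t ℚᵘ.+ ℚᵘ.mkℚᵘ (+ 1) t               ≈⟨ ℚᵘP.+-cong (ℚP.toℚᵘ-fromℚᵘ (ℚᵘ.mkℚᵘ (+ b) t)) (ℚP.toℚᵘ-fromℚᵘ (ℚᵘ.mkℚᵘ (+ 1) t)) ⟨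
    toℚᵘ (+ b ℚ./ suc t) ℚᵘ.+ toℚᵘ (+ 1 ℚ./ suc t)     ≈⟨ ℚP.toℚᵘ-homo-+ (+ b ℚ./ suc t) (+ 1 ℚ./ suc t) ⟨
    toℚᵘ (+ b ℚ./ suc t ℚ.+ + 1 ℚ./ suc t)             ∎)
    where
    open ℚᵘP.≃-Reasoning
    lemma : ∀ b t → suc b ℕ.* (t ℕ.* t) ≡ (b ℕ.* t ℕ.+ 1 ℕ.* t) ℕ.* t
    lemma = solve-∀
    main : + ((b ℕ.* suc t ℕ.+ 1 ℕ.* suc t) ℕ.* suc t) ≡ (+ b ℤ.* + suc t ℤ.+ + 1 ℤ.* + suc t) ℤ.* + suc t
    main = trans (ℤP.pos-* (b ℕ.* suc t ℕ.+ 1 ℕ.* suc t) (suc t))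
      (cong (ℤ._* + suc t) (trans (ℤP.pos-+ (b ℕ.* suc t) (1 ℕ.* suc t))
        (cong₂ ℤ._+_ (ℤP.pos-* b (suc t)) (ℤP.pos-* 1 (suc t)))))

  1/n<ε : ∀ ε → 0ℚ ℚ.< ε → ∀ k → ℚ.↧ₙ ε ℕ.≤ k → + 1 ℚ./ suc k ℚ.< ε
  1/n<ε ε 0<ε k ε≤k with ℚ.positive 0<ε
  1/n<ε ε@(ℚ.mkℚ (ℤ.+[1+ p ]) q _) 0<ε k q≤k | _ = ℚP.toℚᵘ-cancel-<
    (ℚᵘP.<-respˡ-≃ (ℚᵘP.≃-sym (ℚP.toℚᵘ-fromℚᵘ (ℚᵘ.mkℚᵘ (+ 1) k)))
    (ℚᵘ.*<* (subst₂ ℤ._<_ (ℤP.pos-* 1 (suc q)) (ℤP.pos-* (suc p) (suc k))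
      (ℤ.+<+ (ℕP.≤-<-trans (ℕP.≤-reflexive (ℕP.*-identityˡ (suc q)))
        (ℕP.<-≤-trans (s≤s q≤k) (ℕP.m≤m+n (suc k) (p ℕ.* suc k))))))))

  root : ℕ → ℕ → ℕ
  root m k = isqrt (m ℕ.* (suc k ℕ.* suc k))

  root-cross : ∀ m s t → root m s ℕ.* suc t ℕ.< suc (root m t) ℕ.* suc s
  root-cross m s t = square-cancel-< (begin-strict
    (a ℕ.* suc t) ℕ.* (a ℕ.* suc t)                  ≡⟨ shuffle a (suc t) ⟩
    (a ℕ.* a) ℕ.* (suc t ℕ.* suc t)                  ≤⟨ ℕP.*-monoˡ-≤ (suc t ℕ.* suc t) (isqrt-lower (m ℕ.* (suc s ℕ.* suc s))) ⟩
    (m ℕ.* (suc s ℕ.* suc s)) ℕ.* (suc t ℕ.* suc t)  ≡⟨ shuffle′ m (suc s ℕ.* suc s) (suc t ℕ.* suc t) ⟩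
    (m ℕ.* (suc t ℕ.* suc t)) ℕ.* (suc s ℕ.* suc s)  <⟨ ℕP.*-monoˡ-< (suc s ℕ.* suc s) (isqrt-upper (m ℕ.* (suc t ℕ.* suc t))) ⟩
    (b ℕ.* b) ℕ.* (suc s ℕ.* suc s)                  ≡⟨ shuffle b (suc s) ⟨
    (b ℕ.* suc s) ℕ.* (b ℕ.* suc s)                  ∎)
    where
    open ℕP.≤-Reasoning
    a = root m s
    b = suc (root m t)
    shuffle : ∀ a t → (a ℕ.* t) ℕ.* (a ℕ.* t) ≡ (a ℕ.* a) ℕ.* (t ℕ.* t)
    shuffle = solve-∀
    shuffle′ : ∀ m s t → (m ℕ.* s) ℕ.* t ≡ (m ℕ.* t) ℕ.* s
    shuffle′ = solve-∀

  ∣-∣-< : ∀ {p q ε} → p ℚ.< q ℚ.+ ε → q ℚ.< p ℚ.+ ε → ∣ p ℚ.- q ∣ ℚ.< ε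
  ∣-∣-< {p} {q} {ε} p<q+ε q<p+ε with ℚP.∣p∣≡p∨∣p∣≡-p (p ℚ.- q)
  ... | inj₁ eq = subst₂ ℚ._<_ (sym eq) (cancel q ε) (ℚP.+-monoˡ-< (ℚ.- q) p<q+ε)
    where
    cancel : ∀ q ε → (q ℚ.+ ε) ℚ.- q ≡ ε
    cancel = +-*-Solver.solve 2 (λ q ε → let open +-*-Solver in (q :+ ε) :- q := ε) refl
  ... | inj₂ eq = subst₂ ℚ._<_ (trans (swap p q) (sym eq)) (cancel p ε) (ℚP.+-monoˡ-< (ℚ.- p) q<p+ε)
    where
    cancel : ∀ q ε → (q ℚ.+ ε) ℚ.- q ≡ ε
    cancel = +-*-Solver.solve 2 (λ q ε → let open +-*-Solver in (q :+ ε) :- q := ε) refl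

-- The square root of a natural number: the k-th approximation is
-- ⌊(k+1)√m⌋ / (k+1), which is within 1/(k+1) of √m.
√ : ℕ → ℝ
√ m .seq k        = + isqrt (m ℕ.* (suc k ℕ.* suc k)) ℚ./ suc k
√ m .cauchy ε 0<ε = ℚ.↧ₙ ε , λ i j i≥ j≥ → ∣-∣-< (near i j j≥) (near j i i≥)
  where
  near : ∀ i j → ℚ.↧ₙ ε ℕ.≤ j →
         + root m i ℚ./ suc i ℚ.< + root m j ℚ./ suc j ℚ.+ ε
  near i j j≥ = ℚP.<-trans
    (subst (+ root m i ℚ./ suc i ℚ.<_) (/-suc (root m j) j)
      (/-mono-< (root m i) (suc (root m j)) i j (root-cross m i j)))
    (ℚP.+-monoʳ-< (+ root m j ℚ./ suc j) (1/n<ε ε 0<ε j j≥))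

√-positive : ∀ m → m ≢ 0 → fromℚ 0ℚ <ᴿ √ m
√-positive zero    m≢0 = contradiction refl m≢0
√-positive (suc m) _   = ½ , ℚP.positive⁻¹ ½ , 0 , λ k _ →
  ℚP.<⇒≤ (subst (ℚ._< + root (suc m) k ℚ./ suc k) (sym (ℚP.+-identityˡ ½))
    (/-mono-< 1 (root (suc m) k) 1 k (bound k)))
  where
  bound : ∀ k → 1 ℕ.* suc k ℕ.< root (suc m) k ℕ.* 2
  bound k = begin-strict
    1 ℕ.* suc k              ≡⟨ ℕP.*-identityˡ (suc k) ⟩
    suc k                    <⟨ ℕP.m<m*n (suc k) 2 (s≤s (s≤s z≤n)) ⟩
    suc k ℕ.* 2              ≤⟨ ℕP.*-monoˡ-≤ 2 (ℕ.s≤s⁻¹ (square-cancel-< {suc k} {suc (root (suc m) k)} (ℕP.≤-<-trans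
                                  (ℕP.m≤m+n (suc k ℕ.* suc k) (m ℕ.* (suc k ℕ.* suc k)))
                                  (isqrt-upper (suc m ℕ.* (suc k ℕ.* suc k)))))) ⟩
    root (suc m) k ℕ.* 2     ∎
    where open ℕP.≤-Reasoning

-- ℝ_{>0}. Extensional functions between setoids are represented by Func, so a
-- real function ℝ_{>0} → ℝ_{>0} is an element of Func ℝ₊ ℝ₊.
ℝ₊ : Setoid 0ℓ 0ℓ
ℝ₊ = record
  { Carrier       = Σ ℝ (fromℚ 0ℚ <ᴿ_)
  ; _≈_           = λ x y → proj₁ x ≈ᴿ proj₁ y
  ; isEquivalence = record
    { refl  = λ {x} → S.refl {proj₁ x}
    ; sym   = λ {x} {y} → S.sym {proj₁ x} {proj₁ y}
    ; trans = λ {x} {y} {z} → S.trans {proj₁ x} {proj₁ y} {proj₁ z}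
    }
  }
  where module S = Setoid ℝ-setoid

-- The points of ℙ^{N-1}(ℚ), by N homogeneous coordinates.
record Projective (N : ℕ) : Set where
  field
    coord   : Vector ℚ N
    nonzero : ∃ λ i → coord i ≢ 0ℚ
open Projective public

infix 4 _∼_

_∼_ : ∀ {N} → Projective N → Projective N → Set
x ∼ y = ∃ λ c → c ≢ 0ℚ × ∀ i → coord x i ≡ c ℚ.* coord y i

private
  *-≢0 : ∀ {p q} → p ≢ 0ℚ → q ≢ 0ℚ → p ℚ.* q ≢ 0ℚ
  *-≢0 {p} {q} p≢0 q≢0 pq≡0 = q≢0 (begin
    q                          ≡⟨ ℚP.*-identityˡ q ⟨
    1ℚ ℚ.* q                   ≡⟨ cong (ℚ._* q) (ℚP.*-inverseˡ p) ⟨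
    (ℚ.1/ p ℚ.* p) ℚ.* q       ≡⟨ ℚP.*-assoc (ℚ.1/ p) p q ⟩
    ℚ.1/ p ℚ.* (p ℚ.* q)       ≡⟨ cong (ℚ.1/ p ℚ.*_) pq≡0 ⟩
    ℚ.1/ p ℚ.* 0ℚ              ≡⟨ ℚP.*-zeroʳ (ℚ.1/ p) ⟩
    0ℚ                         ∎)
    where
    open ≡-Reasoning
    instance
      p-nonZero : ℚ.NonZero p
      p-nonZero = ℚ.≢-nonZero p≢0

  inverse : ∀ c → c ≢ 0ℚ → ∃ λ c⁻¹ → c⁻¹ ≢ 0ℚ × ∀ p q → p ≡ c ℚ.* q → q ≡ c⁻¹ ℚ.* p
  inverse c c≢0 = ℚ.1/ c , 1/c≢0 , λ p q p≡cq → begin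
    q                          ≡⟨ ℚP.*-identityˡ q ⟨
    1ℚ ℚ.* q                   ≡⟨ cong (ℚ._* q) (ℚP.*-inverseˡ c) ⟨
    (ℚ.1/ c ℚ.* c) ℚ.* q       ≡⟨ ℚP.*-assoc (ℚ.1/ c) c q ⟩
    ℚ.1/ c ℚ.* (c ℚ.* q)       ≡⟨ cong (ℚ.1/ c ℚ.*_) p≡cq ⟨
    ℚ.1/ c ℚ.* p               ∎
    where
    open ≡-Reasoning
    instance
      c-nonZero : ℚ.NonZero c
      c-nonZero = ℚ.≢-nonZero c≢0
    1/c≢0 : ℚ.1/ c ≢ 0ℚ
    1/c≢0 eq = ℚP.1≢0 (trans (sym (ℚP.*-inverseʳ c)) (trans (cong (c ℚ.*_) eq) (ℚP.*-zeroʳ c)))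

ℙ-coords : ℕ → Setoid 0ℓ 0ℓ
ℙ-coords N = record
  { Carrier       = Projective N
  ; _≈_           = _∼_
  ; isEquivalence = record
    { refl  = λ {x} → 1ℚ , ℚP.1≢0 , λ i → sym (ℚP.*-identityˡ (coord x i))
    ; sym   = λ {x} {y} (c , c≢0 , x≡cy) → let c⁻¹ , c⁻¹≢0 , solve = inverse c c≢0 in
        c⁻¹ , c⁻¹≢0 , λ i → solve (coord x i) (coord y i) (x≡cy i)
    ; trans = λ {x} {y} {z} (b , b≢0 , x≡by) (c , c≢0 , y≡cz) →
        b ℚ.* c , *-≢0 b≢0 c≢0 , λ i →
          trans (x≡by i) (trans (cong (b ℚ.*_) (y≡cz i)) (sym (ℚP.*-assoc b c (coord z i))))
    }
  }

content : ∀ {N} → Vector ℤ N → ℕ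
content = Vector.foldr (λ a g → gcd ℤ.∣ a ∣ g) 0

normSq : ∀ {N} → Vector ℤ N → ℕ
normSq = Vector.foldr (λ a s → ℤ.∣ a ∣ ℕ.* ℤ.∣ a ∣ ℕ.+ s) 0

‖_‖ : ∀ {N} → Vector ℤ N → ℝ
‖ a ‖ = √ (normSq a)

Primitive : ∀ {N} → Vector ℤ N → Set
Primitive a = content a ≡ 1

infix 4 _Represents_

_Represents_ : ∀ {N} → Vector ℤ N → Projective N → Set
a Represents x = ∃ λ c → c ≢ 0ℚ × ∀ i → coord x i ≡ c ℚ.* (a i ℚ./ 1)

private
  /1-homo-* : ∀ a b → (a ℤ.* b) ℚ./ 1 ≡ (a ℚ./ 1) ℚ.* (b ℚ./ 1)
  /1-homo-* a b = ℚP.toℚᵘ-injective (begin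
    toℚᵘ ((a ℤ.* b) ℚ./ 1)                 ≈⟨ ℚP.toℚᵘ-fromℚᵘ (ℚᵘ.mkℚᵘ (a ℤ.* b) 0) ⟩
    ℚᵘ.mkℚᵘ a 0 ℚᵘ.* ℚᵘ.mkℚᵘ b 0           ≈⟨ ℚᵘP.*-cong (ℚP.toℚᵘ-fromℚᵘ (ℚᵘ.mkℚᵘ a 0)) (ℚP.toℚᵘ-fromℚᵘ (ℚᵘ.mkℚᵘ b 0)) ⟨
    toℚᵘ (a ℚ./ 1) ℚᵘ.* toℚᵘ (b ℚ./ 1)     ≈⟨ ℚP.toℚᵘ-homo-* (a ℚ./ 1) (b ℚ./ 1) ⟨
    toℚᵘ ((a ℚ./ 1) ℚ.* (b ℚ./ 1))         ∎)
    where open ℚᵘP.≃-Reasoning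

  /1-≢0 : ∀ a → a ≢ 0ℤ → a ℚ./ 1 ≢ 0ℚ
  /1-≢0 a a≢0 eq = a≢0 (trans (sym (ℤP.*-identityʳ a))
    (trans (ℚᵘP.drop-*≡* (ℚᵘP.≃-trans (ℚᵘP.≃-sym (ℚP.toℚᵘ-fromℚᵘ (ℚᵘ.mkℚᵘ a 0)))
                                      (ℚᵘP.≃-reflexive (cong toℚᵘ eq))))
           (ℤP.*-zeroˡ (+ 1))))

  numerator : ∀ q → (+ ℚ.↧ₙ q ℚ./ 1) ℚ.* q ≡ ℚ.↥ q ℚ./ 1
  numerator q = ℚP.toℚᵘ-injective (begin
    toℚᵘ ((+ ℚ.↧ₙ q ℚ./ 1) ℚ.* q)          ≈⟨ ℚP.toℚᵘ-homo-* (+ ℚ.↧ₙ q ℚ./ 1) q ⟩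
    toℚᵘ (+ ℚ.↧ₙ q ℚ./ 1) ℚᵘ.* toℚᵘ q      ≈⟨ ℚᵘP.*-congʳ {toℚᵘ q} (ℚP.toℚᵘ-fromℚᵘ (ℚᵘ.mkℚᵘ (+ ℚ.↧ₙ q) 0)) ⟩
    ℚᵘ.mkℚᵘ (+ ℚ.↧ₙ q) 0 ℚᵘ.* toℚᵘ q       ≈⟨ cancel q ⟩
    ℚᵘ.mkℚᵘ (ℚ.↥ q) 0                      ≈⟨ ℚP.toℚᵘ-fromℚᵘ (ℚᵘ.mkℚᵘ (ℚ.↥ q) 0) ⟨
    toℚᵘ (ℚ.↥ q ℚ./ 1)                     ∎)
    where
    open ℚᵘP.≃-Reasoning
    cancel : ∀ q → ℚᵘ.mkℚᵘ (+ ℚ.↧ₙ q) 0 ℚᵘ.* toℚᵘ q ℚᵘ.≃ ℚᵘ.mkℚᵘ (ℚ.↥ q) 0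
    cancel (ℚ.mkℚ n d _) = ℚᵘ.*≡* (trans (ℤP.*-identityʳ (+ suc d ℤ.* n))
      (trans (ℤP.*-comm (+ suc d) n)
        (cong (λ t → n ℤ.* + suc t) (sym (ℕP.+-identityʳ d)))))

  clear-denominators : ∀ {N} (x : Vector ℚ N) → ∃₂ λ (D : ℤ) (z : Vector ℤ N) →
    D ≢ 0ℤ × ∀ i → (D ℚ./ 1) ℚ.* x i ≡ z i ℚ./ 1
  clear-denominators {zero}  x = + 1 , (λ ()) , (λ ()) , λ ()
  clear-denominators {suc N} x =
    let D , z , D≢0 , Dx≡z = clear-denominators (x ∘ suc)
        e = + ℚ.↧ₙ (x zero)
    in D ℤ.* e , (D ℤ.* ℚ.↥ x zero) Vector.∷ (λ i → e ℤ.* z i) ,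
       (λ De≡0 → nonzero-product D e D≢0 (λ ()) De≡0) ,
       λ { zero → begin
             ((D ℤ.* e) ℚ./ 1) ℚ.* x zero               ≡⟨ cong (ℚ._* x zero) (/1-homo-* D e) ⟩
             ((D ℚ./ 1) ℚ.* (e ℚ./ 1)) ℚ.* x zero       ≡⟨ ℚP.*-assoc (D ℚ./ 1) (e ℚ./ 1) (x zero) ⟩
             (D ℚ./ 1) ℚ.* ((e ℚ./ 1) ℚ.* x zero)       ≡⟨ cong ((D ℚ./ 1) ℚ.*_) (numerator (x zero)) ⟩
             (D ℚ./ 1) ℚ.* (ℚ.↥ x zero ℚ./ 1)           ≡⟨ /1-homo-* D (ℚ.↥ x zero) ⟨
             (D ℤ.* ℚ.↥ x zero) ℚ./ 1                   ∎
         ; (suc i) → begin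
             ((D ℤ.* e) ℚ./ 1) ℚ.* x (suc i)            ≡⟨ cong (λ t → (t ℚ./ 1) ℚ.* x (suc i)) (ℤP.*-comm D e) ⟩
             ((e ℤ.* D) ℚ./ 1) ℚ.* x (suc i)            ≡⟨ cong (ℚ._* x (suc i)) (/1-homo-* e D) ⟩
             ((e ℚ./ 1) ℚ.* (D ℚ./ 1)) ℚ.* x (suc i)    ≡⟨ ℚP.*-assoc (e ℚ./ 1) (D ℚ./ 1) (x (suc i)) ⟩
             (e ℚ./ 1) ℚ.* ((D ℚ./ 1) ℚ.* x (suc i))    ≡⟨ cong ((e ℚ./ 1) ℚ.*_) (Dx≡z i) ⟩
             (e ℚ./ 1) ℚ.* (z i ℚ./ 1)                  ≡⟨ /1-homo-* e (z i) ⟨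
             (e ℤ.* z i) ℚ./ 1                          ∎ }
    where
    open ≡-Reasoning
    nonzero-product : ∀ a b → a ≢ 0ℤ → b ≢ 0ℤ → a ℤ.* b ≢ 0ℤ
    nonzero-product a b a≢0 b≢0 ab≡0 with ℤP.i*j≡0⇒i≡0∨j≡0 a ab≡0
    ... | inj₁ a≡0 = a≢0 a≡0
    ... | inj₂ b≡0 = b≢0 b≡0

  content-∣ : ∀ {N} (z : Vector ℤ N) i → content z ∣ ℤ.∣ z i ∣
  content-∣ z zero    = gcd[m,n]∣m ℤ.∣ z zero ∣ (content (z ∘ suc))
  content-∣ z (suc i) = ∣-trans (gcd[m,n]∣n ℤ.∣ z zero ∣ (content (z ∘ suc))) (content-∣ (z ∘ suc) i)

  content-scale : ∀ {N} g (z a : Vector ℤ N) → (∀ i → z i ≡ + g ℤ.* a i) →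
                  content z ≡ g ℕ.* content a
  content-scale {zero}  g z a z≡ga = sym (ℕP.*-zeroʳ g)
  content-scale {suc N} g z a z≡ga = trans
    (cong₂ gcd (trans (cong ℤ.∣_∣ (z≡ga zero)) (ℤP.abs-* (+ g) (a zero)))
               (content-scale g (z ∘ suc) (a ∘ suc) (z≡ga ∘ suc)))
    (sym (c*gcd[m,n]≡gcd[cm,cn] g ℤ.∣ a zero ∣ (content (a ∘ suc))))

  signed-quotient : ∀ g z → g ∣ ℤ.∣ z ∣ → ∃ λ a → z ≡ + g ℤ.* a
  signed-quotient g (+ n)      (divides q n≡qg) =
    + q , trans (cong +_ (trans n≡qg (ℕP.*-comm q g))) (ℤP.pos-* g q)
  signed-quotient g ℤ.-[1+ n ] (divides q n≡qg) =
    ℤ.- + q , trans (cong (ℤ.-_ ∘ +_) (trans n≡qg (ℕP.*-comm q g)))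
             (trans (cong ℤ.-_ (ℤP.pos-* g q)) (ℤP.neg-distribʳ-* (+ g) (+ q)))

primVec-exists : ∀ {N} (x : Projective N) → ∃ λ a → Primitive a × a Represents x
primVec-exists x =
  let D , z , D≢0 , Dx≡z = clear-denominators (coord x)
      D⁻¹ , D⁻¹≢0 , divide = inverse (D ℚ./ 1) (/1-≢0 D D≢0)
      g = content z
      a = λ i → proj₁ (signed-quotient g (z i) (content-∣ z i))
      z≡ga = λ i → proj₂ (signed-quotient g (z i) (content-∣ z i))
      x≡z = λ i → divide (z i ℚ./ 1) (coord x i) (sym (Dx≡z i))
      j , xj≢0 = nonzero x
      g≢0 : g ≢ 0
      g≢0 g≡0 = xj≢0 (trans (x≡z j) (trans
        (cong (λ t → D⁻¹ ℚ.* (t ℚ./ 1)) (trans (z≡ga j) (trans (cong (λ t → + t ℤ.* a j) g≡0) (ℤP.*-zeroˡ (a j)))))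
        (ℚP.*-zeroʳ D⁻¹)))
      +g≢0 : + g ≢ 0ℤ
      +g≢0 eq = g≢0 (ℤP.+-injective eq)
  in a ,
     sym (ℕP.*-cancelˡ-≡ 1 (content a) g {{ℕ.≢-nonZero g≢0}}
       (trans (ℕP.*-identityʳ g) (content-scale g z a z≡ga))) ,
     D⁻¹ ℚ.* (+ g ℚ./ 1) , *-≢0 D⁻¹≢0 (/1-≢0 (+ g) +g≢0) , λ i →
       trans (x≡z i) (trans (cong (λ t → D⁻¹ ℚ.* (t ℚ./ 1)) (z≡ga i))
         (trans (cong (D⁻¹ ℚ.*_) (/1-homo-* (+ g) (a i)))
                (sym (ℚP.*-assoc D⁻¹ (+ g ℚ./ 1) (a i ℚ./ 1)))))

-- One of the two primitive integer vectors representing x; the other is its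
-- negative, so ‖ primVec x ‖ does not depend on the choice.
primVec : ∀ {N} → Projective N → Vector ℤ N
primVec x = proj₁ (primVec-exists x)

‖primVec‖-positive : ∀ {N} (x : Projective N) → fromℚ 0ℚ <ᴿ ‖ primVec x ‖
‖primVec‖-positive x = √-positive (normSq a) λ s≡0 →
  contradiction (trans (sym (normSq≡0⇒content≡0 a s≡0)) (proj₁ (proj₂ (primVec-exists x)))) λ ()
  where
  a = primVec x
  normSq≡0⇒content≡0 : ∀ {N} (a : Vector ℤ N) → normSq a ≡ 0 → content a ≡ 0
  normSq≡0⇒content≡0 {zero}  a _   = refl
  normSq≡0⇒content≡0 {suc N} a s≡0
    with ℕP.m*n≡0⇒m≡0∨n≡0 ℤ.∣ a zero ∣ (ℕP.m+n≡0⇒m≡0 (ℤ.∣ a zero ∣ ℕ.* ℤ.∣ a zero ∣) s≡0)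
  ... | inj₁ eq = cong₂ gcd eq (normSq≡0⇒content≡0 (a ∘ suc) (ℕP.m+n≡0⇒n≡0 (ℤ.∣ a zero ∣ ℕ.* ℤ.∣ a zero ∣) s≡0))
  ... | inj₂ eq = cong₂ gcd eq (normSq≡0⇒content≡0 (a ∘ suc) (ℕP.m+n≡0⇒n≡0 (ℤ.∣ a zero ∣ ℕ.* ℤ.∣ a zero ∣) s≡0))

-- Exponent vectors of the degree d monomials in k variables, in lexicographic
-- order: those divisible by the first variable precede the others.
monomials : ∀ k → ℕ → List (Vec ℕ k)
monomials k       zero    = Vec.replicate k 0 ∷ []
monomials zero    (suc d) = []
monomials (suc k) (suc d) =
  List.map (λ e → suc (Vec.head e) Vec.∷ Vec.tail e) (monomials (suc k) d)
  ++ List.map (0 Vec.∷_) (monomials k (suc d))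

length-monomials : ∀ n d → length (monomials (suc n) d) ≡ (n ℕ.+ d) C d
length-monomials n       zero    = refl
length-monomials zero    (suc d) = begin
  length (List.map inc (monomials 1 d) ++ [])   ≡⟨ length-++ (List.map inc (monomials 1 d)) ⟩
  length (List.map inc (monomials 1 d)) ℕ.+ 0   ≡⟨ ℕP.+-identityʳ _ ⟩
  length (List.map inc (monomials 1 d))         ≡⟨ length-map inc (monomials 1 d) ⟩
  length (monomials 1 d)                        ≡⟨ length-monomials 0 d ⟩
  d C d                                         ≡⟨ nCn≡1 d ⟩
  1                                             ≡⟨ nCn≡1 (suc d) ⟨
  suc d C suc d                                 ∎
  where
  open ≡-Reasoning
  inc : Vec ℕ 1 → Vec ℕ 1
  inc e = suc (Vec.head e) Vec.∷ Vec.tail e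
length-monomials (suc n) (suc d) = begin
  length (List.map inc with-x₀ ++ List.map (0 Vec.∷_) without-x₀)
    ≡⟨ length-++ (List.map inc with-x₀) ⟩
  length (List.map inc with-x₀) ℕ.+ length (List.map (0 Vec.∷_) without-x₀)
    ≡⟨ cong₂ ℕ._+_ (length-map inc with-x₀) (length-map (0 Vec.∷_) without-x₀) ⟩
  length with-x₀ ℕ.+ length without-x₀
    ≡⟨ cong₂ ℕ._+_ (length-monomials (suc n) d) (length-monomials n (suc d)) ⟩
  suc (n ℕ.+ d) C d ℕ.+ (n ℕ.+ suc d) C suc d
    ≡⟨ cong (λ m → suc (n ℕ.+ d) C d ℕ.+ m C suc d) (ℕP.+-suc n d) ⟩
  suc (n ℕ.+ d) C d ℕ.+ suc (n ℕ.+ d) C suc d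
    ≡⟨ nCk+nC[k+1]≡[n+1]C[k+1] (suc (n ℕ.+ d)) d ⟩
  suc (suc (n ℕ.+ d)) C suc d
    ≡⟨ cong (λ m → suc m C suc d) (ℕP.+-suc n d) ⟨
  (suc n ℕ.+ suc d) C suc d ∎
  where
  open ≡-Reasoning
  inc : Vec ℕ (suc (suc n)) → Vec ℕ (suc (suc n))
  inc e = suc (Vec.head e) Vec.∷ Vec.tail e
  with-x₀    = monomials (suc (suc n)) d
  without-x₀ = monomials (suc n) (suc d)

data ℝ∞ : Set where
  fin : ℝ → ℝ∞
  ∞   : ℝ∞

infix 4 _<∞_

data _<∞_ : ℝ∞ → ℝ∞ → Set where
  fin<fin : ∀ {x y} → x <ᴿ y → fin x <∞ fin y
  fin<∞   : ∀ {x} → fin x <∞ ∞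

module Hypersurfaces (d n : ℕ) where

  N : ℕ
  N = (n ℕ.+ d) C d

  monomial : Fin N → Vec ℕ (suc n)
  monomial i = List.lookup (monomials (suc n) d) (cast (sym (length-monomials n d)) i)

  ℙⁿ : Setoid 0ℓ 0ℓ
  ℙⁿ = ℙ-coords (suc n)

  𝕍 : Setoid 0ℓ 0ℓ
  𝕍 = ℙ-coords N

  open Setoid ℙⁿ using () renaming (Carrier to Point)
  open Setoid 𝕍 using () renaming (Carrier to Hypersurface)

  evaluate : Vector ℚ N → Vector ℚ (suc n) → ℚ
  evaluate a x = sum λ i → a i ℚ.* product λ j → x j ^ Vec.lookup (monomial i) j

  infix 4 _LiesOn_

  _LiesOn_ : Point → Hypersurface → Set
  x LiesOn V = evaluate (coord V) (coord x) ≡ 0ℚ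

  H : Point → ℝ
  H x = ‖ primVec x ‖ ^ᴿ (suc n ∸ d)

  -- The graph of 𝔐 : whether V has a rational point is not known to be
  -- decidable, so 𝔐 cannot be given as a function of V.
  data 𝔐[_]≡_ (V : Hypersurface) : ℝ∞ → Set where
    attained : ∀ x → x LiesOn V → (∀ y → y LiesOn V → H x ≤ᴿ H y) → 𝔐[ V ]≡ fin (H x)
    no-point : (∀ x → ¬ x LiesOn V) → 𝔐[ V ]≡ ∞

  𝕍[_] : ℝ → Pred Hypersurface 0ℓ
  𝕍[ A ] V = ‖ primVec V ‖ ≤ᴿ A

  ‖𝐚_‖ : Hypersurface → Setoid.Carrier ℝ₊
  ‖𝐚 V ‖ = ‖ primVec V ‖ , ‖primVec‖-positive V

  𝔐[_]>_ : Hypersurface → ℝ → Set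
  𝔐[ V ]> t = ∃ λ m → 𝔐[ V ]≡ m × fin t <∞ m

HasCardinality : (S : Setoid 0ℓ 0ℓ) → Pred (Setoid.Carrier S) 0ℓ → ℕ → Set
HasCardinality S P k = ∃ λ xs → Unique xs × (∀ x → x ∈ xs ⇔ P x) × length xs ≡ k
  where
  open UniqueSetoid S using (Unique)
  open Membership S using (_∈_)

-- q is the ratio # P / # Q.
HasRatio : (S : Setoid 0ℓ 0ℓ) (P Q : Pred (Setoid.Carrier S) 0ℓ) → ℚ → Set
HasRatio S P Q q = ∃₂ λ k l → Σ (ℕ.NonZero l) λ l≢0 →
  HasCardinality S P k × HasCardinality S Q l × q ≡ (+ k ℚ./ l) {{l≢0}}

-- Limit as A → ∞ of the rational-valued function with graph F. Membership in a
-- set cut out by real inequalities is undecidable, so that constructively its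
-- exact cardinality exists only up to double negation; classically ¬ ¬ ∃ is ∃.
TendsTo : (F : ℝ → ℚ → Set) → ℚ → Set
TendsTo F L = ∀ ε → 0ℚ ℚ.< ε → ∃ λ A₀ → ∀ A → A₀ ≤ᴿ A →
  ¬ ¬ (∃ λ q → F A q × ∣ q ℚ.- L ∣ ℚ.< ε)

-- ψ(u) = o(u) as u → ∞
IsLittleO : Func ℝ₊ ℝ₊ → Set
IsLittleO ψ = ∀ ε → 0ℚ ℚ.< ε → ∃ λ U → ∀ u → U ≤ᴿ proj₁ u →
  proj₁ (Func.to ψ u) ≤ᴿ fromℚ ε *ᴿ proj₁ u

{-# OPTIONS --safe #-}

-- An exceptional V passes through a point x with ‖x‖^(n+1-d) ≤ ψ(‖a_V‖), which
-- is at most ε A once ‖a_V‖ is large.  Let m = max |xᵢ| ≤ A.  Since x is primitive,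
-- every v in [0, A m^d) is the value at x of an integral form of degree d with
-- coefficients O(A).  The translates by these forms of the set of the forms of
-- size A vanishing at x are disjoint, so this set has O(A^(N-1) / m^d) elements.
-- There are O(m^n) points x with max |xᵢ| = m; summing over m ≤ (ε A)^(1/(n+1-d))
-- gives O(ε A^N) exceptional V, whereas 𝕍(A) contains a positive proportion
-- of the A^N vectors, because 1/2² + 1/3² + ⋯ < 1.
module Submission where

open import Defs
open import Algebra.Bundles using (AbelianGroup; CommutativeRing)
import Algebra.Definitions.RawSemiring
import Algebra.Properties.Group
import Algebra.Properties.Semiring.Sum
open import Data.Fin.Base using (Fin; zero; suc; cast; toℕ)
import Data.Fin.Properties as FinP
open import Data.Integer.Base as ℤ using (ℤ; +_; -[1+_]; 0ℤ; 1ℤ)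
import Data.Integer.DivMod as ℤDM
import Data.Integer.Properties as ℤP
import Data.Integer.Tactic.RingSolver as ℤSolver
open import Data.List.Base as List using (List; []; _∷_; _++_; length)
open import Data.List.Membership.Propositional using (_∈_)
import Data.List.Membership.Propositional.Properties as ∈P
import Data.List.Membership.Setoid as Membership
import Data.List.Membership.Setoid.Properties as MembershipP
import Data.List.Properties as ListP
open import Data.List.Relation.Binary.Sublist.Propositional using (_⊆_; []; _∷_; _∷ʳ_)
open import Data.List.Relation.Binary.Sublist.Propositional.Properties using (All-resp-⊆)
open import Data.List.Relation.Unary.All as All using (All; []; _∷_)
import Data.List.Relation.Unary.All.Properties as AllP
open import Data.List.Relation.Unary.AllPairs using (AllPairs; []; _∷_)
open import Data.List.Relation.Unary.Any as Any using (Any; here; there)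
import Data.List.Relation.Unary.Any.Properties as AnyP
open import Data.List.Relation.Unary.Unique.Propositional using (Unique)
import Data.List.Relation.Unary.Unique.Propositional.Properties as UniqueP
import Data.List.Relation.Unary.Unique.Setoid as UniqueSetoid
import Data.List.Relation.Unary.Unique.Setoid.Properties as UniqueSP
open import Data.Nat.Base as ℕ using (ℕ; zero; suc; _+_; _*_; _∸_; _^_; _≤_; _<_; z≤n; s≤s; NonZero)
import Data.Nat.DivMod as DivMod
open import Data.Nat.Divisibility using (_∣_; divides; ∣-trans; ∣⇒≤)
open import Data.Nat.GCD using (gcd; gcd[m,n]∣m; gcd[m,n]∣n; gcd-GCD; module Bézout; c*gcd[m,n]≡gcd[cm,cn])
import Data.Nat.Properties as ℕP
open import Data.Nat.Tactic.RingSolver using (solve-∀)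
open import Data.Product.Base using (Σ; ∃; ∃₂; _×_; _,_; proj₁; proj₂)
open import Data.Rational.Base as ℚ using (ℚ; 0ℚ; 1ℚ; toℚᵘ; ½)
import Data.Rational.Properties as ℚP
open import Data.Rational.Solver using (module +-*-Solver)
import Data.Rational.Unnormalised.Base as ℚᵘ
import Data.Rational.Unnormalised.Properties as ℚᵘP
open import Data.Sum.Base as Sum using (_⊎_; inj₁; inj₂)
open import Data.Vec.Base as Vec using (Vec; []; _∷_)
open import Data.Vec.Functional as Vector using (Vector)
import Data.Vec.Properties as VecP
open import Function.Base using (_∘_; id)
open import Function.Bundles using (Func; _⇔_; mk⇔)
open import Level using (0ℓ)
open import Relation.Binary.Bundles using (Setoid)
open import Relation.Binary.PropositionalEquality using (_≡_; _≢_; refl; sym; trans; cong; cong₂; subst; subst₂; module ≡-Reasoning)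
import Relation.Binary.PropositionalEquality.Properties as ≡P
open import Relation.Nullary.Decidable.Core using (Dec; yes; no; ¬¬-excluded-middle)
open import Relation.Nullary.Negation.Core using (¬_; contradiction)
open import Relation.Unary using (Decidable)

-- Counting with lists

-- The forms vanishing at x make up a lattice of covolume of order m^d. Packing translates into a
-- larger box counts its points in a box without geometry of numbers, at the price of a constant
-- factor, which is harmless because ε is arbitrary. The gain m^d leaves m^(n-d) of the m^n points
-- of size m, and summing over sizes raises the exponent to n-d+1, the very exponent of H: this is
-- why the threshold is linear in A. Nothing is known about ψ where ‖a_V‖ is small; those V lie in a
-- box that does not depend on A and are outnumbered once A is large. Neither 𝕍(A) nor the existence
-- of a rational point is decidable. Upper bounds therefore speak of arbitrary duplicate-free lists,
-- and classical case distinctions happen under a double negation. Real inequalities are turned into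
-- inequalities between naturals, with A replaced by a natural T. The sign of a primitive vector is
-- never normalised: the upper bound counts vectors, one for each listed hypersurface, and the lower
-- bound uses positive vectors, which are determined by their absolute values.

AllPairs-resp-⊇ : {A : Set} {R : A → A → Set} {xs ys : List A} →
                  ys ⊆ xs → AllPairs R xs → AllPairs R ys
AllPairs-resp-⊇ []         []         = []
AllPairs-resp-⊇ (_ ∷ʳ p)   (_ ∷ rs)   = AllPairs-resp-⊇ p rs
AllPairs-resp-⊇ (refl ∷ p) (r ∷ rs)   = All-resp-⊆ p r ∷ AllPairs-resp-⊇ p rs

-- Both parts are sublists, so that uniqueness passes to them. `cover` is stated for every `R`
-- because membership will later be taken up to a setoid equality.
record Split {A : Set} (P Q : A → Set) (xs : List A) : Set₁ where
  constructor mkSplit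
  field
    {ys zs} : List A
    ys⊆xs   : ys ⊆ xs
    zs⊆xs   : zs ⊆ xs
    lengths : length ys + length zs ≡ length xs
    all-ys  : All P ys
    all-zs  : All Q zs
    cover   : ∀ {R : A → Set} → Any R xs → Any R ys ⊎ Any R zs

split : {A : Set} {P Q : A → Set} {xs : List A} → All (λ x → P x ⊎ Q x) xs → Split P Q xs
split [] = mkSplit [] [] refl [] [] λ ()
split {xs = x ∷ _} (inj₁ p ∷ pqs) with split pqs
... | mkSplit {ys} {zs} s t e ps qs c = mkSplit (refl ∷ s) (x ∷ʳ t) (cong suc e) (p ∷ ps) qs λ where
  (here r)   → inj₁ (here r)
  (there r∈) → Sum.map₁ there (c r∈)
split {xs = x ∷ _} (inj₂ q ∷ pqs) with split pqs
... | mkSplit {ys} {zs} s t e ps qs c =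
  mkSplit (x ∷ʳ s) (refl ∷ t) (trans (ℕP.+-suc (length ys) (length zs)) (cong suc e)) ps (q ∷ qs) λ where
    (here r)   → inj₂ (here r)
    (there r∈) → Sum.map₂ there (c r∈)

module _ (S : Setoid 0ℓ 0ℓ) where
  open Setoid S using () renaming (Carrier to A; _≈_ to _≈ˢ_; sym to ≈-sym; trans to ≈-trans)
  open Membership S using () renaming (_∈_ to _∈ˢ_)
  open UniqueSetoid S using () renaming (Unique to Uniqueˢ)

  delete : ∀ {y ys} → y ∈ˢ ys → ∃ λ ys′ → length ys ≡ suc (length ys′) ×
           (∀ {z} → z ∈ˢ ys → ¬ y ≈ˢ z → z ∈ˢ ys′)
  delete {ys = _ ∷ ys} (here y≈) = ys , refl , λ where
    (here z≈)  y≉z → contradiction (≈-trans y≈ (≈-sym z≈)) y≉z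
    (there z∈) _   → z∈
  delete {ys = x ∷ _} (there y∈) = let ys′ , e , keep = delete y∈ in
    x ∷ ys′ , cong suc e , λ where
      (here z≈)  _   → here z≈
      (there z∈) y≉z → there (keep z∈ y≉z)

  pigeonhole : ∀ {xs ys} → Uniqueˢ xs → All (_∈ˢ ys) xs → length xs ≤ length ys
  pigeonhole [] [] = z≤n
  pigeonhole (x≉ ∷ xs!) (x∈ ∷ xs⊆ys) = let ys′ , e , keep = delete x∈ in
    subst (_ ≤_) (sym e) (s≤s (pigeonhole xs!
      (All.zipWith (λ (x≉z , z∈) → keep z∈ x≉z) (x≉ , xs⊆ys))))

-- Stands for the bound k / w on the size of P. Quantifying over duplicate-free lists avoids
-- deciding P, and the weight w avoids fractions.
Bounded : {A : Set} → (A → Set) → ℕ → ℕ → Set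
Bounded P w k = ∀ xs → Unique xs → All P xs → length xs * w ≤ k

Bounded-⊆ : {A : Set} {P Q : A → Set} {w k : ℕ} → (∀ {x} → P x → Q x) → Bounded Q w k → Bounded P w k
Bounded-⊆ P⊆Q b xs xs! ps = b xs xs! (All.map P⊆Q ps)

Bounded-∈ : {A : Set} (ys : List A) → Bounded (_∈ ys) 1 (length ys)
Bounded-∈ ys xs xs! xs⊆ys = subst (_≤ length ys) (sym (ℕP.*-identityʳ (length xs)))
  (pigeonhole (≡P.setoid _) xs! xs⊆ys)

Bounded-∪ : {A : Set} {P Q : A → Set} {w k l : ℕ} →
            Bounded P w k → Bounded Q w l → Bounded (λ x → P x ⊎ Q x) w (k + l)
Bounded-∪ {w = w} {k} {l} bP bQ xs xs! pqs with split pqs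
... | mkSplit {ys} {zs} s t e ps qs _ = begin
  length xs * w                    ≡⟨ cong (_* w) e ⟨
  (length ys + length zs) * w      ≡⟨ ℕP.*-distribʳ-+ w (length ys) (length zs) ⟩
  length ys * w + length zs * w    ≤⟨ ℕP.+-mono-≤ (bP ys (AllPairs-resp-⊇ s xs!) ps) (bQ zs (AllPairs-resp-⊇ t xs!) qs) ⟩
  k + l                            ∎
  where open ℕP.≤-Reasoning

Bounded-⋃ : {A I : Set} {P : I → A → Set} {w k : ℕ} (is : List I) →
            (∀ i → i ∈ is → Bounded (P i) w k) →
            Bounded (λ x → ∃ λ i → i ∈ is × P i x) w (length is * k)
Bounded-⋃ [] b [] _ _ = z≤n
Bounded-⋃ [] b (_ ∷ _) _ ((_ , () , _) ∷ _)
Bounded-⋃ {P = P} (i ∷ is) b = Bounded-⊆ {Q = λ x → P i x ⊎ ∃ λ j → j ∈ is × P j x}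
  (λ where (_ , here refl , p) → inj₁ p
           (j , there j∈ , p)  → inj₂ (j , j∈ , p))
  (Bounded-∪ (b i (here refl)) (Bounded-⋃ is λ j j∈ → b j (there j∈)))

Bounded-*ˡ : {A : Set} {P : A → Set} {w k : ℕ} (c : ℕ) → Bounded P w k → Bounded P (c * w) (c * k)
Bounded-*ˡ {w = w} {k} c b xs xs! ps = begin
  length xs * (c * w)   ≡⟨ shuffle (length xs) c w ⟩
  c * (length xs * w)   ≤⟨ ℕP.*-monoʳ-≤ c (b xs xs! ps) ⟩
  c * k                 ∎
  where
  open ℕP.≤-Reasoning
  shuffle : ∀ x c w → x * (c * w) ≡ c * (x * w)
  shuffle = solve-∀

Bounded-cancelˡ : {A : Set} {P : A → Set} {w k : ℕ} (c : ℕ) .{{_ : NonZero c}} →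
                  Bounded P (c * w) (c * k) → Bounded P w k
Bounded-cancelˡ {w = w} {k} c b xs xs! ps = ℕP.*-cancelˡ-≤ c (begin
  c * (length xs * w)   ≡⟨ shuffle (length xs) c w ⟨
  length xs * (c * w)   ≤⟨ b xs xs! ps ⟩
  c * k                 ∎)
  where
  open ℕP.≤-Reasoning
  shuffle : ∀ x c w → x * (c * w) ≡ c * (x * w)
  shuffle = solve-∀

-- The empty list needs no bound, and any other list carries a proof of C in its first element; so a
-- side condition shared by all elements may be assumed without being decided.
Bounded-given : {A C : Set} {P : A → Set} {w k : ℕ} →
                (C → Bounded P w k) → Bounded (λ x → C × P x) w k
Bounded-given b []       _   _              = z≤n
Bounded-given b (x ∷ xs) xs! ps@((c , _) ∷ _) = b c (x ∷ xs) xs! (All.map proj₂ ps)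

Bounded-weaken : {A : Set} {P : A → Set} {w k l : ℕ} → k ≤ l → Bounded P w k → Bounded P w l
Bounded-weaken k≤l b xs xs! ps = ℕP.≤-trans (b xs xs! ps) k≤l

Bounded-weight : {A : Set} {P : A → Set} {w v k : ℕ} → v ≤ w → Bounded P w k → Bounded P v k
Bounded-weight v≤w b xs xs! ps = ℕP.≤-trans (ℕP.*-monoʳ-≤ (length xs) v≤w) (b xs xs! ps)

-- The translates of P by the M shifts are disjoint subsets of Q.
packing : {A B : Set} {P : A → Set} {Q : B → Set} {M k : ℕ} (f : A → Fin M → B) →
          (∀ {a b v w} → P a → P b → f a v ≡ f b w → a ≡ b × v ≡ w) →
          (∀ {a} v → P a → Q (f a v)) →
          Bounded Q 1 k → Bounded P M k
packing {P = P} {Q} {M} {k} f f-inj f-Q b xs xs! ps = begin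
  length xs * M       ≡⟨ images-length xs ⟨
  length (images xs)  ≡⟨ ℕP.*-identityʳ _ ⟨
  length (images xs) * 1  ≤⟨ b (images xs) (images-unique xs! ps) (images-Q ps) ⟩
  k                   ∎
  where
  open ℕP.≤-Reasoning
  row : ∀ x → List _
  row x = List.tabulate (f x)

  images : List _ → List _
  images xs = List.concatMap row xs

  images-length : ∀ xs → length (images xs) ≡ length xs * M
  images-length []       = refl
  images-length (x ∷ xs) = trans (ListP.length-++ (row x))
    (cong₂ _+_ (ListP.length-tabulate (f x)) (images-length xs))

  images-Q : ∀ {xs} → All P xs → All Q (images xs)
  images-Q []       = []
  images-Q (p ∷ ps) = AllP.++⁺ (AllP.tabulate⁺ λ v → f-Q v p) (images-Q ps)

  fresh : ∀ {x xs} → All (x ≢_) xs → P x → All P xs → ∀ {v} → All (f x v ≢_) (images xs)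
  fresh []         _ []       = []
  fresh (x≢ ∷ x≢s) p (q ∷ qs) = AllP.++⁺
    (AllP.tabulate⁺ λ w e → x≢ (proj₁ (f-inj p q e))) (fresh x≢s p qs)

  images-unique : ∀ {xs} → Unique xs → All P xs → Unique (images xs)
  images-unique [] [] = []
  images-unique (x≢ ∷ xs!) (p ∷ ps) = UniqueP.++⁺
    (UniqueP.tabulate⁺ λ e → proj₂ (f-inj p p e))
    (images-unique xs! ps)
    λ (y∈row , y∈images) → let v , e = ∈P.∈-tabulate⁻ y∈row in
      All.lookup (fresh x≢ p ps {v}) (subst (_∈ _) e y∈images) refl

vectors : {A : Set} → List A → ∀ N → List (Vec A N)
vectors cs zero    = [] ∷ []
vectors cs (suc N) = List.cartesianProductWith _∷_ cs (vectors cs N)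

length-cartesianProductWith : {A B C : Set} (f : A → B → C) (xs : List A) (ys : List B) →
  length (List.cartesianProductWith f xs ys) ≡ length xs * length ys
length-cartesianProductWith f []       ys = refl
length-cartesianProductWith f (x ∷ xs) ys = trans (ListP.length-++ (List.map (f x) ys))
  (cong₂ _+_ (ListP.length-map (f x) ys) (length-cartesianProductWith f xs ys))

length-vectors : {A : Set} (cs : List A) (N : ℕ) → length (vectors cs N) ≡ length cs ^ N
length-vectors cs zero    = refl
length-vectors cs (suc N) = trans (length-cartesianProductWith _∷_ cs (vectors cs N))
  (cong (length cs *_) (length-vectors cs N))

vectors-unique : {A : Set} {cs : List A} → Unique cs → ∀ N → Unique (vectors cs N)
vectors-unique cs! zero    = [] ∷ []
vectors-unique cs! (suc N) = UniqueP.cartesianProductWith⁺ _∷_ VecP.∷-injective cs! (vectors-unique cs! N)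

∈-vectors : {A : Set} {cs : List A} {N : ℕ} (a : Vec A N) →
            (∀ i → Vec.lookup a i ∈ cs) → a ∈ vectors cs N
∈-vectors []       _  = here refl
∈-vectors (_ ∷ a) a∈ = ∈P.∈-cartesianProductWith⁺ _∷_ (a∈ zero) (∈-vectors a (a∈ ∘ suc))

∈-vectors⁻ : {A : Set} {cs : List A} {N : ℕ} (a : Vec A N) →
             a ∈ vectors cs N → ∀ i → Vec.lookup a i ∈ cs
∈-vectors⁻ {cs = cs} {suc N} (_ ∷ _) a∈ i with ∈P.∈-cartesianProductWith⁻ _∷_ cs (vectors cs N) a∈
∈-vectors⁻ (_ ∷ _) _ zero    | _ , _ , x∈ , _  , refl = x∈
∈-vectors⁻ (_ ∷ a) _ (suc i) | _ , _ , _  , a∈ , refl = ∈-vectors⁻ a a∈ i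

-- Values of integral forms at a primitive point

module ℤ∑ = Algebra.Properties.Semiring.Sum ℤP.+-*-semiring
module ℤ^ = Algebra.Definitions.RawSemiring ℤ.+-*-rawSemiring

infix 7 _∙_
_∙_ : ∀ {N} → Vector ℤ N → Vector ℤ N → ℤ
a ∙ w = ℤ∑.sum λ i → a i ℤ.* w i

∙-distribʳ-+ : ∀ {N} (a b w : Vector ℤ N) → (λ i → a i ℤ.+ b i) ∙ w ≡ a ∙ w ℤ.+ b ∙ w
∙-distribʳ-+ a b w = trans (ℤ∑.sum-cong-≗ λ i → ℤP.*-distribʳ-+ (w i) (a i) (b i))
  (ℤ∑.∑-distrib-+ (λ i → a i ℤ.* w i) (λ i → b i ℤ.* w i))

∙-*ˡ : ∀ {N} c (a w : Vector ℤ N) → (λ i → c ℤ.* a i) ∙ w ≡ c ℤ.* (a ∙ w)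
∙-*ˡ c a w = trans (ℤ∑.sum-cong-≗ λ i → ℤP.*-assoc c (a i) (w i))
  (sym (ℤ∑.*-distribˡ-sum c (λ i → a i ℤ.* w i)))

single : ∀ {N} → Fin N → ℤ → Vector ℤ N
single zero    c zero    = c
single zero    c (suc _) = 0ℤ
single (suc t) c zero    = 0ℤ
single (suc t) c (suc i) = single t c i

∣single∣≤ : ∀ {N} (t : Fin N) c i → ℤ.∣ single t c i ∣ ≤ ℤ.∣ c ∣
∣single∣≤ zero    c zero    = ℕP.≤-refl
∣single∣≤ zero    c (suc _) = z≤n
∣single∣≤ (suc t) c zero    = z≤n
∣single∣≤ (suc t) c (suc i) = ∣single∣≤ t c i

0-∙ : ∀ {N} (w : Vector ℤ N) → (λ _ → 0ℤ) ∙ w ≡ 0ℤ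
0-∙ {zero}  w = refl
0-∙ {suc N} w = trans (ℤP.+-identityˡ _) (0-∙ (w ∘ suc))

single-∙ : ∀ {N} (t : Fin N) c w → single t c ∙ w ≡ c ℤ.* w t
single-∙ zero    c w = trans (cong (λ s → c ℤ.* w zero ℤ.+ s) (0-∙ (w ∘ suc))) (ℤP.+-identityʳ _)
single-∙ (suc t) c w = trans (ℤP.+-identityˡ _) (single-∙ t c (w ∘ suc))

∣∙∣≤ : ∀ {N} (r x : Vector ℤ N) R m → (∀ i → ℤ.∣ r i ∣ ≤ R) → (∀ i → ℤ.∣ x i ∣ ≤ m) →
       ℤ.∣ r ∙ x ∣ ≤ N * (R * m)
∣∙∣≤ {zero}  r x R m r≤ x≤ = z≤n
∣∙∣≤ {suc N} r x R m r≤ x≤ = begin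
  ℤ.∣ r zero ℤ.* x zero ℤ.+ (r ∘ suc) ∙ (x ∘ suc) ∣              ≤⟨ ℤP.∣i+j∣≤∣i∣+∣j∣ (r zero ℤ.* x zero) ((r ∘ suc) ∙ (x ∘ suc)) ⟩
  ℤ.∣ r zero ℤ.* x zero ∣ + ℤ.∣ (r ∘ suc) ∙ (x ∘ suc) ∣          ≡⟨ cong (_+ ℤ.∣ (r ∘ suc) ∙ (x ∘ suc) ∣) (ℤP.abs-* (r zero) (x zero)) ⟩
  ℤ.∣ r zero ∣ * ℤ.∣ x zero ∣ + ℤ.∣ (r ∘ suc) ∙ (x ∘ suc) ∣      ≤⟨ ℕP.+-mono-≤ (ℕP.*-mono-≤ (r≤ zero) (x≤ zero)) (∣∙∣≤ (r ∘ suc) (x ∘ suc) R m (r≤ ∘ suc) (x≤ ∘ suc)) ⟩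
  R * m + N * (R * m)                                            ∎
  where open ℕP.≤-Reasoning

gcd-bezout : ∀ z g → ∃₂ λ s t → s ℤ.* z ℤ.+ t ℤ.* + g ≡ + gcd ℤ.∣ z ∣ g
gcd-bezout (+ m) g with Bézout.identity (gcd-GCD m g)
... | Bézout.+- a b e = + a , ℤ.- + b , (begin
  + a ℤ.* + m ℤ.+ ℤ.- + b ℤ.* + g                     ≡⟨ cong (ℤ._+ ℤ.- + b ℤ.* + g) (trans (sym (ℤP.pos-* a m)) (trans (cong +_ (sym e)) (trans (ℤP.pos-+ (gcd m g) (b * g)) (cong (ℤ._+_ (+ gcd m g)) (ℤP.pos-* b g))))) ⟩
  (+ gcd m g ℤ.+ + b ℤ.* + g) ℤ.+ ℤ.- + b ℤ.* + g     ≡⟨ cancel (+ gcd m g) (+ b) (+ g) ⟩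
  + gcd m g                                           ∎)
  where
  open ≡-Reasoning
  cancel : ∀ d b g → (d ℤ.+ b ℤ.* g) ℤ.+ ℤ.- b ℤ.* g ≡ d
  cancel = ℤSolver.solve-∀
... | Bézout.-+ a b e = ℤ.- + a , + b , (begin
  ℤ.- + a ℤ.* + m ℤ.+ + b ℤ.* + g                     ≡⟨ cong (ℤ._+_ (ℤ.- + a ℤ.* + m)) (trans (sym (ℤP.pos-* b g)) (trans (cong +_ (sym e)) (trans (ℤP.pos-+ (gcd m g) (a * m)) (cong (ℤ._+_ (+ gcd m g)) (ℤP.pos-* a m))))) ⟩
  ℤ.- + a ℤ.* + m ℤ.+ (+ gcd m g ℤ.+ + a ℤ.* + m)     ≡⟨ cancel (+ gcd m g) (+ a) (+ m) ⟩
  + gcd m g                                           ∎)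
  where
  open ≡-Reasoning
  cancel : ∀ d a m → ℤ.- a ℤ.* m ℤ.+ (d ℤ.+ a ℤ.* m) ≡ d
  cancel = ℤSolver.solve-∀
gcd-bezout z@(-[1+ m ]) g = let s , t , e = gcd-bezout (+ suc m) g in
  ℤ.- s , t , trans (cong (ℤ._+ t ℤ.* + g) (neg s (+ suc m))) e
  where
  neg : ∀ s m → ℤ.- s ℤ.* ℤ.- m ≡ s ℤ.* m
  neg = ℤSolver.solve-∀

bezout : ∀ {N} (x : Vector ℤ N) → ∃ λ u → u ∙ x ≡ + content x
bezout {zero}  x = (λ ()) , refl
bezout {suc N} x =
  let u , e = bezout (x ∘ suc)
      s , t , e′ = gcd-bezout (x zero) (content (x ∘ suc))
  in s Vector.∷ (λ i → t ℤ.* u i) ,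
     trans (cong (ℤ._+_ (s ℤ.* x zero)) (trans (∙-*ˡ t u (x ∘ suc)) (cong (t ℤ.*_) e))) e′

monomialValue : ∀ {k} → Vec ℕ k → Vector ℤ k → ℤ
monomialValue e x = ℤ^.product λ j → x j ℤ^.^ Vec.lookup e j

monomialValue-bump : ∀ {k} (e : Vec ℕ k) x i →
                     monomialValue (Vec.updateAt e i suc) x ≡ x i ℤ.* monomialValue e x
monomialValue-bump (e₀ ∷ e) x zero    = ℤP.*-assoc (x zero) (x zero ℤ^.^ e₀) (monomialValue e (x ∘ suc))
monomialValue-bump (e₀ ∷ e) x (suc i) = trans
  (cong (x zero ℤ^.^ e₀ ℤ.*_) (monomialValue-bump e (x ∘ suc) i))
  (swap (x zero ℤ^.^ e₀) (x (suc i)) (monomialValue e (x ∘ suc)))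
  where
  swap : ∀ a b c → a ℤ.* (b ℤ.* c) ≡ b ℤ.* (a ℤ.* c)
  swap = ℤSolver.solve-∀

monomialValue-cong : ∀ {k} (e : Vec ℕ k) {x y : Vector ℤ k} → (∀ j → x j ≡ y j) → monomialValue e x ≡ monomialValue e y
monomialValue-cong []       x≡y = refl
monomialValue-cong (e₀ ∷ e) x≡y = cong₂ ℤ._*_ (cong (ℤ^._^ e₀) (x≡y zero)) (monomialValue-cong e (x≡y ∘ suc))

sum-bump : ∀ {k} (e : Vec ℕ k) i → Vec.sum (Vec.updateAt e i suc) ≡ suc (Vec.sum e)
sum-bump (e₀ ∷ e) zero    = refl
sum-bump (e₀ ∷ e) (suc i) = trans (cong (e₀ ℕ.+_) (sum-bump e i)) (ℕP.+-suc e₀ (Vec.sum e))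

monomialValue-0 : ∀ {k} (x : Vector ℤ k) → monomialValue (Vec.replicate k 0) x ≡ 1ℤ
monomialValue-0 {zero}  x = refl
monomialValue-0 {suc k} x = trans (ℤP.*-identityˡ _) (monomialValue-0 (x ∘ suc))

sum-0 : ∀ k → Vec.sum (Vec.replicate k 0) ≡ 0
sum-0 zero    = refl
sum-0 (suc k) = sum-0 k

∈-monomials : ∀ {k} d (e : Vec ℕ k) → Vec.sum e ≡ d → e ∈ monomials k d
∈-monomials zero    e            s = here (zeros e s)
  where
  zeros : ∀ {k} (e : Vec ℕ k) → Vec.sum e ≡ 0 → e ≡ Vec.replicate k 0
  zeros []         _ = refl
  zeros (zero ∷ e) s = cong (0 ∷_) (zeros e s)
∈-monomials {suc k} (suc d) (zero ∷ e)  s =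
  ∈P.∈-++⁺ʳ _ (∈P.∈-map⁺ (0 ∷_) (∈-monomials (suc d) e s))
∈-monomials {suc k} (suc d) (suc a ∷ e) s =
  ∈P.∈-++⁺ˡ (∈P.∈-map⁺ _ (∈-monomials d (a ∷ e) (ℕP.suc-injective s)))

-- v is the value at x of an integral form of degree d whose coefficients have
-- absolute values summing to B.
data Combination {k} (x : Vector ℤ k) (d : ℕ) : ℕ → ℤ → Set where
  none : Combination x d 0 0ℤ
  term : ∀ {B v} c e → Vec.sum e ≡ d → Combination x d B v →
         Combination x d (ℤ.∣ c ∣ + B) (c ℤ.* monomialValue e x ℤ.+ v)

module _ {k} {x : Vector ℤ k} where

  combination-+ : ∀ {d B C v w} → Combination x d B v → Combination x d C w →
                  Combination x d (B + C) (v ℤ.+ w)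
  combination-+ {C = C} {w = w} none g = subst (Combination x _ C) (sym (ℤP.+-identityˡ w)) g
  combination-+ {C = C} {w = w} (term {B} {v} c e s f) g = subst₂ (Combination x _)
    (sym (ℕP.+-assoc ℤ.∣ c ∣ B C)) (sym (ℤP.+-assoc (c ℤ.* monomialValue e x) v w))
    (term c e s (combination-+ f g))

  combination-* : ∀ {d B v} i → Combination x d B v → Combination x (suc d) B (x i ℤ.* v)
  combination-* i none = subst (Combination x _ 0) (sym (ℤP.*-zeroʳ (x i))) none
  combination-* i (term {B} {v} c e s f) = subst (Combination x _ (ℤ.∣ c ∣ + B))
    (trans (cong (λ t → c ℤ.* t ℤ.+ x i ℤ.* v) (monomialValue-bump e x i))
           (shuffle c (x i) (monomialValue e x) v))
    (term c (Vec.updateAt e i suc) (trans (sum-bump e i) (cong suc s)) (combination-* i f))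
    where
    shuffle : ∀ c x m v → c ℤ.* (x ℤ.* m) ℤ.+ x ℤ.* v ≡ x ℤ.* (c ℤ.* m ℤ.+ v)
    shuffle = ℤSolver.solve-∀

  constant : ∀ c → Combination x 0 ℤ.∣ c ∣ c
  constant c = subst₂ (Combination x 0) (ℕP.+-identityʳ ℤ.∣ c ∣)
    (trans (ℤP.+-identityʳ _) (trans (cong (c ℤ.*_) (monomialValue-0 x)) (ℤP.*-identityʳ c)))
    (term c (Vec.replicate k 0) (sum-0 k) none)

-- `Combination` records the exact sum of the absolute values; the estimates only control an upper
-- bound for it.
Value : ∀ {k} → Vector ℤ k → ℕ → ℕ → ℤ → Set
Value x d B v = ∃ λ C → C ≤ B × Combination x d C v

value-+ : ∀ {k} {x : Vector ℤ k} {d B C v w} → Value x d B v → Value x d C w → Value x d (B + C) (v ℤ.+ w)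
value-+ (_ , ≤B , f) (_ , ≤C , g) = _ , ℕP.+-mono-≤ ≤B ≤C , combination-+ f g

value-* : ∀ {k} {x : Vector ℤ k} {d B v} i → Value x d B v → Value x (suc d) B (v ℤ.* x i)
value-* {x = x} {v = v} i (_ , ≤B , f) = _ , ≤B , subst (Combination x _ _) (ℤP.*-comm (x i) v) (combination-* i f)

-- The map `ι` lets the induction pass to the remaining coordinates while the point x, and with it
-- the ring of forms, stays fixed.
value-∙ : ∀ {k N} {x : Vector ℤ k} {d B} (r : Vector ℤ N) (ι : Fin N → Fin k) →
          (∀ i → Value x d B (r i)) → Value x (suc d) (N * B) (r ∙ (x ∘ ι))
value-∙ {N = zero}  r ι f = 0 , z≤n , none
value-∙ {N = suc N} r ι f = value-+ (value-* (ι zero) (f zero)) (value-∙ (r ∘ suc) (ι ∘ suc) (f ∘ suc))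

module _ {n} (x : Vector ℤ (suc n)) (x-primitive : Primitive x) (k : Fin (suc n))
         (x≤xₖ : ∀ i → ℤ.∣ x i ∣ ≤ ℤ.∣ x k ∣) .{{_ : NonZero ℤ.∣ x k ∣}} where

  private
    m = ℤ.∣ x k ∣
    u = proj₁ (bezout x)

    u∙x≡1 : u ∙ x ≡ 1ℤ
    u∙x≡1 = trans (proj₂ (bezout x)) (cong +_ x-primitive)

  -- Writing w = Σ w uᵢ xᵢ and reducing the coefficients modulo M leaves
  -- a multiple of M.
  reduce : ∀ w M .{{_ : NonZero M}} → ∃₂ λ r q → (∀ i → ℤ.∣ r i ∣ ≤ M) × w ≡ r ∙ x ℤ.+ + M ℤ.* q
  reduce w M = r , t ∙ x , (λ i → ℕP.<⇒≤ (ℤDM.n%ℕd<d (w ℤ.* u i) M)) , (begin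
    w                                              ≡⟨ ℤP.*-identityʳ w ⟨
    w ℤ.* 1ℤ                                       ≡⟨ cong (w ℤ.*_) u∙x≡1 ⟨
    w ℤ.* (u ∙ x)                                  ≡⟨ ∙-*ˡ w u x ⟨
    (λ i → w ℤ.* u i) ∙ x                          ≡⟨ ℤ∑.sum-cong-≗ (λ i → cong (ℤ._* x i) (trans (ℤDM.a≡a%ℕn+[a/ℕn]*n (w ℤ.* u i) M) (cong (λ z → r i ℤ.+ z) (ℤP.*-comm (t i) (+ M))))) ⟩
    (λ i → r i ℤ.+ + M ℤ.* t i) ∙ x                ≡⟨ ∙-distribʳ-+ r (λ i → + M ℤ.* t i) x ⟩
    r ∙ x ℤ.+ (λ i → + M ℤ.* t i) ∙ x              ≡⟨ cong (λ z → r ∙ x ℤ.+ z) (∙-*ˡ (+ M) t x) ⟩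
    r ∙ x ℤ.+ + M ℤ.* (t ∙ x)                      ∎)
    where
    open ≡-Reasoning
    r t : Vector ℤ (suc n)
    r i = + ((w ℤ.* u i) ℤDM.%ℕ M)
    t i = (w ℤ.* u i) ℤDM./ℕ M

  factor-xₖ : ∀ z → ∃ λ z′ → + m ℤ.* z ≡ z′ ℤ.* x k
  factor-xₖ z with x k
  ... | + a      = z , ℤP.*-comm (+ a) z
  ... | -[1+ a ] = ℤ.- z , neg (+ suc a) z
    where
    neg : ∀ a z → a ℤ.* z ≡ ℤ.- z ℤ.* ℤ.- a
    neg = ℤSolver.solve-∀

  -- Induction on the degree. Reducing modulo m^(d+1) gives w = r ∙ x + q * x k with |r i| ≤ m^(d+1)
  -- ≤ B m^d, where m ≤ B enters. As x k is the largest coordinate, the triangle inequality gives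
  -- |q| ≤ (n+2) B m^d. So every r i and q is a value in degree d, and multiplying by a coordinate
  -- raises the degree. The r i cost n+1 and q costs n+2, together the factor 3+2n.
  values : ∀ d B w → m ≤ B → ℤ.∣ w ∣ ≤ B * m ^ d → Value x d ((3 + 2 * n) ^ d * B) w
  values zero    B w m≤B w≤ = ℤ.∣ w ∣ , subst (ℤ.∣ w ∣ ≤_) (ℕP.*-comm B 1) w≤ , constant w
  values (suc d) B w m≤B w≤ =
    subst₂ (Value x (suc d)) (coefficient ((3 + 2 * n) ^ d) n B) (sym w≡)
      (value-+ (value-∙ r id λ i → values d B (r i) m≤B (r≤B i))
               (value-* k (values d ((2 + n) * B) q (ℕP.≤-trans m≤B (ℕP.m≤m+n B ((suc n) * B))) q≤)))
    where
    open ℕP.≤-Reasoning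
    instance
      M≢0 : NonZero (m ^ suc d)
      M≢0 = ℕP.m^n≢0 m (suc d)
    M = m ^ suc d
    reduction = reduce w M
    r = proj₁ reduction
    p = proj₁ (proj₂ reduction)
    r≤M : ∀ i → ℤ.∣ r i ∣ ≤ M
    r≤M = proj₁ (proj₂ (proj₂ reduction))

    extract = factor-xₖ (+ (m ^ d) ℤ.* p)
    q = proj₁ extract

    Mp≡qx : + M ℤ.* p ≡ q ℤ.* x k
    Mp≡qx = trans (trans (cong (ℤ._* p) (ℤP.pos-* m (m ^ d))) (ℤP.*-assoc (+ m) (+ (m ^ d)) p)) (proj₂ extract)

    w≡ : w ≡ r ∙ x ℤ.+ q ℤ.* x k
    w≡ = trans (proj₂ (proj₂ (proj₂ reduction))) (cong (λ z → r ∙ x ℤ.+ z) Mp≡qx)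

    r≤B : ∀ i → ℤ.∣ r i ∣ ≤ B * m ^ d
    r≤B i = ℕP.≤-trans (r≤M i) (ℕP.*-monoˡ-≤ (m ^ d) m≤B)

    coefficient : ∀ c n B → suc n * (c * B) + c * ((2 + n) * B) ≡ (3 + 2 * n) * c * B
    coefficient = solve-∀

    isolate : ∀ a b c → a ≡ b ℤ.+ c → c ≡ a ℤ.- b
    isolate a b c refl = sub b c
      where
      sub : ∀ b c → c ≡ b ℤ.+ c ℤ.- b
      sub = ℤSolver.solve-∀

    collect : ∀ B m M n → B * (m * M) + suc n * ((m * M) * m) ≡ (B + suc n * m) * M * m
    collect = solve-∀

    q≤ : ℤ.∣ q ∣ ≤ (2 + n) * B * m ^ d
    q≤ = ℕP.*-cancelʳ-≤ ℤ.∣ q ∣ ((2 + n) * B * m ^ d) m (begin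
      ℤ.∣ q ∣ * m                          ≡⟨ ℤP.abs-* q (x k) ⟨
      ℤ.∣ q ℤ.* x k ∣                      ≡⟨ cong ℤ.∣_∣ (isolate w (r ∙ x) (q ℤ.* x k) w≡) ⟩
      ℤ.∣ w ℤ.- r ∙ x ∣                    ≤⟨ ℤP.∣i-j∣≤∣i∣+∣j∣ w (r ∙ x) ⟩
      ℤ.∣ w ∣ + ℤ.∣ r ∙ x ∣                ≤⟨ ℕP.+-mono-≤ w≤ (∣∙∣≤ r x M m r≤M x≤xₖ) ⟩
      B * M + suc n * (M * m)              ≡⟨ collect B m (m ^ d) n ⟩
      (B + suc n * m) * m ^ d * m          ≤⟨ ℕP.*-monoˡ-≤ m (ℕP.*-monoˡ-≤ (m ^ d) (ℕP.+-monoʳ-≤ B (ℕP.*-monoʳ-≤ (suc n) m≤B))) ⟩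
      (2 + n) * B * m ^ d * m              ∎)

module _ (d n : ℕ) where
  open Hypersurfaces d n

  monomial-index : ∀ e → Vec.sum e ≡ d → ∃ λ t → monomial t ≡ e
  monomial-index e s = cast (length-monomials n d) (Any.index e∈) ,
    trans (cong (List.lookup (monomials (suc n) d)) (FinP.cast-involutive (sym (length-monomials n d)) (length-monomials n d) (Any.index e∈)))
          (sym (AnyP.lookup-index e∈))
    where
    e∈ = ∈-monomials d e s

  veronese : Vector ℤ (suc n) → Vector ℤ N
  veronese x i = monomialValue (monomial i) x

  -- An exponent may occur in several terms, whose coefficients then add up in one entry. This is
  -- why a combination keeps track of the sum of absolute values and not of their maximum.
  coefficients : ∀ {x B v} → Combination x d B v →
                 ∃ λ s → (∀ i → ℤ.∣ s i ∣ ≤ B) × s ∙ veronese x ≡ v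
  coefficients {x} none = (λ _ → 0ℤ) , (λ _ → z≤n) , 0-∙ (veronese x)
  coefficients {x} (term {B} {v} c e s≡d f) =
    let s , s≤B , s∙≡v = coefficients f
        t , t≡e = monomial-index e s≡d
    in (λ i → single t c i ℤ.+ s i) ,
       (λ i → ℕP.≤-trans (ℤP.∣i+j∣≤∣i∣+∣j∣ (single t c i) (s i)) (ℕP.+-mono-≤ (∣single∣≤ t c i) (s≤B i))) ,
       trans (∙-distribʳ-+ (single t c) s (veronese x))
         (cong₂ ℤ._+_ (trans (single-∙ t c (veronese x)) (cong (λ e → c ℤ.* monomialValue e x) t≡e)) s∙≡v)

-- Hypersurfaces with a small rational zero

module ℤG = Algebra.Properties.Group (AbelianGroup.group ℤP.+-0-abelianGroup)

^-distribʳ-* : ∀ n a b → (a * b) ^ n ≡ a ^ n * b ^ n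
^-distribʳ-* zero    a b = refl
^-distribʳ-* (suc n) a b = trans (cong (a * b *_) (^-distribʳ-* n a b)) (shuffle a b (a ^ n) (b ^ n))
  where
  shuffle : ∀ a b c d → a * b * (c * d) ≡ (a * c) * (b * d)
  shuffle = solve-∀

interval : ℕ → List ℤ
interval R = List.map +_ (List.upTo (suc R)) ++ List.map -[1+_] (List.upTo R)

length-interval : ∀ R → length (interval R) ≡ suc (2 * R)
length-interval R = begin
  length (interval R)
    ≡⟨ ListP.length-++ (List.map +_ (List.upTo (suc R))) ⟩
  length (List.map +_ (List.upTo (suc R))) + length (List.map -[1+_] (List.upTo R))
    ≡⟨ cong₂ _+_ (trans (ListP.length-map +_ (List.upTo (suc R))) (ListP.length-upTo (suc R)))
                 (trans (ListP.length-map -[1+_] (List.upTo R)) (ListP.length-upTo R)) ⟩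
  suc R + R
    ≡⟨ cong (λ r → suc (R + r)) (ℕP.+-identityʳ R) ⟨
  suc (2 * R) ∎
  where open ≡-Reasoning

∈-interval : ∀ {R} z → ℤ.∣ z ∣ ≤ R → z ∈ interval R
∈-interval     (+ a)    a≤R = ∈P.∈-++⁺ˡ (∈P.∈-map⁺ +_ (∈P.∈-upTo⁺ (s≤s a≤R)))
∈-interval {R} -[1+ a ] a<R = ∈P.∈-++⁺ʳ (List.map +_ (List.upTo (suc R))) (∈P.∈-map⁺ -[1+_] (∈P.∈-upTo⁺ a<R))

InBox : ∀ {N} → ℕ → Vec ℤ N → Set
InBox R a = ∀ i → ℤ.∣ Vec.lookup a i ∣ ≤ R

box : ∀ N → ℕ → List (Vec ℤ N)
box N R = vectors (interval R) N

length-box : ∀ N R → length (box N R) ≡ suc (2 * R) ^ N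
length-box N R = trans (length-vectors (interval R) N) (cong (_^ N) (length-interval R))

∈-box : ∀ {N R} {a : Vec ℤ N} → InBox R a → a ∈ box N R
∈-box {a = a} a≤R = ∈-vectors a λ i → ∈-interval (Vec.lookup a i) (a≤R i)

Bounded-box : ∀ N R → Bounded (InBox {N} R) 1 (suc (2 * R) ^ N)
Bounded-box N R = subst (Bounded (InBox R) 1) (length-box N R)
  (Bounded-⊆ {Q = _∈ box N R} (λ {a} → ∈-box {a = a}) (Bounded-∈ (box N R)))

-- Contains every vector of maximum norm m: ± m is inserted at some position into a vector of the
-- box. Repetitions do no harm, since only the order m^n of its length is used.
shell : ∀ n → ℕ → List (Vec ℤ (suc n))
shell n m = List.cartesianProductWith (λ (k , z) y → Vec.insertAt y k z)
  (List.cartesianProduct (List.allFin (suc n)) (+ m ∷ ℤ.- + m ∷ [])) (box n m)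

length-shell : ∀ n m → length (shell n m) ≡ suc n * 2 * suc (2 * m) ^ n
length-shell n m = trans (length-cartesianProductWith _ (List.cartesianProduct (List.allFin (suc n)) (+ m ∷ ℤ.- + m ∷ [])) (box n m))
  (cong₂ _*_ (trans (length-cartesianProductWith _,_ (List.allFin (suc n)) (+ m ∷ ℤ.- + m ∷ []))
               (cong (_* 2) (ListP.length-tabulate {n = suc n} id)))
             (length-box n m))

lookup-removeAt : {A : Set} {n : ℕ} (x : Vec A (suc n)) (k : Fin (suc n)) (j : Fin n) →
  ∃ λ i → Vec.lookup (Vec.removeAt x k) j ≡ Vec.lookup x i
lookup-removeAt (_ ∷ x)     zero    j       = suc j , refl
lookup-removeAt (_ ∷ _ ∷ _) (suc k) zero    = zero , refl
lookup-removeAt (_ ∷ y ∷ x) (suc k) (suc j) =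
  let i , e = lookup-removeAt (y ∷ x) k j in suc i , e

∈-shell : ∀ {n m} (x : Vec ℤ (suc n)) k → ℤ.∣ Vec.lookup x k ∣ ≡ m → InBox m x → x ∈ shell n m
∈-shell {n} {m} x k xₖ≡m x≤m = subst (_∈ shell n m) (VecP.insertAt-removeAt x k)
  (∈P.∈-cartesianProductWith⁺ (λ (k , z) y → Vec.insertAt y k z)
    (∈P.∈-cartesianProduct⁺ (∈P.∈-allFin k) (sign (Vec.lookup x k) xₖ≡m))
    (∈-box λ j → let i , e = lookup-removeAt x k j in
      subst (λ z → ℤ.∣ z ∣ ≤ m) (sym e) (x≤m i)))
  where
  sign : ∀ z → ℤ.∣ z ∣ ≡ m → z ∈ + m ∷ ℤ.- + m ∷ []
  sign (+ a)    refl = here refl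
  sign -[1+ a ] refl = there (here refl)

greatest : {P : ℕ → Set} → Decidable P → P 0 → ∀ M → ∃ λ B → P B × ∀ {m} → m ≤ M → P m → m ≤ B
greatest P? p₀ zero    = 0 , p₀ , λ m≤0 _ → m≤0
greatest P? p₀ (suc M) with P? (suc M) | greatest P? p₀ M
... | yes p | _           = suc M , p , λ m≤ _ → m≤
... | no ¬p | B , p , max = B , p , λ where
  m≤ pm → max (ℕ.s≤s⁻¹ (ℕP.≤∧≢⇒< m≤ λ where refl → ¬p pm)) pm

module _ (d n : ℕ) (d≤n : d ≤ n) where
  open Hypersurfaces d n

  Vanishes : Vec ℤ N → Vector ℤ (suc n) → Set
  Vanishes a x = Vec.lookup a ∙ veronese d n x ≡ 0ℤ

  -- A translate is a vector of the box of radius T plus a shift with entries at most (3+2n)^d T;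
  -- `enlarge * T` bounds the sum.
  enlarge : ℕ
  enlarge = suc ((3 + 2 * n) ^ d)

  largeBox : ℕ → ℕ
  largeBox T = suc (2 * (enlarge * T)) ^ N

  -- Vanishing at x is a linear condition with normal vector `veronese`. Taking B = T in `values`
  -- supplies one shift for each of the T m^d prescribed values.
  Bounded-hyperplane : ∀ (x : Vector ℤ (suc n)) → Primitive x → ∀ k → (∀ i → ℤ.∣ x i ∣ ≤ ℤ.∣ x k ∣) →
    ∀ T → NonZero ℤ.∣ x k ∣ → ℤ.∣ x k ∣ ≤ T →
    Bounded (λ a → InBox T a × Vanishes a x) (T * ℤ.∣ x k ∣ ^ d) (largeBox T)
  Bounded-hyperplane x x-primitive k x≤xₖ T m≢0 m≤T =
    packing translate
      (λ {a} {b} → translate-injective {a} {b}) (λ {a} → translate-bounded {a}) (Bounded-box N (enlarge * T))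
    where
    m = ℤ.∣ x k ∣
    w = veronese d n x

    represent : (v : Fin (T * m ^ d)) → ∃ λ s → (∀ i → ℤ.∣ s i ∣ ≤ (3 + 2 * n) ^ d * T) × s ∙ w ≡ + toℕ v
    represent v =
      let C , C≤ , f = values x x-primitive k x≤xₖ {{m≢0}} d T (+ toℕ v) m≤T (ℕP.<⇒≤ (FinP.toℕ<n v))
          s , s≤ , s∙w = coefficients d n f
      in s , (λ i → ℕP.≤-trans (s≤ i) C≤) , s∙w

    shift : Fin (T * m ^ d) → Vector ℤ N
    shift v = proj₁ (represent v)

    translate : Vec ℤ N → Fin (T * m ^ d) → Vec ℤ N
    translate a v = Vec.tabulate λ i → Vec.lookup a i ℤ.+ shift v i

    value : ∀ {a} v → Vanishes a x → (λ i → Vec.lookup a i ℤ.+ shift v i) ∙ w ≡ + toℕ v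
    value {a} v a∙w≡0 = trans (∙-distribʳ-+ (Vec.lookup a) (shift v) w)
      (trans (cong₂ ℤ._+_ a∙w≡0 (proj₂ (proj₂ (represent v)))) (ℤP.+-identityˡ _))

    entries : ∀ a b {v w} → translate a v ≡ translate b w →
              ∀ i → Vec.lookup a i ℤ.+ shift v i ≡ Vec.lookup b i ℤ.+ shift w i
    entries a b e i = trans (sym (VecP.lookup∘tabulate _ i)) (trans (cong (λ a → Vec.lookup a i) e) (VecP.lookup∘tabulate _ i))

    -- The translate takes the value v at x because a vanishes there. Hence v can be read off from
    -- the translate, and subtracting its shift recovers a.
    translate-injective : ∀ {a b v w} → InBox T a × Vanishes a x → InBox T b × Vanishes b x →
                          translate a v ≡ translate b w → a ≡ b × v ≡ w
    translate-injective {a} {b} {v} {v′} (_ , a∙w≡0) (_ , b∙w≡0) e =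
      (begin
        a                            ≡⟨ VecP.tabulate∘lookup a ⟨
        Vec.tabulate (Vec.lookup a)  ≡⟨ VecP.tabulate-cong (λ i → ℤG.∙-cancelʳ (shift v i) _ _ (trans (entries a b e i) (cong (λ v → Vec.lookup b i ℤ.+ shift v i) (sym v≡v′)))) ⟩
        Vec.tabulate (Vec.lookup b)  ≡⟨ VecP.tabulate∘lookup b ⟩
        b                            ∎) , v≡v′
      where
      open ≡-Reasoning
      v≡v′ : v ≡ v′
      v≡v′ = FinP.toℕ-injective (ℤP.+-injective (trans (sym (value {a} v a∙w≡0))
        (trans (ℤ∑.sum-cong-≗ (λ i → cong (ℤ._* w i) (entries a b e i))) (value {b} v′ b∙w≡0))))

    translate-bounded : ∀ {a} v → InBox T a × Vanishes a x → InBox (enlarge * T) (translate a v)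
    translate-bounded {a} v (a≤T , _) i = subst (λ z → ℤ.∣ z ∣ ≤ enlarge * T) (sym (VecP.lookup∘tabulate _ i))
      (ℕP.≤-trans (ℤP.∣i+j∣≤∣i∣+∣j∣ (Vec.lookup a i) (shift v i))
        (ℕP.+-mono-≤ (a≤T i) (proj₁ (proj₂ (represent v)) i)))

  PointOfSize : ℕ → Vec ℤ (suc n) → Set
  PointOfSize m x = Primitive (Vec.lookup x) × (∃ λ k → ℤ.∣ Vec.lookup x k ∣ ≡ m) × InBox m x

  size≢0 : ∀ {m x} → PointOfSize m x → NonZero m
  size≢0 {zero}  {x} (prim , _ , x≤0) = contradiction (trans (sym prim) (content-0 (Vec.lookup x) λ i → ℕP.n≤0⇒n≡0 (x≤0 i))) λ ()
    where
    content-0 : ∀ {k} (x : Vector ℤ k) → (∀ i → ℤ.∣ x i ∣ ≡ 0) → content x ≡ 0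
    content-0 {zero}  x _    = refl
    content-0 {suc k} x x≡0 = cong₂ gcd (x≡0 zero) (content-0 (x ∘ suc) (x≡0 ∘ suc))
  size≢0 {suc m} _ = _

  ZeroOfSize : ℕ → ℕ → Vec ℤ N → Set
  ZeroOfSize T m a = ∃ λ x → PointOfSize m x × InBox T a × Vanishes a (Vec.lookup x)

  -- The exponent of m left when the m^n points are weighed against the factor m^d of the packing.
  -- The exponent of the height is `suc codim`.
  codim : ℕ
  codim = n ∸ d

  -- By 2m+1 ≤ 3m for m ≥ 1, the shell has at most `shellConstant * m ^ n` elements.
  shellConstant : ℕ
  shellConstant = suc n * 2 * 3 ^ n

  Bounded-zeroOfSize : ∀ T m → m ≤ T → Bounded (ZeroOfSize T m) T (shellConstant * m ^ codim * largeBox T)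
  Bounded-zeroOfSize T m m≤T = Bounded-⊆ {Q = λ a → NonZero m × ZeroOfSize T m a}
    (λ z@(x , p , _) → size≢0 {x = x} p , z)
    -- Cancelling m^d needs m ≠ 0, which follows from the primitivity of the point in any element of
    -- the list.
    (Bounded-given λ m≢0 → Bounded-cancelˡ (m ^ d) {{ℕP.m^n≢0 m d {{m≢0}}}}
      (subst (λ w → Bounded (ZeroOfSize T m) w (m ^ d * (shellConstant * m ^ codim * largeBox T))) (ℕP.*-comm T (m ^ d))
        (Bounded-weaken (count m≢0)
          (Bounded-⊆ {Q = λ a → ∃ λ x → x ∈ shell n m × PointOfSize m x × InBox T a × Vanishes a (Vec.lookup x)}
            (λ (x , p@(_ , (k , e) , x≤m) , z) → x , ∈-shell x k e x≤m , p , z)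
            (Bounded-⋃ (shell n m) λ x _ → Bounded-given {C = PointOfSize m x} λ p → through x p m≢0)))))
    where
    through : ∀ x → PointOfSize m x → NonZero m →
              Bounded (λ a → InBox T a × Vanishes a (Vec.lookup x)) (T * m ^ d) (largeBox T)
    through x (prim , (k , refl) , x≤m) m≢0 = Bounded-hyperplane (Vec.lookup x) prim k x≤m T m≢0 m≤T

    open ℕP.≤-Reasoning

    3m : ∀ m → .{{NonZero m}} → suc (2 * m) ≤ 3 * m
    3m (suc m) = ℕP.+-monoˡ-≤ (2 * suc m) (s≤s (z≤n {m}))

    reassoc : ∀ c b a e l → c * (b * (a * e)) * l ≡ e * (c * b * a * l)
    reassoc = solve-∀

    count : NonZero m → length (shell n m) * largeBox T ≤ m ^ d * (shellConstant * m ^ codim * largeBox T)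
    count m≢0 = begin
      length (shell n m) * largeBox T                                 ≡⟨ cong (_* largeBox T) (length-shell n m) ⟩
      suc n * 2 * suc (2 * m) ^ n * largeBox T                        ≤⟨ ℕP.*-monoˡ-≤ (largeBox T) (ℕP.*-monoʳ-≤ (suc n * 2) (ℕP.^-monoˡ-≤ n (3m m {{m≢0}}))) ⟩
      suc n * 2 * (3 * m) ^ n * largeBox T                            ≡⟨ cong (λ t → suc n * 2 * t * largeBox T) (^-distribʳ-* n 3 m) ⟩
      suc n * 2 * (3 ^ n * m ^ n) * largeBox T                        ≡⟨ cong (λ e → suc n * 2 * (3 ^ n * m ^ e) * largeBox T) (sym (ℕP.m∸n+n≡m d≤n)) ⟩
      suc n * 2 * (3 ^ n * m ^ (codim + d)) * largeBox T              ≡⟨ cong (λ t → suc n * 2 * (3 ^ n * t) * largeBox T) (ℕP.^-distribˡ-+-* m codim d) ⟩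
      suc n * 2 * (3 ^ n * (m ^ codim * m ^ d)) * largeBox T          ≡⟨ reassoc (suc n * 2) (3 ^ n) (m ^ codim) (m ^ d) (largeBox T) ⟩
      m ^ d * (shellConstant * m ^ codim * largeBox T)                ∎

  -- The condition m^(n+1-d) ≤ T / q, with 1 / q in the role of ε and the maximum norm in place of
  -- the Euclidean norm.
  SmallZero : ℕ → ℕ → Vec ℤ N → Set
  SmallZero q T a = ∃ λ m → m ^ suc codim * q ≤ T × ZeroOfSize T m a

  -- Let B be the largest admissible size. Estimating m^(n-d) by B^(n-d) for each of the B sizes
  -- loses only a constant: the sum becomes B^(n-d+1) / T, which is at most 1 / q by the choice of
  -- B.
  Bounded-smallZero : ∀ q T .{{_ : NonZero q}} .{{_ : NonZero T}} →
                      Bounded (SmallZero q T) q (shellConstant * largeBox T)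
  Bounded-smallZero q T =
    Bounded-cancelˡ T (subst (λ w → Bounded (SmallZero q T) w (T * (shellConstant * largeBox T))) (ℕP.*-comm q T)
      (Bounded-weaken count (Bounded-*ˡ q
        (Bounded-⊆ {Q = λ a → ∃ λ m → m ∈ sizes × m ≤ B × ZeroOfSize T m a} (λ {a} → small {a})
          (Bounded-⋃ sizes λ m _ → Bounded-given λ m≤B →
            Bounded-weaken (ℕP.*-monoˡ-≤ (largeBox T) (ℕP.*-monoʳ-≤ shellConstant (ℕP.^-monoˡ-≤ codim m≤B)))
              (Bounded-zeroOfSize T m (ℕP.≤-trans m≤B B≤T)))))))
    where
    open ℕP.≤-Reasoning
    -- The exponent is at least 1 and q ≥ 1, so no admissible m exceeds T and a search up to T
    -- suffices.
    root = greatest (λ m → m ^ suc codim * q ℕP.≤? T) z≤n T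
    B = proj₁ root
    sizes = List.map suc (List.upTo B)

    m≤m^ : ∀ m → m ≤ m ^ suc codim * q
    m≤m^ zero    = z≤n
    m≤m^ (suc m) = ℕP.≤-trans (ℕP.m≤m*n (suc m) (suc m ^ codim) {{ℕP.m^n≢0 (suc m) codim}}) (ℕP.m≤m*n (suc m ^ suc codim) q)

    B≤T : B ≤ T
    B≤T = ℕP.≤-trans (m≤m^ B) (proj₁ (proj₂ root))

    ∈-sizes : ∀ {m} → NonZero m → m ≤ B → m ∈ sizes
    ∈-sizes {suc m} _ m<B = ∈P.∈-map⁺ suc (∈P.∈-upTo⁺ m<B)

    small : ∀ {a} → SmallZero q T a → ∃ λ m → m ∈ sizes × m ≤ B × ZeroOfSize T m a
    small (m , m^≤T , z@(x , p , _)) = m , ∈-sizes (size≢0 {x = x} p) m≤B , m≤B , z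
      where
      m≤B : m ≤ B
      m≤B = proj₂ (proj₂ root) (ℕP.≤-trans (m≤m^ m) m^≤T) m^≤T

    regroup : ∀ q B S C L → q * (B * (S * C * L)) ≡ B * C * q * (S * L)
    regroup = solve-∀

    count : q * (length sizes * (shellConstant * B ^ codim * largeBox T)) ≤ T * (shellConstant * largeBox T)
    count = begin
      q * (length sizes * (shellConstant * B ^ codim * largeBox T))   ≡⟨ cong (λ l → q * (l * (shellConstant * B ^ codim * largeBox T))) (trans (ListP.length-map suc (List.upTo B)) (ListP.length-upTo B)) ⟩
      q * (B * (shellConstant * B ^ codim * largeBox T))              ≡⟨ regroup q B shellConstant (B ^ codim) (largeBox T) ⟩
      B ^ suc codim * q * (shellConstant * largeBox T)                ≤⟨ ℕP.*-monoˡ-≤ (shellConstant * largeBox T) (proj₁ (proj₂ root)) ⟩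
      T * (shellConstant * largeBox T)                                ∎

-- Primitive vectors have positive density

content-∣ : ∀ {N} (z : Vector ℤ N) i → content z ∣ ℤ.∣ z i ∣
content-∣ z zero    = gcd[m,n]∣m ℤ.∣ z zero ∣ (content (z ∘ suc))
content-∣ z (suc i) = ∣-trans (gcd[m,n]∣n ℤ.∣ z zero ∣ (content (z ∘ suc))) (content-∣ (z ∘ suc) i)

positives : ℕ → List ℕ
positives K = List.map suc (List.upTo K)

length-positives : ∀ K → length (positives K) ≡ K
length-positives K = trans (ListP.length-map suc (List.upTo K)) (ListP.length-upTo K)

∈-positives : ∀ {K c} → 1 ≤ c → c ≤ K → c ∈ positives K
∈-positives {c = suc c} _ c<K = ∈P.∈-map⁺ suc (∈P.∈-upTo⁺ c<K)

∈-positives⁻ : ∀ {K c} → c ∈ positives K → 1 ≤ c × c ≤ K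
∈-positives⁻ c∈ with ∈P.∈-map⁻ suc c∈
... | _ , c∈upTo , refl = s≤s z≤n , ∈P.∈-upTo⁻ c∈upTo

PositiveUpTo : ∀ {N} → ℕ → Vec ℕ N → Set
PositiveUpTo K a = ∀ i → 1 ≤ Vec.lookup a i × Vec.lookup a i ≤ K

length-positive-vectors : ∀ K N → length (vectors (positives K) N) ≡ K ^ N
length-positive-vectors K N = trans (length-vectors (positives K) N) (cong (_^ N) (length-positives K))

module _ (N : ℕ) (K : ℕ) where

  MultipleOf : ℕ → Vec ℕ (2 + N) → Set
  MultipleOf g a = PositiveUpTo K a × ∀ i → g ∣ Vec.lookup a i

  -- Division by g leaves ⌊K/g⌋^(2+N) vectors. Of the saving g^(2+N) only g² is kept, which suffices
  -- in every dimension from 2 on because the sum of 1/g² over g ≥ 2 is less than 1.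
  Bounded-multiples : ∀ g .{{_ : NonZero g}} → Bounded (MultipleOf g) (g * g) (K ^ (2 + N))
  Bounded-multiples g = Bounded-weaken count (subst (λ w → Bounded (MultipleOf g) w (g * g * length multiples)) (ℕP.*-identityʳ (g * g))
    (Bounded-*ˡ (g * g) (Bounded-⊆ {Q = _∈ multiples} (λ {a} → complete {a}) (Bounded-∈ multiples))))
    where
    open ℕP.≤-Reasoning
    quotients = vectors (positives (K ℕ./ g)) (2 + N)
    multiples = List.map (Vec.map (_* g)) quotients

    quotient : ∀ {c} → g ∣ c → ℕ
    quotient (divides q _) = q

    quotient-bounds : ∀ {c} (g∣c : g ∣ c) → 1 ≤ c → c ≤ K → 1 ≤ quotient g∣c × quotient g∣c ≤ K ℕ./ g
    quotient-bounds (divides zero refl)      () _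
    quotient-bounds (divides q@(suc _) refl) _  qg≤K = s≤s z≤n ,
      subst (_≤ K ℕ./ g) (DivMod.m*n/n≡m q g) (DivMod./-monoˡ-≤ g qg≤K)

    quotient-* : ∀ {c} (g∣c : g ∣ c) → quotient g∣c * g ≡ c
    quotient-* (divides _ e) = sym e

    complete : ∀ {a} → MultipleOf g a → a ∈ multiples
    complete {a} (pos , g∣) = subst (_∈ multiples) a≡
      (∈P.∈-map⁺ (Vec.map (_* g)) (∈-vectors b λ i →
        let l , u = quotient-bounds (g∣ i) (proj₁ (pos i)) (proj₂ (pos i)) in
        subst (_∈ positives (K ℕ./ g)) (sym (VecP.lookup∘tabulate (λ i → quotient (g∣ i)) i)) (∈-positives l u)))
      where
      b = Vec.tabulate λ i → quotient (g∣ i)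
      a≡ : Vec.map (_* g) b ≡ a
      a≡ = trans (sym (VecP.tabulate-∘ (_* g) (λ i → quotient (g∣ i))))
        (trans (VecP.tabulate-cong (λ i → quotient-* (g∣ i))) (VecP.tabulate∘lookup a))

    count : g * g * length multiples ≤ K ^ (2 + N)
    count = begin
      g * g * length multiples                  ≡⟨ cong (g * g *_) (trans (ListP.length-map (Vec.map (_* g)) quotients) (length-positive-vectors (K ℕ./ g) (2 + N))) ⟩
      g * g * (K ℕ./ g) ^ (2 + N)               ≤⟨ ℕP.*-monoˡ-≤ ((K ℕ./ g) ^ (2 + N)) (ℕP.*-monoʳ-≤ g (ℕP.m≤m*n g (g ^ N) {{ℕP.m^n≢0 g N}})) ⟩
      g ^ (2 + N) * (K ℕ./ g) ^ (2 + N)         ≡⟨ ^-distribʳ-* (2 + N) g (K ℕ./ g) ⟨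
      (g * (K ℕ./ g)) ^ (2 + N)                 ≤⟨ ℕP.^-monoˡ-≤ (2 + N) (subst (_≤ K) (ℕP.*-comm (K ℕ./ g) g) (DivMod.m/n*n≤m K g)) ⟩
      K ^ (2 + N)                               ∎

  Divisible : ℕ → Vec ℕ (2 + N) → Set
  Divisible G a = ∃ λ g → 2 ≤ g × g ≤ G × MultipleOf g a

  -- 1/2² + ⋯ + 1/G² ≤ 3/4 − 1/G, with denominators cleared and G = 2 + j.
  Bounded-divisible : ∀ j → Bounded (Divisible (2 + j)) (4 * (2 + j)) ((2 + 3 * j) * K ^ (2 + N))
  Bounded-divisible zero = Bounded-⊆ {Q = MultipleOf 2}
    (λ { {a} (g , 2≤g , g≤2 , m) → subst (λ g → MultipleOf g a) (ℕP.≤-antisym g≤2 2≤g) m })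
    (Bounded-*ˡ 2 (Bounded-multiples 2))
  Bounded-divisible (suc j) = Bounded-cancelˡ G
    (subst₂ (Bounded (Divisible (suc G))) (weights j) (bounds j (K ^ (2 + N)))
      (Bounded-⊆ {Q = λ a → Divisible G a ⊎ MultipleOf (suc G) a} (λ {a} → last {a})
        (Bounded-∪ (Bounded-*ˡ (suc G) (Bounded-divisible j))
          (subst (λ w → Bounded (MultipleOf (suc G)) w (4 * K ^ (2 + N))) (weights′ j)
            -- 1/(G+1)² is weakened to 1/(G(G+1)) = 1/G - 1/(G+1), which makes the sum telescope.
            (Bounded-*ˡ 4 (Bounded-weight (ℕP.*-monoʳ-≤ (suc G) (ℕP.n≤1+n G)) (Bounded-multiples (suc G))))))))
    where
    G = 2 + j
    weights′ : ∀ j → 4 * ((3 + j) * (2 + j)) ≡ (3 + j) * (4 * (2 + j))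
    weights′ = solve-∀
    weights : ∀ j → (3 + j) * (4 * (2 + j)) ≡ (2 + j) * (4 * (3 + j))
    weights = solve-∀
    bounds : ∀ j X → (3 + j) * ((2 + 3 * j) * X) + 4 * X ≡ (2 + j) * ((2 + 3 * (1 + j)) * X)
    bounds = solve-∀
    last : ∀ {a} → Divisible (suc G) a → Divisible G a ⊎ MultipleOf (suc G) a
    last (g , 2≤g , g≤ , m) with g ℕP.≟ suc G
    ... | yes refl = inj₂ m
    ... | no  g≢   = inj₁ (g , 2≤g , ℕ.s≤s⁻¹ (ℕP.≤∧≢⇒< g≤ g≢) , m)

  embed : ∀ {N} → Vec ℕ N → Vector ℤ N
  embed a i = + Vec.lookup a i

  -- The content divides an entry between 1 and K, so it is neither 0 nor greater than K; if it is
  -- not 1, it serves as the divisor g.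
  primitive-or-divisible : ∀ {a} → a ∈ vectors (positives K) (2 + N) →
             (PositiveUpTo K a × Primitive (embed a)) ⊎ Divisible K a
  primitive-or-divisible {a} a∈ with content (embed a) | content-∣ (embed a) | content (embed a) ℕP.≟ 1
  ... | g | g∣ | yes g≡1 = inj₁ ((λ i → ∈-positives⁻ (∈-vectors⁻ a a∈ i)) , g≡1)
  ... | g | g∣ | no  g≢1 = inj₂ (g , ≥2 g (g∣ zero) g≢1 , ℕP.≤-trans (∣⇒≤ {{ℕ.>-nonZero (proj₁ (pos zero))}} (g∣ zero)) (proj₂ (pos zero)) , pos , g∣)
    where
    pos : PositiveUpTo K a
    pos i = ∈-positives⁻ (∈-vectors⁻ a a∈ i)
    ≥2 : ∀ g → g ∣ Vec.lookup a zero → g ≢ 1 → 2 ≤ g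
    ≥2 zero          (divides q e) _ = contradiction (proj₁ (pos zero)) (subst (λ c → ¬ 1 ≤ c) (sym (trans e (ℕP.*-zeroʳ q))) λ ())
    ≥2 (suc zero)    _ 1≢1 = contradiction refl 1≢1
    ≥2 (suc (suc g)) _ _   = s≤s (s≤s z≤n)

  primitive-vectors : 2 ≤ K → ∃ λ as → Unique as ×
    All (λ (a : Vec ℕ (2 + N)) → PositiveUpTo K a × Primitive (embed a)) as ×
    K ^ (2 + N) ≤ 4 * length as
  primitive-vectors 2≤K with split (All.tabulate {xs = vectors (positives K) (2 + N)} primitive-or-divisible)
  ... | mkSplit {ys} {zs} s t lengths prims divs _ =
    ys , AllPairs-resp-⊇ s all! , prims , ℕP.+-cancelʳ-≤ (4 * length zs) X (4 * length ys) (begin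
      X + 4 * length zs                   ≤⟨ ℕP.+-monoʳ-≤ X few ⟩
      X + 3 * X                           ≡⟨ cong (4 *_) (trans (sym (length-positive-vectors K (2 + N))) (sym lengths)) ⟩
      4 * (length ys + length zs)         ≡⟨ ℕP.*-distribˡ-+ 4 (length ys) (length zs) ⟩
      4 * length ys + 4 * length zs       ∎)
    where
    open ℕP.≤-Reasoning
    X = K ^ (2 + N)
    all! : Unique (vectors (positives K) (2 + N))
    all! = vectors-unique (UniqueP.map⁺ ℕP.suc-injective (UniqueP.upTo⁺ K)) (2 + N)

    j = K ∸ 2
    K≡ : 2 + j ≡ K
    K≡ = ℕP.m+[n∸m]≡n 2≤K

    regroup : ∀ z j → 4 * z * (2 + j) ≡ z * (4 * (2 + j))
    regroup = solve-∀
    split3 : ∀ j X → (2 + 3 * j) * X + 4 * X ≡ 3 * X * (2 + j)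
    split3 = solve-∀

    few : 4 * length zs ≤ 3 * X
    few = ℕP.*-cancelʳ-≤ (4 * length zs) (3 * X) (2 + j) (begin
      4 * length zs * (2 + j)         ≡⟨ regroup (length zs) j ⟩
      length zs * (4 * (2 + j))       ≤⟨ Bounded-divisible j zs (AllPairs-resp-⊇ t all!) (subst (λ G → All (Divisible G) zs) (sym K≡) divs) ⟩
      -- The term -1/K of the bound 3/4 - 1/K is given up here.
      (2 + 3 * j) * X                 ≤⟨ ℕP.m≤m+n ((2 + 3 * j) * X) (4 * X) ⟩
      (2 + 3 * j) * X + 4 * X         ≡⟨ split3 j X ⟩
      3 * X * (2 + j)                 ∎)

positive-primitive-vectors : ∀ N K → 2 ≤ N → 2 ≤ K → ∃ λ as → Unique as ×
  All (λ (a : Vec ℕ N) → PositiveUpTo K a × Primitive (λ i → + Vec.lookup a i)) as ×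
  K ^ N ≤ 4 * length as
positive-primitive-vectors (suc (suc N)) K _ 2≤K = primitive-vectors N K 2≤K
positive-primitive-vectors (suc zero)    K (s≤s ())

-- Real and rational inequalities

-- The second argument is one less than the denominator, which is thus visibly nonzero. In
-- particular `frac 1 q` is 1/(q+1).
frac : ℕ → ℕ → ℚ
frac a s = + a ℚ./ suc s

ι : ℕ → ℚ
ι n = frac n 0

toℚᵘ-frac : ∀ a s → toℚᵘ (frac a s) ℚᵘ.≃ ℚᵘ.mkℚᵘ (+ a) s
toℚᵘ-frac a s = ℚP.toℚᵘ-fromℚᵘ (ℚᵘ.mkℚᵘ (+ a) s)

frac-mono-≤ : ∀ a b s t → a * suc t ≤ b * suc s → frac a s ℚ.≤ frac b t
frac-mono-≤ a b s t h = ℚP.toℚᵘ-cancel-≤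
  (ℚᵘP.≤-respˡ-≃ (ℚᵘP.≃-sym (toℚᵘ-frac a s))
  (ℚᵘP.≤-respʳ-≃ (ℚᵘP.≃-sym (toℚᵘ-frac b t))
  (ℚᵘ.*≤* (subst₂ ℤ._≤_ (ℤP.pos-* a (suc t)) (ℤP.pos-* b (suc s)) (ℤ.+≤+ h)))))

frac-mono-< : ∀ a b s t → a * suc t < b * suc s → frac a s ℚ.< frac b t
frac-mono-< a b s t h = ℚP.toℚᵘ-cancel-<
  (ℚᵘP.<-respˡ-≃ (ℚᵘP.≃-sym (toℚᵘ-frac a s))
  (ℚᵘP.<-respʳ-≃ (ℚᵘP.≃-sym (toℚᵘ-frac b t))
  (ℚᵘ.*<* (subst₂ ℤ._<_ (ℤP.pos-* a (suc t)) (ℤP.pos-* b (suc s)) (ℤ.+<+ h)))))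

frac-cancel-≤ : ∀ a b s t → frac a s ℚ.≤ frac b t → a * suc t ≤ b * suc s
frac-cancel-≤ a b s t h with a * suc t ℕP.≤? b * suc s
... | yes p = p
... | no ¬p = contradiction (ℚP.<-≤-trans (frac-mono-< b a t s (ℕP.≰⇒> ¬p)) h) (ℚP.<-irrefl refl)

frac-cong : ∀ a b s t → a * suc t ≡ b * suc s → frac a s ≡ frac b t
frac-cong a b s t e = ℚP.≤-antisym (frac-mono-≤ a b s t (ℕP.≤-reflexive e)) (frac-mono-≤ b a t s (ℕP.≤-reflexive (sym e)))

frac-* : ∀ a b s t → frac a s ℚ.* frac b t ≡ frac (a * b) (t + s * suc t)
frac-* a b s t = ℚP.toℚᵘ-injective (begin
  toℚᵘ (frac a s ℚ.* frac b t)                   ≈⟨ ℚP.toℚᵘ-homo-* (frac a s) (frac b t) ⟩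
  toℚᵘ (frac a s) ℚᵘ.* toℚᵘ (frac b t)           ≈⟨ ℚᵘP.*-cong (toℚᵘ-frac a s) (toℚᵘ-frac b t) ⟩
  ℚᵘ.mkℚᵘ (+ a ℤ.* + b) (t + s * suc t)          ≡⟨ cong (λ z → ℚᵘ.mkℚᵘ z (t + s * suc t)) (ℤP.pos-* a b) ⟨
  ℚᵘ.mkℚᵘ (+ (a * b)) (t + s * suc t)            ≈⟨ toℚᵘ-frac (a * b) (t + s * suc t) ⟨
  toℚᵘ (frac (a * b) (t + s * suc t))            ∎)
  where open ℚᵘP.≃-Reasoning

frac-+ : ∀ a b s → frac a s ℚ.+ frac b s ≡ frac (a + b) s
frac-+ a b s = ℚP.toℚᵘ-injective (begin
  toℚᵘ (frac a s ℚ.+ frac b s)                   ≈⟨ ℚP.toℚᵘ-homo-+ (frac a s) (frac b s) ⟩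
  toℚᵘ (frac a s) ℚᵘ.+ toℚᵘ (frac b s)           ≈⟨ ℚᵘP.+-cong (toℚᵘ-frac a s) (toℚᵘ-frac b s) ⟩
  ℚᵘ.mkℚᵘ (+ a) s ℚᵘ.+ ℚᵘ.mkℚᵘ (+ b) s           ≈⟨ ℚᵘ.*≡* (trans main (ℤP.pos-* (a + b) (suc s * suc s))) ⟩
  ℚᵘ.mkℚᵘ (+ (a + b)) s                          ≈⟨ toℚᵘ-frac (a + b) s ⟨
  toℚᵘ (frac (a + b) s)                          ∎)
  where
  open ℚᵘP.≃-Reasoning
  lemma : ∀ a b s → (a * s + b * s) * s ≡ (a + b) * (s * s)
  lemma = solve-∀
  main : (+ a ℤ.* + suc s ℤ.+ + b ℤ.* + suc s) ℤ.* + suc s ≡ + ((a + b) * (suc s * suc s))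
  main = trans (cong (ℤ._* + suc s) (cong₂ ℤ._+_ (sym (ℤP.pos-* a (suc s))) (sym (ℤP.pos-* b (suc s)))))
    (trans (sym (ℤP.pos-* (a * suc s + b * suc s) (suc s))) (cong +_ (lemma a b (suc s))))

ι-* : ∀ a b → ι a ℚ.* ι b ≡ ι (a * b)
ι-* a b = frac-* a b 0 0

ι-+ : ∀ a b → ι a ℚ.+ ι b ≡ ι (a + b)
ι-+ a b = frac-+ a b 0

ι-mono : ∀ {a b} → a ≤ b → ι a ℚ.≤ ι b
ι-mono {a} {b} a≤b = frac-mono-≤ a b 0 0 (ℕP.*-monoˡ-≤ 1 a≤b)

ι-cancel : ∀ {a b} → ι a ℚ.≤ ι b → a ≤ b
ι-cancel {a} {b} h = ℕP.*-cancelʳ-≤ a b 1 (frac-cancel-≤ a b 0 0 h)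

0≤ι : ∀ a → 0ℚ ℚ.≤ ι a
0≤ι a = ι-mono {0} {a} z≤n

*-mono-≤-nonNeg : ∀ {p q r s} → 0ℚ ℚ.≤ p → 0ℚ ℚ.≤ r → p ℚ.≤ q → r ℚ.≤ s → p ℚ.* r ℚ.≤ q ℚ.* s
*-mono-≤-nonNeg {p} {q} {r} {s} 0≤p 0≤r p≤q r≤s = ℚP.≤-trans
  (ℚP.*-monoʳ-≤-nonNeg r {{ℚ.nonNegative 0≤r}} p≤q)
  (ℚP.*-monoˡ-≤-nonNeg q {{ℚ.nonNegative (ℚP.≤-trans 0≤p p≤q)}} r≤s)

square-cancel-≤ : ∀ {a b} → a * a ≤ b * b → a ≤ b
square-cancel-≤ {a} {b} a²≤b² with a ℕP.≤? b
... | yes a≤b = a≤b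
... | no  a≰b = contradiction (ℕP.<-≤-trans (ℕP.*-mono-< (ℕP.≰⇒> a≰b) (ℕP.≰⇒> a≰b)) a²≤b²) (ℕP.<-irrefl refl)

isqrt-≥ : ∀ {b k} → b * b ≤ k → b ≤ isqrt k
isqrt-≥ {b} {k} b²≤k with b ℕP.≤? isqrt k
... | yes p = p
... | no ¬p = contradiction (ℕP.<-≤-trans (isqrt-upper k) (ℕP.≤-trans (ℕP.*-mono-≤ (ℕP.≰⇒> ¬p) (ℕP.≰⇒> ¬p)) b²≤k)) (ℕP.<-irrefl refl)

isqrt-≤ : ∀ {b k} → k ≤ b * b → isqrt k ≤ b
isqrt-≤ {b} {k} k≤b² with isqrt k ℕP.≤? b
... | yes p = p
... | no ¬p = contradiction (ℕP.<-≤-trans (ℕP.*-mono-< (ℕP.≰⇒> ¬p) (ℕP.≰⇒> ¬p)) (ℕP.≤-trans (isqrt-lower k) k≤b²)) (ℕP.<-irrefl refl)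

private
  square-* : ∀ b t → (b * t) * (b * t) ≡ (b * b) * (t * t)
  square-* = solve-∀

-- `b * suc i` is an integer, so rounding `suc i` times √m down does not fall below it. The bound
-- thus holds for each approximation and not only in the limit.
√-≥ : ∀ {b m} → b * b ≤ m → ∀ i → ι b ℚ.≤ seq (√ m) i
√-≥ {b} {m} b²≤m i = frac-mono-≤ b (isqrt (m * (suc i * suc i))) 0 i
  (subst (b * suc i ≤_) (sym (ℕP.*-identityʳ _))
    (isqrt-≥ (subst (_≤ m * (suc i * suc i)) (sym (square-* b (suc i))) (ℕP.*-monoˡ-≤ (suc i * suc i) b²≤m))))

√-≤ : ∀ {b m} → m ≤ b * b → ∀ i → seq (√ m) i ℚ.≤ ι b
√-≤ {b} {m} m≤b² i = frac-mono-≤ (isqrt (m * (suc i * suc i))) b i 0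
  (subst (_≤ b * suc i) (sym (ℕP.*-identityʳ _))
    (isqrt-≤ (subst (m * (suc i * suc i) ≤_) (sym (square-* b (suc i))) (ℕP.*-monoˡ-≤ (suc i * suc i) m≤b²))))

√-mono : ∀ {m m′} → m ≤ m′ → ∀ i → seq (√ m) i ℚ.≤ seq (√ m′) i
√-mono {m} {m′} m≤m′ i = frac-mono-≤ a b i i (ℕP.*-monoˡ-≤ (suc i)
  (isqrt-≥ {a} (ℕP.≤-trans (isqrt-lower (m * (suc i * suc i))) (ℕP.*-monoˡ-≤ (suc i * suc i) m≤m′))))
  where
  a = isqrt (m * (suc i * suc i))
  b = isqrt (m′ * (suc i * suc i))

0≤√ : ∀ m i → 0ℚ ℚ.≤ seq (√ m) i
0≤√ m i = √-≥ {0} {m} z≤n i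

0≤^ᴿ : ∀ x i k → 0ℚ ℚ.≤ seq x i → 0ℚ ℚ.≤ seq (x ^ᴿ k) i
0≤^ᴿ x i zero    _   = 0≤ι 1
0≤^ᴿ x i (suc k) 0≤x = *-mono-≤-nonNeg {0ℚ} {r = 0ℚ} ℚP.≤-refl ℚP.≤-refl 0≤x (0≤^ᴿ x i k 0≤x)

^ᴿ-mono : ∀ x y i k → 0ℚ ℚ.≤ seq x i → seq x i ℚ.≤ seq y i → seq (x ^ᴿ k) i ℚ.≤ seq (y ^ᴿ k) i
^ᴿ-mono x y i zero    _   _   = ℚP.≤-refl
^ᴿ-mono x y i (suc k) 0≤x x≤y = *-mono-≤-nonNeg 0≤x (0≤^ᴿ x i k 0≤x) x≤y (^ᴿ-mono x y i k 0≤x x≤y)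

^ᴿ-≥ : ∀ x b i k → ι b ℚ.≤ seq x i → ι (b ^ k) ℚ.≤ seq (x ^ᴿ k) i
^ᴿ-≥ x b i zero    _   = ℚP.≤-refl
^ᴿ-≥ x b i (suc k) b≤x = subst (ℚ._≤ seq (x ^ᴿ suc k) i) (ι-* b (b ^ k))
  (*-mono-≤-nonNeg (0≤ι b) (0≤ι (b ^ k)) b≤x (^ᴿ-≥ x b i k b≤x))

p<p+ε : ∀ p {ε} → 0ℚ ℚ.< ε → p ℚ.< p ℚ.+ ε
p<p+ε p 0<ε = subst (ℚ._< p ℚ.+ _) (ℚP.+-identityʳ p) (ℚP.+-monoʳ-< p 0<ε)

≤ᴿ-eventually : ∀ x y M → (∀ i → M ≤ i → seq x i ℚ.≤ seq y i) → x ≤ᴿ y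
≤ᴿ-eventually x y M x≤y (ε , 0<ε , N , y+ε≤x) = ℚP.<-irrefl refl
  (ℚP.<-≤-trans (p<p+ε (seq y i) 0<ε) (ℚP.≤-trans (y+ε≤x i (ℕP.m≤n⊔m M N)) (x≤y i (ℕP.m≤m⊔n M N))))
  where
  i = M ℕ.⊔ N

+-cancel : ∀ p q → p ℚ.+ q ℚ.- q ≡ p
+-cancel = solve 2 (λ p q → p :+ q :- q := p) refl
  where open +-*-Solver

halves : ∀ p → ½ ℚ.* p ℚ.+ ½ ℚ.* p ≡ p
halves p = trans (sym (ℚP.*-distribʳ-+ p ½ ½)) (ℚP.*-identityˡ p)

p≤∣p∣ : ∀ p → p ℚ.≤ ℚ.∣ p ∣
p≤∣p∣ p with p ℚP.≤? 0ℚ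
... | yes p≤0 = ℚP.≤-trans p≤0 (ℚP.0≤∣p∣ p)
... | no  p≰0 = ℚP.≤-reflexive (sym (ℚP.0≤p⇒∣p∣≡p (ℚP.<⇒≤ (ℚP.≰⇒> p≰0))))

near : ∀ {p q δ} → ℚ.∣ p ℚ.- q ∣ ℚ.< δ → p ℚ.≤ q ℚ.+ δ × q ℚ.≤ p ℚ.+ δ
near {p} {q} {δ} ∣p-q∣<δ =
  subst (ℚ._≤ q ℚ.+ δ) (cancel q p) (ℚP.+-monoʳ-≤ q (ℚP.≤-trans (p≤∣p∣ (p ℚ.- q)) (ℚP.<⇒≤ ∣p-q∣<δ))) ,
  subst (ℚ._≤ p ℚ.+ δ) (cancel p q) (ℚP.+-monoʳ-≤ p (ℚP.≤-trans (p≤∣p∣ (q ℚ.- p)) (subst (ℚ._≤ δ) flip (ℚP.<⇒≤ ∣p-q∣<δ))))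
  where
  open +-*-Solver
  cancel : ∀ q p → q ℚ.+ (p ℚ.- q) ≡ p
  cancel = solve 2 (λ q p → q :+ (p :- q) := p) refl
  flip : ℚ.∣ p ℚ.- q ∣ ≡ ℚ.∣ q ℚ.- p ∣
  flip = trans (sym (ℚP.∣-p∣≡∣p∣ (p ℚ.- q))) (cong ℚ.∣_∣ (solve 2 (λ p q → :- (p :- q) := q :- p) refl p q))

0<p-q : ∀ {p q} → q ℚ.< p → 0ℚ ℚ.< p ℚ.- q
0<p-q {p} {q} q<p = subst (ℚ._< p ℚ.- q) (ℚP.+-inverseʳ q) (ℚP.+-monoˡ-< (ℚ.- q) q<p)

-- _≤ᴿ_ is a negation, so ruling out c < m needs an approximation to y to
-- compare with the midpoint of c and m.
squeeze : ∀ {m c} x y z → (∀ i → m ℚ.≤ seq x i) → x ≤ᴿ y → y ≤ᴿ z → (∀ i → seq z i ℚ.≤ c) → m ℚ.≤ c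
squeeze {m} {c} x y z m≤x x≤y y≤z z≤c with m ℚP.≤? c
... | yes m≤c = m≤c
... | no  m≰c = contradiction (seq y N ℚP.≤? c ℚ.+ (δ ℚ.+ δ)) either
  where
  open +-*-Solver using (solve; _:=_; _:+_; _:-_)
  open ℚP.≤-Reasoning
  -- A quarter of the gap: `c + (δ + δ)` is the midpoint, and on either side a margin δ remains
  -- after the error δ of the approximation.
  δ : ℚ
  δ = ½ ℚ.* (½ ℚ.* (m ℚ.- c))

  half : ∀ {p} → 0ℚ ℚ.< p → 0ℚ ℚ.< ½ ℚ.* p
  half {p} 0<p = subst (ℚ._< ½ ℚ.* p) (ℚP.*-zeroʳ ½) (ℚP.*-monoʳ-<-pos ½ 0<p)

  0<δ : 0ℚ ℚ.< δ
  0<δ = half (half (0<p-q (ℚP.≰⇒> m≰c)))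

  N = proj₁ (cauchy y δ 0<δ)

  y-near : ∀ i → N ≤ i → seq y i ℚ.≤ seq y N ℚ.+ δ × seq y N ℚ.≤ seq y i ℚ.+ δ
  y-near i N≤i = near (proj₂ (cauchy y δ 0<δ) i N N≤i ℕP.≤-refl)

  either : ¬ Dec (seq y N ℚ.≤ c ℚ.+ (δ ℚ.+ δ))
  either (yes yN≤) = x≤y (δ , 0<δ , N , λ i N≤i → begin
    seq y i ℚ.+ δ                         ≤⟨ ℚP.+-monoˡ-≤ δ (proj₁ (y-near i N≤i)) ⟩
    seq y N ℚ.+ δ ℚ.+ δ                   ≤⟨ ℚP.+-monoˡ-≤ δ (ℚP.+-monoˡ-≤ δ yN≤) ⟩
    c ℚ.+ (δ ℚ.+ δ) ℚ.+ δ ℚ.+ δ           ≡⟨ trans (solve 2 (λ c d → c :+ (d :+ d) :+ d :+ d := (d :+ d) :+ (d :+ d) :+ c) refl c δ)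
                                               (trans (cong (λ h → h ℚ.+ h ℚ.+ c) (halves (½ ℚ.* (m ℚ.- c))))
                                               (trans (cong (ℚ._+ c) (halves (m ℚ.- c))) (solve 2 (λ m c → m :- c :+ c := m) refl m c))) ⟩
    m                                     ≤⟨ m≤x i ⟩
    seq x i                               ∎)
  either (no yN≰) = y≤z (δ , 0<δ , N , λ i N≤i → begin
    seq z i ℚ.+ δ                         ≤⟨ ℚP.+-monoˡ-≤ δ (z≤c i) ⟩
    c ℚ.+ δ                               ≡⟨ solve 2 (λ c d → c :+ d := c :+ (d :+ d) :- d) refl c δ ⟩
    c ℚ.+ (δ ℚ.+ δ) ℚ.- δ                 ≤⟨ ℚP.+-monoˡ-≤ (ℚ.- δ) (ℚP.<⇒≤ (ℚP.≰⇒> yN≰)) ⟩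
    seq y N ℚ.- δ                         ≤⟨ ℚP.+-monoˡ-≤ (ℚ.- δ) (proj₂ (y-near i N≤i)) ⟩
    seq y i ℚ.+ δ ℚ.- δ                   ≡⟨ +-cancel (seq y i) δ ⟩
    seq y i                               ∎)

between : ∀ q → 0ℚ ℚ.≤ q → ∃ λ f → ι f ℚ.≤ q × q ℚ.≤ ι (suc f)
between q@(ℚ.mkℚ (+ n) d _) _ =
  n ℕ./ suc d ,
  subst (ι (n ℕ./ suc d) ℚ.≤_) (ℚP.↥p/↧p≡p q) (frac-mono-≤ (n ℕ./ suc d) n 0 d
    (subst (n ℕ./ suc d * suc d ≤_) (sym (ℕP.*-identityʳ n)) (DivMod.m/n*n≤m n (suc d)))) ,
  subst (ℚ._≤ ι (suc (n ℕ./ suc d))) (ℚP.↥p/↧p≡p q) (frac-mono-≤ n (suc (n ℕ./ suc d)) d 0 (begin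
    n * 1                                        ≡⟨ ℕP.*-identityʳ n ⟩
    n                                            ≡⟨ DivMod.m≡m%n+[m/n]*n n (suc d) ⟩
    n ℕ.% suc d + n ℕ./ suc d * suc d            ≤⟨ ℕP.+-monoˡ-≤ (n ℕ./ suc d * suc d) (ℕP.<⇒≤ (DivMod.m%n<n n (suc d))) ⟩
    suc (n ℕ./ suc d) * suc d                    ∎))
  where open ℕP.≤-Reasoning
between (ℚ.mkℚ -[1+ n ] d _) (ℚ.*≤* ())

bounded-above : ∀ x → ∃₂ λ U N → ∀ i → N ≤ i → seq x i ℚ.≤ ι U
bounded-above x =
  let N , close = cauchy x 1ℚ (ℚP.positive⁻¹ 1ℚ)
      f , _ , ≤f = between ℚ.∣ seq x N ∣ (ℚP.0≤∣p∣ (seq x N))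
  in suc f + 1 , N , λ i N≤i → ℚP.≤-trans (proj₁ (near (close i N N≤i ℕP.≤-refl)))
       (subst (seq x N ℚ.+ 1ℚ ℚ.≤_) (ι-+ (suc f) 1) (ℚP.+-monoˡ-≤ 1ℚ (ℚP.≤-trans (p≤∣p∣ (seq x N)) ≤f)))

-- The floor of a real is not computable. Here T is one less than the floor f of a single
-- approximation whose error is at most 1, so the later terms lie between f - 1 and f + 2; this
-- explains the window of length 3.
approximate : ∀ x M → fromℚ (ι (3 + M)) ≤ᴿ x →
  ∃ λ T → M ≤ T × ∃ λ N → ∀ i → N ≤ i → ι T ℚ.≤ seq x i × seq x i ℚ.≤ ι (3 + T)
approximate x M M≤x with cauchy x 1ℚ (ℚP.positive⁻¹ 1ℚ)
... | N , close = conclude (between a (ℚP.≤-trans (0≤ι (2 + M)) M≤a))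
  where
  open ℚP.≤-Reasoning
  open +-*-Solver using (solve; _:=_; _:+_; _:-_)
  a = seq x N

  x-near : ∀ i → N ≤ i → seq x i ℚ.≤ a ℚ.+ 1ℚ × a ℚ.≤ seq x i ℚ.+ 1ℚ
  x-near i N≤i = near {seq x i} {a} {1ℚ} (close i N N≤i ℕP.≤-refl)

  M≤a+1 : ι (3 + M) ℚ.≤ a ℚ.+ 1ℚ
  M≤a+1 = ℚP.≮⇒≥ λ lt → M≤x (ι (3 + M) ℚ.- (a ℚ.+ 1ℚ) , 0<p-q lt , N , λ i N≤i → begin
    seq x i ℚ.+ (ι (3 + M) ℚ.- (a ℚ.+ 1ℚ))       ≤⟨ ℚP.+-monoˡ-≤ (ι (3 + M) ℚ.- (a ℚ.+ 1ℚ)) (proj₁ (x-near i N≤i)) ⟩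
    a ℚ.+ 1ℚ ℚ.+ (ι (3 + M) ℚ.- (a ℚ.+ 1ℚ))      ≡⟨ solve 2 (λ b c → b :+ (c :- b) := c) refl (a ℚ.+ 1ℚ) (ι (3 + M)) ⟩
    ι (3 + M)                                    ∎)

  M≤a : ι (2 + M) ℚ.≤ a
  M≤a = begin
    ι (2 + M)                       ≡⟨ +-cancel (ι (2 + M)) 1ℚ ⟨
    ι (2 + M) ℚ.+ 1ℚ ℚ.- 1ℚ         ≡⟨ cong (ℚ._- 1ℚ) (trans (ι-+ (2 + M) 1) (cong ι (ℕP.+-comm (2 + M) 1))) ⟩
    ι (3 + M) ℚ.- 1ℚ                ≤⟨ ℚP.+-monoˡ-≤ (ℚ.- 1ℚ) M≤a+1 ⟩
    a ℚ.+ 1ℚ ℚ.- 1ℚ                 ≡⟨ +-cancel a 1ℚ ⟩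
    a                               ∎

  conclude : (∃ λ f → ι f ℚ.≤ a × a ℚ.≤ ι (suc f)) →
    ∃ λ T → M ≤ T × ∃ λ N → ∀ i → N ≤ i → ι T ℚ.≤ seq x i × seq x i ℚ.≤ ι (3 + T)
  conclude (zero , _ , a≤1) = contradiction (ι-cancel {2 + M} {1} (ℚP.≤-trans M≤a a≤1)) λ { (s≤s ()) }
  conclude (suc T , T+1≤a , a≤T+2) = T , ℕ.s≤s⁻¹ (ℕ.s≤s⁻¹ (ι-cancel {2 + M} {2 + T} (ℚP.≤-trans M≤a a≤T+2))) , N , λ i N≤i →
    let x≤a+1 , a≤x+1 = x-near i N≤i in
    (begin
      ι T                             ≡⟨ +-cancel (ι T) 1ℚ ⟨
      ι T ℚ.+ 1ℚ ℚ.- 1ℚ               ≡⟨ cong (ℚ._- 1ℚ) (trans (ι-+ T 1) (cong ι (ℕP.+-comm T 1))) ⟩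
      ι (suc T) ℚ.- 1ℚ                ≤⟨ ℚP.+-monoˡ-≤ (ℚ.- 1ℚ) (ℚP.≤-trans T+1≤a a≤x+1) ⟩
      seq x i ℚ.+ 1ℚ ℚ.- 1ℚ           ≡⟨ +-cancel (seq x i) 1ℚ ⟩
      seq x i                         ∎) ,
    (begin
      seq x i                         ≤⟨ x≤a+1 ⟩
      a ℚ.+ 1ℚ                        ≤⟨ ℚP.+-monoˡ-≤ 1ℚ a≤T+2 ⟩
      ι (2 + T) ℚ.+ 1ℚ                ≡⟨ trans (ι-+ (2 + T) 1) (cong ι (ℕP.+-comm (2 + T) 1)) ⟩
      ι (3 + T)                       ∎)

-- Projective points and their primitive vectors

module ℚ∑ = Algebra.Properties.Semiring.Sum (CommutativeRing.semiring ℚP.+-*-commutativeRing)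
module ℚ^ = Algebra.Definitions.RawSemiring ℚ.+-*-rawSemiring

τ : ℤ → ℚ
τ a = a ℚ./ 1

toℚᵘ-τ : ∀ a → toℚᵘ (τ a) ℚᵘ.≃ ℚᵘ.mkℚᵘ a 0
toℚᵘ-τ a = ℚP.toℚᵘ-fromℚᵘ (ℚᵘ.mkℚᵘ a 0)

τ-* : ∀ a b → τ (a ℤ.* b) ≡ τ a ℚ.* τ b
τ-* a b = ℚP.toℚᵘ-injective (begin
  toℚᵘ (τ (a ℤ.* b))                 ≈⟨ toℚᵘ-τ (a ℤ.* b) ⟩
  ℚᵘ.mkℚᵘ a 0 ℚᵘ.* ℚᵘ.mkℚᵘ b 0       ≈⟨ ℚᵘP.*-cong (toℚᵘ-τ a) (toℚᵘ-τ b) ⟨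
  toℚᵘ (τ a) ℚᵘ.* toℚᵘ (τ b)         ≈⟨ ℚP.toℚᵘ-homo-* (τ a) (τ b) ⟨
  toℚᵘ (τ a ℚ.* τ b)                 ∎)
  where open ℚᵘP.≃-Reasoning

τ-+ : ∀ a b → τ (a ℤ.+ b) ≡ τ a ℚ.+ τ b
τ-+ a b = ℚP.toℚᵘ-injective (begin
  toℚᵘ (τ (a ℤ.+ b))                 ≈⟨ toℚᵘ-τ (a ℤ.+ b) ⟩
  ℚᵘ.mkℚᵘ (a ℤ.+ b) 0                ≡⟨ cong₂ (λ s t → ℚᵘ.mkℚᵘ (s ℤ.+ t) 0) (ℤP.*-identityʳ a) (ℤP.*-identityʳ b) ⟨
  ℚᵘ.mkℚᵘ a 0 ℚᵘ.+ ℚᵘ.mkℚᵘ b 0       ≈⟨ ℚᵘP.+-cong (toℚᵘ-τ a) (toℚᵘ-τ b) ⟨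
  toℚᵘ (τ a) ℚᵘ.+ toℚᵘ (τ b)         ≈⟨ ℚP.toℚᵘ-homo-+ (τ a) (τ b) ⟨
  toℚᵘ (τ a ℚ.+ τ b)                 ∎)
  where open ℚᵘP.≃-Reasoning

τ-injective : ∀ {a b} → τ a ≡ τ b → a ≡ b
τ-injective {a} {b} e = ℤP.*-cancelʳ-≡ a b (+ 1) (ℚᵘP.drop-*≡* (ℚᵘP.≃-trans (ℚᵘP.≃-sym (toℚᵘ-τ a))
  (ℚᵘP.≃-trans (ℚᵘP.≃-reflexive (cong toℚᵘ e)) (toℚᵘ-τ b))))

τ-numerator : ∀ q → τ (+ ℚ.↧ₙ q) ℚ.* q ≡ τ (ℚ.↥ q)
τ-numerator q = ℚP.toℚᵘ-injective (begin
  toℚᵘ (τ (+ ℚ.↧ₙ q) ℚ.* q)              ≈⟨ ℚP.toℚᵘ-homo-* (τ (+ ℚ.↧ₙ q)) q ⟩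
  toℚᵘ (τ (+ ℚ.↧ₙ q)) ℚᵘ.* toℚᵘ q        ≈⟨ ℚᵘP.*-congʳ {toℚᵘ q} (toℚᵘ-τ (+ ℚ.↧ₙ q)) ⟩
  ℚᵘ.mkℚᵘ (+ ℚ.↧ₙ q) 0 ℚᵘ.* toℚᵘ q       ≈⟨ cancel q ⟩
  ℚᵘ.mkℚᵘ (ℚ.↥ q) 0                      ≈⟨ toℚᵘ-τ (ℚ.↥ q) ⟨
  toℚᵘ (τ (ℚ.↥ q))                       ∎)
  where
  open ℚᵘP.≃-Reasoning
  cancel : ∀ q → ℚᵘ.mkℚᵘ (+ ℚ.↧ₙ q) 0 ℚᵘ.* toℚᵘ q ℚᵘ.≃ ℚᵘ.mkℚᵘ (ℚ.↥ q) 0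
  cancel (ℚ.mkℚ n d _) = ℚᵘ.*≡* (trans (ℤP.*-identityʳ (+ suc d ℤ.* n))
    (trans (ℤP.*-comm (+ suc d) n)
      (cong (λ t → n ℤ.* + suc t) (sym (ℕP.+-identityʳ d)))))

τ-^ : ∀ a k → τ (a ℤ^.^ k) ≡ τ a ℚ^.^ k
τ-^ a zero    = refl
τ-^ a (suc k) = trans (τ-* a (a ℤ^.^ k)) (cong (τ a ℚ.*_) (τ-^ a k))

τ-sum : ∀ {k} (f : Vector ℤ k) → τ (ℤ∑.sum f) ≡ ℚ∑.sum (τ ∘ f)
τ-sum {zero}  f = refl
τ-sum {suc k} f = trans (τ-+ (f zero) (ℤ∑.sum (f ∘ suc))) (cong (τ (f zero) ℚ.+_) (τ-sum (f ∘ suc)))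

inverse : ∀ c → c ≢ 0ℚ → ∃ λ c⁻¹ → c⁻¹ ℚ.* c ≡ 1ℚ
inverse c c≢0 = (ℚ.1/ c) {{ℚ.≢-nonZero c≢0}} , ℚP.*-inverseˡ c {{ℚ.≢-nonZero c≢0}}

*-cancelˡ-≢0 : ∀ c {p q} → c ≢ 0ℚ → c ℚ.* p ≡ c ℚ.* q → p ≡ q
*-cancelˡ-≢0 c {p} {q} c≢0 cp≡cq = let c⁻¹ , c⁻¹c≡1 = inverse c c≢0
                                       undo = λ r → trans (sym (ℚP.*-assoc c⁻¹ c r)) (trans (cong (ℚ._* r) c⁻¹c≡1) (ℚP.*-identityˡ r))
  in trans (sym (undo p)) (trans (cong (c⁻¹ ℚ.*_) cp≡cq) (undo q))

≢0-* : ∀ {p q} → p ≢ 0ℚ → q ≢ 0ℚ → p ℚ.* q ≢ 0ℚ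
≢0-* {p} p≢0 q≢0 pq≡0 = q≢0 (*-cancelˡ-≢0 p p≢0 (trans pq≡0 (sym (ℚP.*-zeroʳ p))))

≢0-^ : ∀ {p} k → p ≢ 0ℚ → p ℚ^.^ k ≢ 0ℚ
≢0-^ zero    _   = ℚP.1≢0
≢0-^ (suc k) p≢0 = ≢0-* p≢0 (≢0-^ k p≢0)

*-^ : ∀ p q k → (p ℚ.* q) ℚ^.^ k ≡ p ℚ^.^ k ℚ.* q ℚ^.^ k
*-^ p q zero    = refl
*-^ p q (suc k) = trans (cong (p ℚ.* q ℚ.*_) (*-^ p q k)) (shuffle p q (p ℚ^.^ k) (q ℚ^.^ k))
  where
  open +-*-Solver
  shuffle : ∀ a b c d → a ℚ.* b ℚ.* (c ℚ.* d) ≡ a ℚ.* c ℚ.* (b ℚ.* d)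
  shuffle = solve 4 (λ a b c d → a :* b :* (c :* d) := a :* c :* (b :* d)) refl

^-+ : ∀ p k l → p ℚ^.^ (k + l) ≡ p ℚ^.^ k ℚ.* p ℚ^.^ l
^-+ p zero    l = sym (ℚP.*-identityˡ (p ℚ^.^ l))
^-+ p (suc k) l = trans (cong (p ℚ.*_) (^-+ p k l)) (sym (ℚP.*-assoc p (p ℚ^.^ k) (p ℚ^.^ l)))

product-scale : ∀ {k} (e : Vec ℕ k) c (X : Vector ℚ k) (x : Vector ℤ k) → (∀ j → X j ≡ c ℚ.* τ (x j)) →
  ℚ^.product (λ j → X j ℚ^.^ Vec.lookup e j) ≡ c ℚ^.^ Vec.sum e ℚ.* τ (monomialValue e x)
product-scale []       c X x X≡cx = refl
product-scale (e₀ ∷ e) c X x X≡cx = begin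
  X zero ℚ^.^ e₀ ℚ.* ℚ^.product (λ j → X (suc j) ℚ^.^ Vec.lookup e j)
    ≡⟨ cong₂ ℚ._*_ head (product-scale e c (X ∘ suc) (x ∘ suc) (X≡cx ∘ suc)) ⟩
  (c ℚ^.^ e₀ ℚ.* τ (x zero ℤ^.^ e₀)) ℚ.* (c ℚ^.^ Vec.sum e ℚ.* τ (monomialValue e (x ∘ suc)))
    ≡⟨ shuffle (c ℚ^.^ e₀) (τ (x zero ℤ^.^ e₀)) (c ℚ^.^ Vec.sum e) (τ (monomialValue e (x ∘ suc))) ⟩
  (c ℚ^.^ e₀ ℚ.* c ℚ^.^ Vec.sum e) ℚ.* (τ (x zero ℤ^.^ e₀) ℚ.* τ (monomialValue e (x ∘ suc)))
    ≡⟨ cong₂ ℚ._*_ (^-+ c e₀ (Vec.sum e)) (τ-* (x zero ℤ^.^ e₀) (monomialValue e (x ∘ suc))) ⟨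
  c ℚ^.^ (e₀ + Vec.sum e) ℚ.* τ (monomialValue (e₀ ∷ e) x)   ∎
  where
  open ≡-Reasoning
  open +-*-Solver
  shuffle : ∀ a b c d → a ℚ.* b ℚ.* (c ℚ.* d) ≡ a ℚ.* c ℚ.* (b ℚ.* d)
  shuffle = solve 4 (λ a b c d → a :* b :* (c :* d) := a :* c :* (b :* d)) refl
  head : X zero ℚ^.^ e₀ ≡ c ℚ^.^ e₀ ℚ.* τ (x zero ℤ^.^ e₀)
  head = trans (cong (ℚ^._^ e₀) (X≡cx zero)) (trans (*-^ c (τ (x zero)) e₀) (cong (c ℚ^.^ e₀ ℚ.*_) (sym (τ-^ (x zero) e₀))))

monomials-degree : ∀ k d → All (λ e → Vec.sum e ≡ d) (monomials k d)
monomials-degree k       zero    = sum-0 k ∷ []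
monomials-degree zero    (suc d) = []
monomials-degree (suc k) (suc d) = AllP.++⁺
  (AllP.map⁺ (All.map (λ { {_ ∷ _} s → cong suc s }) (monomials-degree (suc k) d)))
  (AllP.map⁺ (monomials-degree k (suc d)))

content-scale : ∀ {N} g (z a : Vector ℤ N) → (∀ i → ℤ.∣ z i ∣ ≡ g * ℤ.∣ a i ∣) → content z ≡ g * content a
content-scale {zero}  g z a z≡ga = sym (ℕP.*-zeroʳ g)
content-scale {suc N} g z a z≡ga = trans
  (cong₂ gcd (z≡ga zero) (content-scale g (z ∘ suc) (a ∘ suc) (z≡ga ∘ suc)))
  (sym (c*gcd[m,n]≡gcd[cm,cn] g ℤ.∣ a zero ∣ (content (a ∘ suc))))

content-cong : ∀ {k} {a b : Vector ℤ k} → (∀ i → a i ≡ b i) → content a ≡ content b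
content-cong {zero}  _   = refl
content-cong {suc k} a≡b = cong₂ gcd (cong ℤ.∣_∣ (a≡b zero)) (content-cong (a≡b ∘ suc))

normSq-cong : ∀ {N} {a b : Vector ℤ N} → (∀ i → ℤ.∣ a i ∣ ≡ ℤ.∣ b i ∣) → normSq a ≡ normSq b
normSq-cong {zero}  _   = refl
normSq-cong {suc N} a≡b = cong₂ _+_ (cong₂ _*_ (a≡b zero) (a≡b zero)) (normSq-cong (a≡b ∘ suc))

-- Clearing the denominator of r gives ↧r · a = ↥r · b. Both contents being 1, comparing the
-- contents of the two sides yields ↧r = |↥r|, and this factor cancels.
primitive-proportional : ∀ {N} {a b : Vector ℤ N} → Primitive a → Primitive b →
  ∀ r → (∀ i → τ (a i) ≡ r ℚ.* τ (b i)) → ∀ i → ℤ.∣ a i ∣ ≡ ℤ.∣ b i ∣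
primitive-proportional {a = a} {b} a-prim b-prim r a≡rb i =
  ℕP.*-cancelˡ-≡ _ _ (ℚ.↧ₙ r) (trans (sym (ℤP.abs-* (+ ℚ.↧ₙ r) (a i)))
    (trans (qa≡pb i) (cong (_* ℤ.∣ b i ∣) (sym q≡p))))
  where
  open ≡-Reasoning
  z = λ i → + ℚ.↧ₙ r ℤ.* a i
  z≡ : ∀ i → z i ≡ ℚ.↥ r ℤ.* b i
  z≡ i = τ-injective (begin
    τ (+ ℚ.↧ₙ r ℤ.* a i)               ≡⟨ τ-* (+ ℚ.↧ₙ r) (a i) ⟩
    τ (+ ℚ.↧ₙ r) ℚ.* τ (a i)           ≡⟨ cong (τ (+ ℚ.↧ₙ r) ℚ.*_) (a≡rb i) ⟩
    τ (+ ℚ.↧ₙ r) ℚ.* (r ℚ.* τ (b i))   ≡⟨ ℚP.*-assoc (τ (+ ℚ.↧ₙ r)) r (τ (b i)) ⟨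
    τ (+ ℚ.↧ₙ r) ℚ.* r ℚ.* τ (b i)     ≡⟨ cong (ℚ._* τ (b i)) (τ-numerator r) ⟩
    τ (ℚ.↥ r) ℚ.* τ (b i)              ≡⟨ τ-* (ℚ.↥ r) (b i) ⟨
    τ (ℚ.↥ r ℤ.* b i)                  ∎)
  qa≡pb : ∀ i → ℤ.∣ z i ∣ ≡ ℤ.∣ ℚ.↥ r ∣ * ℤ.∣ b i ∣
  qa≡pb i = trans (cong ℤ.∣_∣ (z≡ i)) (ℤP.abs-* (ℚ.↥ r) (b i))
  q≡p : ℚ.↧ₙ r ≡ ℤ.∣ ℚ.↥ r ∣
  q≡p = begin
    ℚ.↧ₙ r                        ≡⟨ ℕP.*-identityʳ (ℚ.↧ₙ r) ⟨
    ℚ.↧ₙ r * 1                    ≡⟨ cong (ℚ.↧ₙ r *_) a-prim ⟨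
    ℚ.↧ₙ r * content a            ≡⟨ content-scale (ℚ.↧ₙ r) z a (λ i → ℤP.abs-* (+ ℚ.↧ₙ r) (a i)) ⟨
    content z                     ≡⟨ content-scale ℤ.∣ ℚ.↥ r ∣ z b qa≡pb ⟩
    ℤ.∣ ℚ.↥ r ∣ * content b       ≡⟨ cong (ℤ.∣ ℚ.↥ r ∣ *_) b-prim ⟩
    ℤ.∣ ℚ.↥ r ∣ * 1               ≡⟨ ℕP.*-identityʳ ℤ.∣ ℚ.↥ r ∣ ⟩
    ℤ.∣ ℚ.↥ r ∣                   ∎

represents-unique : ∀ {N} {a b : Vector ℤ N} (x y : Projective N) → Primitive a → Primitive b →
  a Represents x → b Represents y → x ∼ y → ∀ i → ℤ.∣ a i ∣ ≡ ℤ.∣ b i ∣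
represents-unique {a = a} {b} x y a-prim b-prim (c , c≢0 , x≡ca) (e , _ , y≡eb) (s , _ , x≡sy) =
  let c⁻¹ , c⁻¹c≡1 = inverse c c≢0 in
  primitive-proportional a-prim b-prim (c⁻¹ ℚ.* (s ℚ.* e)) λ i → begin
    τ (a i)                              ≡⟨ ℚP.*-identityˡ (τ (a i)) ⟨
    1ℚ ℚ.* τ (a i)                       ≡⟨ cong (ℚ._* τ (a i)) c⁻¹c≡1 ⟨
    c⁻¹ ℚ.* c ℚ.* τ (a i)                ≡⟨ ℚP.*-assoc c⁻¹ c (τ (a i)) ⟩
    c⁻¹ ℚ.* (c ℚ.* τ (a i))              ≡⟨ cong (c⁻¹ ℚ.*_) (x≡ca i) ⟨
    c⁻¹ ℚ.* coord x i                    ≡⟨ cong (c⁻¹ ℚ.*_) (trans (x≡sy i) (cong (s ℚ.*_) (y≡eb i))) ⟩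
    c⁻¹ ℚ.* (s ℚ.* (e ℚ.* τ (b i)))      ≡⟨ shuffle c⁻¹ s e (τ (b i)) ⟩
    c⁻¹ ℚ.* (s ℚ.* e) ℚ.* τ (b i)        ∎
  where
  open ≡-Reasoning
  open +-*-Solver using (solve; _:=_; _:*_)
  shuffle : ∀ a b c d → a ℚ.* (b ℚ.* (c ℚ.* d)) ≡ a ℚ.* (b ℚ.* c) ℚ.* d
  shuffle = solve 4 (λ a b c d → a :* (b :* (c :* d)) := a :* (b :* c) :* d) refl

primVec-primitive : ∀ {N} (x : Projective N) → Primitive (primVec x)
primVec-primitive x = proj₁ (proj₂ (primVec-exists x))

primVec-represents : ∀ {N} (x : Projective N) → primVec x Represents x
primVec-represents x = proj₂ (proj₂ (primVec-exists x))

primVec-cong : ∀ {N} (x y : Projective N) → x ∼ y → ∀ i → ℤ.∣ primVec x i ∣ ≡ ℤ.∣ primVec y i ∣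
primVec-cong x y = represents-unique x y (primVec-primitive x) (primVec-primitive y) (primVec-represents x) (primVec-represents y)

primVec-injective : ∀ {N} (x y : Projective N) → (∀ i → primVec x i ≡ primVec y i) → x ∼ y
primVec-injective x y a≡b =
  let c , c≢0 , x≡ca = primVec-represents x
      e , e≢0 , y≡eb = primVec-represents y
      e⁻¹ , e⁻¹e≡1 = inverse e e≢0
  in c ℚ.* e⁻¹ ,
     ≢0-* c≢0 (λ e⁻¹≡0 → ℚP.1≢0 (trans (sym e⁻¹e≡1) (trans (cong (ℚ._* e) e⁻¹≡0) (ℚP.*-zeroˡ e)))) ,
     λ i → begin
       coord x i                               ≡⟨ x≡ca i ⟩
       c ℚ.* τ (primVec x i)                   ≡⟨ cong (λ z → c ℚ.* τ z) (a≡b i) ⟩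
       c ℚ.* τ (primVec y i)                   ≡⟨ cong (c ℚ.*_) (trans (cong (ℚ._* τ (primVec y i)) e⁻¹e≡1) (ℚP.*-identityˡ _)) ⟨
       c ℚ.* (e⁻¹ ℚ.* e ℚ.* τ (primVec y i))   ≡⟨ shuffle c e⁻¹ e (τ (primVec y i)) ⟩
       c ℚ.* e⁻¹ ℚ.* (e ℚ.* τ (primVec y i))   ≡⟨ cong (c ℚ.* e⁻¹ ℚ.*_) (y≡eb i) ⟨
       c ℚ.* e⁻¹ ℚ.* coord y i                 ∎
  where
  open ≡-Reasoning
  open +-*-Solver using (solve; _:=_; _:*_)
  shuffle : ∀ a b c d → a ℚ.* (b ℚ.* c ℚ.* d) ≡ a ℚ.* b ℚ.* (c ℚ.* d)
  shuffle = solve 4 (λ a b c d → a :* (b :* c :* d) := a :* b :* (c :* d)) refl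

module _ (d n : ℕ) where
  open Hypersurfaces d n

  degree-monomial : ∀ i → Vec.sum (monomial i) ≡ d
  degree-monomial i = All.lookup (monomials-degree (suc n) d) (∈P.∈-lookup {xs = monomials (suc n) d} (cast (sym (length-monomials n d)) i))

  evaluate-scale : ∀ (V : Vector ℚ N) (X : Vector ℚ (suc n)) c a e x → (∀ i → V i ≡ c ℚ.* τ (a i)) → (∀ j → X j ≡ e ℚ.* τ (x j)) →
    evaluate V X ≡ c ℚ.* e ℚ^.^ d ℚ.* τ (a ∙ veronese d n x)
  evaluate-scale V X c a e x V≡ca X≡ex = begin
    evaluate V X
      ≡⟨ ℚ∑.sum-cong-≗ (λ i → trans (cong₂ ℚ._*_ (V≡ca i) (trans (product-scale (monomial i) e X x X≡ex) (cong (λ k → e ℚ^.^ k ℚ.* τ (veronese d n x i)) (degree-monomial i))))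
                             (trans (shuffle c (τ (a i)) (e ℚ^.^ d) (τ (veronese d n x i))) (cong (c ℚ.* e ℚ^.^ d ℚ.*_) (sym (τ-* (a i) (veronese d n x i)))))) ⟩
    ℚ∑.sum (λ i → c ℚ.* e ℚ^.^ d ℚ.* τ (a i ℤ.* veronese d n x i))
      ≡⟨ ℚ∑.*-distribˡ-sum (c ℚ.* e ℚ^.^ d) (λ i → τ (a i ℤ.* veronese d n x i)) ⟨
    c ℚ.* e ℚ^.^ d ℚ.* ℚ∑.sum (λ i → τ (a i ℤ.* veronese d n x i))
      ≡⟨ cong (c ℚ.* e ℚ^.^ d ℚ.*_) (τ-sum (λ i → a i ℤ.* veronese d n x i)) ⟨
    c ℚ.* e ℚ^.^ d ℚ.* τ (a ∙ veronese d n x) ∎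
    where
    open ≡-Reasoning
    open +-*-Solver using (solve; _:=_; _:*_)
    shuffle : ∀ a b c d → a ℚ.* b ℚ.* (c ℚ.* d) ≡ a ℚ.* c ℚ.* (b ℚ.* d)
    shuffle = solve 4 (λ a b c d → a :* b :* (c :* d) := a :* c :* (b :* d)) refl

  LiesOn⇒vanishes : ∀ X V → X LiesOn V → primVec V ∙ veronese d n (primVec X) ≡ 0ℤ
  LiesOn⇒vanishes X V on =
    let c , c≢0 , V≡ca = primVec-represents V
        e , e≢0 , X≡ex = primVec-represents X
        v = primVec V ∙ veronese d n (primVec X)
        s≢0 = ≢0-* c≢0 (≢0-^ d e≢0)
    in τ-injective (*-cancelˡ-≢0 (c ℚ.* e ℚ^.^ d) s≢0
         (trans (sym (evaluate-scale (coord V) (coord X) c (primVec V) e (primVec X) V≡ca X≡ex))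
           (trans on (sym (ℚP.*-zeroʳ (c ℚ.* e ℚ^.^ d))))))

  LiesOn-resp-∼ : ∀ X V W → V ∼ W → X LiesOn W → X LiesOn V
  LiesOn-resp-∼ X V W (c , _ , V≡cW) on = begin
    evaluate (coord V) (coord X)                               ≡⟨ ℚ∑.sum-cong-≗ (λ i → trans (cong (ℚ._* M i) (V≡cW i)) (ℚP.*-assoc c (coord W i) (M i))) ⟩
    ℚ∑.sum (λ i → c ℚ.* (coord W i ℚ.* M i))                    ≡⟨ ℚ∑.*-distribˡ-sum c (λ i → coord W i ℚ.* M i) ⟨
    c ℚ.* evaluate (coord W) (coord X)                         ≡⟨ cong (c ℚ.*_) on ⟩
    c ℚ.* 0ℚ                                                   ≡⟨ ℚP.*-zeroʳ c ⟩
    0ℚ                                                         ∎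
    where
    open ≡-Reasoning
    M : Vector ℚ N
    M i = ℚ^.product λ j → coord X j ℚ^.^ Vec.lookup (monomial i) j

-- Classical enumeration

infixl 1 _>>=_
_>>=_ : {A B : Set} → ¬ ¬ A → (A → ¬ ¬ B) → ¬ ¬ B
(m >>= f) k = m λ a → f a k

return : {A : Set} → A → ¬ ¬ A
return a k = k a

em : {A : Set} → ¬ ¬ Dec A
em = ¬¬-excluded-middle

¬¬-All : {A : Set} {P : A → Set} {xs : List A} → All (λ x → ¬ ¬ P x) xs → ¬ ¬ All P xs
¬¬-All []       = return []
¬¬-All (p ∷ ps) = p >>= λ p → ¬¬-All ps >>= λ ps → return (p ∷ ps)

-- The bound k descends as long as some element of P lies below it; whether one does is settled by
-- excluded middle under the double negation.
¬¬-minimum : {A : Set} (f : A → ℕ) {P : A → Set} → ∃ P → ¬ ¬ (∃ λ x → P x × ∀ y → P y → f x ≤ f y)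
¬¬-minimum {A} f {P} (x , p) = below (f x) (x , p , ℕP.≤-refl)
  where
  below : ∀ k → (∃ λ x → P x × f x ≤ k) → ¬ ¬ (∃ λ x → P x × ∀ y → P y → f x ≤ f y)
  below zero    (x , p , fx≤0) = return (x , p , λ y _ → ℕP.≤-trans fx≤0 z≤n)
  below (suc k) (x , p , fx≤k+1) = em {∃ λ y → P y × f y ≤ k} >>= λ where
    (yes y) → below k y
    (no ¬y) → return (x , p , λ y q → ℕP.≤-trans fx≤k+1 (ℕP.≰⇒> λ fy≤k → ¬y (y , q , fy≤k)))

module _ (S : Setoid 0ℓ 0ℓ) where
  open Setoid S using () renaming (Carrier to A; _≈_ to _≈ˢ_; sym to ≈-sym)
  open Membership S using () renaming (_∈_ to _∈ˢ_)
  open UniqueSetoid S using () renaming (Unique to Uniqueˢ)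

  -- Equal keys give equivalent elements, but equivalent elements may have different keys, such as
  -- two opposite primitive vectors. So an element found for a key joins the list only if its class
  -- is not yet there.
  enumerate : {Key : Set} (key : A → Key) → (∀ x y → key x ≡ key y → x ≈ˢ y) → (P : A → Set) → ∀ ks →
    ¬ ¬ (∃ λ xs → Uniqueˢ xs × All P xs × ∀ x → P x → key x ∈ ks → x ∈ˢ xs)
  enumerate key key-inj P []       = return ([] , [] , [] , λ _ _ ())
  enumerate key key-inj P (k ∷ ks) =
    enumerate key key-inj P ks >>= λ (xs , xs! , ps , complete) →
    em {∃ λ x → P x × key x ≡ k} >>= λ where
      (no ¬x) → return (xs , xs! , ps , λ where
        x p (here e)   → contradiction (x , p , e) ¬x
        x p (there k∈) → complete x p k∈)
      (yes (x , p , e)) → em {x ∈ˢ xs} >>= λ where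
        (yes x∈) → return (xs , xs! , ps , λ where
          y q (here e′)  → MembershipP.∈-resp-≈ S (key-inj x y (trans e (sym e′))) x∈
          y q (there k∈) → complete y q k∈)
        (no x∉) → return (x ∷ xs , AllP.¬Any⇒All¬ xs x∉ ∷ xs! , p ∷ ps , λ where
          y q (here e′)  → here (key-inj y x (trans e′ (sym e)))
          y q (there k∈) → there (complete y q k∈))

  ∈⇒ : {P : A → Set} → (∀ x y → x ≈ˢ y → P x → P y) → ∀ {xs} → All P xs → ∀ x → x ∈ˢ xs → P x
  ∈⇒ resp ps x x∈ = let p , x≈ = All.lookupAny ps x∈ in resp _ _ (≈-sym x≈) p

  ¬¬-partition : (P : A → Set) → (∀ x y → x ≈ˢ y → P x → P y) → ∀ {xs} → Uniqueˢ xs →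
    ¬ ¬ (∃₂ λ ys zs → Uniqueˢ ys × Uniqueˢ zs × length ys + length zs ≡ length xs ×
         All (λ x → x ∈ˢ xs × P x) ys × All (λ x → x ∈ˢ xs × ¬ P x) zs × (∀ x → P x → x ∈ˢ xs → x ∈ˢ ys))
  ¬¬-partition P resp {xs} xs! =
    ¬¬-All (All.tabulateₛ S {xs = xs} λ {x} x∈ → classify x x∈) >>= λ pqs → return (conclude (split pqs))
    where
    classify : ∀ x → x ∈ˢ xs → ¬ ¬ ((x ∈ˢ xs × P x) ⊎ (x ∈ˢ xs × ¬ P x))
    classify x x∈ = em {P x} >>= λ where
      (yes p) → return (inj₁ (x∈ , p))
      (no ¬p) → return (inj₂ (x∈ , ¬p))
    conclude : Split (λ x → x ∈ˢ xs × P x) (λ x → x ∈ˢ xs × ¬ P x) xs → _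
    conclude (mkSplit {ys} {zs} s t e ps qs cover) =
      ys , zs , AllPairs-resp-⊇ s xs! , AllPairs-resp-⊇ t xs! , e , ps , qs , λ x p x∈ → choose x p (cover x∈)
      where
      choose : ∀ x → P x → x ∈ˢ ys ⊎ x ∈ˢ zs → x ∈ˢ ys
      choose x p (inj₁ x∈) = x∈
      choose x p (inj₂ x∈) = let (_ , ¬p) , x≈ = All.lookupAny qs x∈ in contradiction (resp _ _ x≈ p) ¬p

argmax : ∀ {n} (x : Vector ℤ (suc n)) → ∃ λ k → ∀ i → ℤ.∣ x i ∣ ≤ ℤ.∣ x k ∣
argmax {zero}  x = zero , λ { zero → ℕP.≤-refl }
argmax {suc n} x with argmax (x ∘ suc)
... | k , max with ℕP.≤-total ℤ.∣ x zero ∣ ℤ.∣ x (suc k) ∣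
...   | inj₁ x₀≤ = suc k , λ { zero → x₀≤ ; (suc i) → max i }
...   | inj₂ ≤x₀ = zero , λ { zero → ℕP.≤-refl ; (suc i) → ℕP.≤-trans (max i) ≤x₀ }

square≤normSq : ∀ {N} (a : Vector ℤ N) i → ℤ.∣ a i ∣ * ℤ.∣ a i ∣ ≤ normSq a
square≤normSq a zero    = ℕP.m≤m+n _ _
square≤normSq a (suc i) = ℕP.≤-trans (square≤normSq (a ∘ suc) i) (ℕP.m≤n+m _ _)

normSq-≤ : ∀ {N} (a : Vector ℤ N) K → (∀ i → ℤ.∣ a i ∣ ≤ K) → normSq a ≤ N * (K * K)
normSq-≤ {zero}  a K a≤K = z≤n
normSq-≤ {suc N} a K a≤K = ℕP.+-mono-≤ (ℕP.*-mono-≤ (a≤K zero) (a≤K zero)) (normSq-≤ (a ∘ suc) K (a≤K ∘ suc))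

<ᴿ-respˡ-≈ : ∀ x y t → x ≈ᴿ y → x <ᴿ t → y <ᴿ t
<ᴿ-respˡ-≈ x y t x≈y (ε , 0<ε , M , x+ε≤t) =
  let δ = ½ ℚ.* ε
      0<δ = subst (ℚ._< δ) (ℚP.*-zeroʳ ½) (ℚP.*-monoʳ-<-pos ½ 0<ε)
      N , close = x≈y δ 0<δ
  in δ , 0<δ , M ℕ.⊔ N , λ i i≥ → begin
    seq y i ℚ.+ δ              ≤⟨ ℚP.+-monoˡ-≤ δ (proj₂ (near {seq x i} {seq y i} (close i (ℕP.m⊔n≤o⇒n≤o M N i≥)))) ⟩
    seq x i ℚ.+ δ ℚ.+ δ        ≡⟨ ℚP.+-assoc (seq x i) δ δ ⟩
    seq x i ℚ.+ (δ ℚ.+ δ)      ≡⟨ cong (seq x i ℚ.+_) (halves ε) ⟩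
    seq x i ℚ.+ ε              ≤⟨ x+ε≤t i (ℕP.m⊔n≤o⇒m≤o M N i≥) ⟩
    seq t i                    ∎
  where open ℚP.≤-Reasoning

-- The distance to 1 is b / l, which is less than 1 / ↧ε, and a positive rational is at least the
-- inverse of its denominator.
ratio-near-1 : ∀ ε → 0ℚ ℚ.< ε → ∀ k b l → k + b ≡ l → b * ℚ.↧ₙ ε < l →
  Σ (NonZero l) λ l≢0 → ℚ.∣ (+ k ℚ./ l) {{l≢0}} ℚ.- 1ℚ ∣ ℚ.< ε
ratio-near-1 ε 0<ε k b (suc l) k+b≡l bE<l = _ , subst (ℚ._< ε) (sym distance) (ℚP.<-≤-trans (frac-mono-< b 1 l (ℚ.denominator-1 ε)
    (ℕP.<-≤-trans bE<l (ℕP.≤-reflexive (sym (ℕP.+-identityʳ (suc l)))))) (unit-fraction ε 0<ε))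
  where
  unit-fraction : ∀ ε → 0ℚ ℚ.< ε → frac 1 (ℚ.denominator-1 ε) ℚ.≤ ε
  unit-fraction ε 0<ε with ℚ.positive 0<ε
  unit-fraction ε@(ℚ.mkℚ ℤ.+[1+ p ] e _) 0<ε | _ = subst (frac 1 e ℚ.≤_) (ℚP.↥p/↧p≡p ε)
    (frac-mono-≤ 1 (suc p) e e (ℕP.*-monoˡ-≤ (suc e) (s≤s (z≤n {p}))))

  sum≡1 : frac k l ℚ.+ frac b l ≡ 1ℚ
  sum≡1 = trans (frac-+ k b l) (frac-cong (k + b) 1 l 0
    (trans (ℕP.*-identityʳ (k + b)) (trans k+b≡l (sym (ℕP.+-identityʳ (suc l))))))

  open +-*-Solver using (solve; _:=_; _:+_; _:-_; :-_)
  distance : ℚ.∣ frac k l ℚ.- 1ℚ ∣ ≡ frac b l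
  distance = trans (cong (λ u → ℚ.∣ frac k l ℚ.- u ∣) (sym sum≡1))
    (trans (cong ℚ.∣_∣ (solve 2 (λ p q → p :- (p :+ q) := :- q) refl (frac k l) (frac b l)))
      (trans (ℚP.∣-p∣≡∣p∣ (frac b l)) (ℚP.0≤p⇒∣p∣≡p (frac-mono-≤ 0 b 0 l z≤n))))

-- The exceptional count b is at most W + C l / (2 E (C + 1)), and W < l / (2 E).
few-exceptions : ∀ E W C X b l → suc (8 * E * W) ≤ X → X ≤ 4 * l →
  b * (2 * E * suc C) ≤ 2 * E * suc C * W + C * l → b * E < l
few-exceptions E W C X b l X≥ X≤4l b≤ = ℕP.*-cancelʳ-< (2 * suc C) (b * E) l (begin-strict
  b * E * (2 * suc C)                        ≡⟨ regroup₁ b E C ⟩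
  b * (2 * E * suc C)                        ≤⟨ b≤ ⟩
  2 * E * suc C * W + C * l                  ≡⟨ regroup₂ E C W l ⟩
  2 * E * W * suc C + C * l                  <⟨ ℕP.+-monoˡ-< (C * l) (ℕP.*-monoˡ-< (suc C) 2EW<l) ⟩
  l * suc C + C * l                          ≤⟨ ℕP.+-monoʳ-≤ (l * suc C) (ℕP.*-monoˡ-≤ l (ℕP.n≤1+n C)) ⟩
  l * suc C + suc C * l                      ≡⟨ regroup₃ l C ⟩
  l * (2 * suc C)                            ∎)
  where
  open ℕP.≤-Reasoning
  regroup₁ : ∀ b E C → b * E * (2 * suc C) ≡ b * (2 * E * suc C)
  regroup₁ = solve-∀
  regroup₂ : ∀ E C W l → 2 * E * suc C * W + C * l ≡ 2 * E * W * suc C + C * l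
  regroup₂ = solve-∀
  regroup₃ : ∀ l C → l * suc C + suc C * l ≡ l * (2 * suc C)
  regroup₃ = solve-∀
  regroup₄ : ∀ E W → 2 * E * W * 4 ≡ 8 * E * W
  regroup₄ = solve-∀
  2EW<l : 2 * E * W < l
  2EW<l = ℕP.*-cancelʳ-< 4 (2 * E * W) l (begin-strict
    2 * E * W * 4     ≡⟨ regroup₄ E W ⟩
    8 * E * W         <⟨ X≥ ⟩
    X                 ≤⟨ X≤4l ⟩
    4 * l             ≡⟨ ℕP.*-comm 4 l ⟩
    l * 4             ∎)

-- The proportion of exceptional hypersurfaces

module _ (d n : ℕ) where
  open Hypersurfaces d n

  private
    Hypersurface = Projective N

  -- H is a monotone function of the natural number `normSq`, so a minimum over naturals replaces
  -- one over reals.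
  𝔐-exists : ∀ V → ¬ ¬ ∃ (𝔐[ V ]≡_)
  𝔐-exists V = em {∃ λ x → x LiesOn V} >>= λ where
    (no ¬x) → return (∞ , no-point λ x on → ¬x (x , on))
    (yes x) → ¬¬-minimum (λ x → normSq (primVec x)) x >>= λ (x , on , min) →
      return (fin (H x) , attained x on λ y on → ≤ᴿ-eventually (H x) (H y) 0 λ i _ →
        ^ᴿ-mono ‖ primVec x ‖ ‖ primVec y ‖ i (suc n ∸ d) (0≤√ (normSq (primVec x)) i) (√-mono (min y on) i))

  𝔐-resp-∼ : ∀ (V W : Hypersurface) m → V ∼ W → 𝔐[ V ]≡ m → 𝔐[ W ]≡ m
  𝔐-resp-∼ V W _ V∼W (attained x on min) = attained x (LiesOn-resp-∼ d n x W V (Setoid.sym 𝕍 {V} {W} V∼W) on)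
    λ y on → min y (LiesOn-resp-∼ d n y V W V∼W on)
  𝔐-resp-∼ V W _ V∼W (no-point ¬on) = no-point λ x on → ¬on x (LiesOn-resp-∼ d n x V W V∼W on)

  normSq-resp-∼ : ∀ (V W : Hypersurface) → V ∼ W → normSq (primVec V) ≡ normSq (primVec W)
  normSq-resp-∼ V W V∼W = normSq-cong {a = primVec V} {primVec W} (primVec-cong V W V∼W)

  𝕍[]-resp-∼ : ∀ A (V W : Hypersurface) → V ∼ W → 𝕍[ A ] V → 𝕍[ A ] W
  𝕍[]-resp-∼ A V W V∼W = subst (λ s → √ s ≤ᴿ A) (normSq-resp-∼ V W V∼W)

  Large : Func ℝ₊ ℝ₊ → ℝ → Hypersurface → Set
  Large ψ A V = 𝕍[ A ] V × 𝔐[ V ]> proj₁ (Func.to ψ ‖𝐚 V ‖)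

  𝔐>-resp-∼ : ∀ (ψ : Func ℝ₊ ℝ₊) (V W : Hypersurface) → V ∼ W → 𝔐[ V ]> proj₁ (Func.to ψ ‖𝐚 V ‖) → 𝔐[ W ]> proj₁ (Func.to ψ ‖𝐚 W ‖)
  𝔐>-resp-∼ ψ V W V∼W (m , 𝔐V , ψ<m) = m , 𝔐-resp-∼ V W m V∼W 𝔐V , resp ψ<m
    where
    ψ≈ : proj₁ (Func.to ψ ‖𝐚 V ‖) ≈ᴿ proj₁ (Func.to ψ ‖𝐚 W ‖)
    ψ≈ = Func.cong ψ {‖𝐚 V ‖} {‖𝐚 W ‖}
      (subst (λ s → ‖ primVec V ‖ ≈ᴿ √ s) (normSq-resp-∼ V W V∼W) (Setoid.refl ℝ-setoid {‖ primVec V ‖}))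
    resp : fin (proj₁ (Func.to ψ ‖𝐚 V ‖)) <∞ m → fin (proj₁ (Func.to ψ ‖𝐚 W ‖)) <∞ m
    resp (fin<fin {y = t} ψ<t) = fin<fin (<ᴿ-respˡ-≈ (proj₁ (Func.to ψ ‖𝐚 V ‖)) (proj₁ (Func.to ψ ‖𝐚 W ‖)) t ψ≈ ψ<t)
    resp fin<∞           = fin<∞

  Large-resp-∼ : ∀ (ψ : Func ℝ₊ ℝ₊) A (V W : Hypersurface) → V ∼ W → Large ψ A V → Large ψ A W
  Large-resp-∼ ψ A V W V∼W (≤A , 𝔐>) = 𝕍[]-resp-∼ A V W V∼W ≤A , 𝔐>-resp-∼ ψ V W V∼W 𝔐>

  -- The point is the one where the minimum is attained; if V had no point, its 𝔐 would be ∞ and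
  -- exceed t.
  small-point : ∀ V t → ¬ 𝔐[ V ]> t → ¬ ¬ (∃ λ x → x LiesOn V × H x ≤ᴿ t)
  small-point V t ¬𝔐> = 𝔐-exists V >>= λ where
    (_ , 𝔐V@(attained x on _)) → return (x , on , λ t<H → ¬𝔐> (_ , 𝔐V , fin<fin t<H))
    (_ , 𝔐V@(no-point _))      → contradiction (_ , 𝔐V , fin<∞) ¬𝔐>

  key : Hypersurface → Vec ℤ N
  key V = Vec.tabulate (primVec V)

  key-injective : ∀ (V W : Hypersurface) → key V ≡ key W → V ∼ W
  key-injective V W e = primVec-injective V W λ i →
    trans (sym (VecP.lookup∘tabulate (primVec V) i)) (trans (cong (λ a → Vec.lookup a i) e) (VecP.lookup∘tabulate (primVec W) i))

  key-InBox : ∀ V R → normSq (primVec V) ≤ R * R → InBox R (key V)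
  key-InBox V R s≤R² i = subst (λ z → ℤ.∣ z ∣ ≤ R) (sym (VecP.lookup∘tabulate (primVec V) i))
    (square-cancel-≤ (ℕP.≤-trans (square≤normSq (primVec V) i) s≤R²))

  -- `_≤ᴿ_` is refuted only by a definite gap; passing from T to `suc T` provides the gap 1.
  normSq-below : ∀ V A T N₀ → (∀ i → N₀ ≤ i → seq A i ℚ.≤ ι T) → 𝕍[ A ] V → normSq (primVec V) ≤ suc T * suc T
  normSq-below V A T N₀ A≤T V∈ = ℕP.≮⇒≥ λ T²<s → V∈ (1ℚ , ℚP.positive⁻¹ 1ℚ , N₀ , λ i N₀≤i → begin
    seq A i ℚ.+ 1ℚ          ≤⟨ ℚP.+-monoˡ-≤ 1ℚ (A≤T i N₀≤i) ⟩
    ι T ℚ.+ ι 1             ≡⟨ trans (ι-+ T 1) (cong ι (ℕP.+-comm T 1)) ⟩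
    ι (suc T)               ≤⟨ √-≥ {suc T} {normSq (primVec V)} (ℕP.<⇒≤ T²<s) i ⟩
    seq ‖ primVec V ‖ i     ∎)
    where open ℚP.≤-Reasoning

  module _ (d≤n : d ≤ n) where

    -- With m the largest |xᵢ|, one has m ≤ ‖x‖ and so m^(n+1-d) ≤ H x ≤ t ≤ T/(q+1). Both ends of
    -- the chain are rational, so `squeeze` turns it into an inequality between naturals.
    small-zero : ∀ V x q T (t : ℝ) → x LiesOn V → H x ≤ᴿ t → t ≤ᴿ fromℚ (frac 1 q) *ᴿ ‖ primVec V ‖ →
      normSq (primVec V) ≤ T * T → SmallZero d n d≤n (suc q) T (key V)
    small-zero V x q T t on H≤t t≤εa s≤T² =
      m , m^≤T , Vec.tabulate (primVec x) ,
      (trans (content-cong (VecP.lookup∘tabulate (primVec x))) (primVec-primitive x) ,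
       (k , cong ℤ.∣_∣ (VecP.lookup∘tabulate (primVec x) k)) ,
       (λ i → subst (λ z → ℤ.∣ z ∣ ≤ m) (sym (VecP.lookup∘tabulate (primVec x) i)) (max i))) ,
      key-InBox V T s≤T² ,
      trans (ℤ∑.sum-cong-≗ λ i → cong₂ ℤ._*_ (VecP.lookup∘tabulate (primVec V) i) (monomialValue-cong (monomial i) (VecP.lookup∘tabulate (primVec x))))
            (LiesOn⇒vanishes d n x V on)
      where
      open ℚP.≤-Reasoning
      k = proj₁ (argmax (primVec x))
      max = proj₂ (argmax (primVec x))
      m = ℤ.∣ primVec x k ∣

      m^≤H : ∀ i → ι (m ^ suc (n ∸ d)) ℚ.≤ seq (H x) i
      m^≤H i = subst (λ e → ι (m ^ e) ℚ.≤ seq (H x) i) (ℕP.+-∸-assoc 1 d≤n)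
        (^ᴿ-≥ ‖ primVec x ‖ m i (suc n ∸ d) (√-≥ {m} {normSq (primVec x)} (square≤normSq (primVec x) k) i))

      εa≤ : ∀ i → frac 1 q ℚ.* seq ‖ primVec V ‖ i ℚ.≤ frac (1 * T) (0 + q * 1)
      εa≤ i = begin
        frac 1 q ℚ.* seq ‖ primVec V ‖ i     ≤⟨ *-mono-≤-nonNeg {frac 1 q} {r = seq ‖ primVec V ‖ i} (frac-mono-≤ 0 1 0 q z≤n) (0≤√ (normSq (primVec V)) i) ℚP.≤-refl (√-≤ {T} {normSq (primVec V)} s≤T² i) ⟩
        frac 1 q ℚ.* ι T                     ≡⟨ frac-* 1 T q 0 ⟩
        frac (1 * T) (0 + q * 1)             ∎

      m^≤T : m ^ suc (n ∸ d) * suc q ≤ T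
      m^≤T = subst₂ _≤_ (cong (λ q → m ^ suc (n ∸ d) * suc q) (ℕP.*-identityʳ q))
        (trans (ℕP.*-identityʳ (1 * T)) (ℕP.*-identityˡ T))
        (frac-cancel-≤ (m ^ suc (n ∸ d)) (1 * T) 0 (0 + q * 1)
          (squeeze (H x) t (fromℚ (frac 1 q) *ᴿ ‖ primVec V ‖) m^≤H H≤t t≤εa εa≤))

    -- K ≥ 1 absorbs the summand 1 of the side length, so that the bound becomes a constant times
    -- K^N and can be compared with the lower bound for 𝕍(A).
    largeBox-≤ : ∀ K T .{{_ : NonZero K}} → T ≤ (2 * N + 4) * K →
                 largeBox d n d≤n T ≤ suc (2 * (enlarge d n d≤n * (2 * N + 4))) ^ N * K ^ N
    largeBox-≤ K T T≤ = begin
      suc (2 * (e * T)) ^ N                           ≤⟨ ℕP.^-monoˡ-≤ N (ℕP.+-mono-≤ (ℕ.>-nonZero⁻¹ K) (ℕP.*-monoʳ-≤ 2 (ℕP.*-monoʳ-≤ e T≤))) ⟩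
      (K + 2 * (e * ((2 * N + 4) * K))) ^ N           ≡⟨ cong (_^ N) (regroup K e (2 * N + 4)) ⟩
      (suc (2 * (e * (2 * N + 4))) * K) ^ N           ≡⟨ ^-distribʳ-* N (suc (2 * (e * (2 * N + 4)))) K ⟩
      suc (2 * (e * (2 * N + 4))) ^ N * K ^ N         ∎
      where
      open ℕP.≤-Reasoning
      e = enlarge d n d≤n
      regroup : ∀ K e c → K + 2 * (e * (c * K)) ≡ suc (2 * (e * c)) * K
      regroup = solve-∀

    module _ (A : ℝ) (T N₀ : ℕ) (A≈T : ∀ i → N₀ ≤ i → ι T ℚ.≤ seq A i × seq A i ℚ.≤ ι (3 + T)) where

      private
        -- The approximations of A stay below 3 + T, and `normSq-below` adds 1.
        R = 4 + T

      normSq-≤R² : ∀ V → 𝕍[ A ] V → normSq (primVec V) ≤ R * R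
      normSq-≤R² V = normSq-below V A (3 + T) N₀ (λ i N₀≤i → proj₂ (A≈T i N₀≤i))

      normSq-≤T²⇒∈ : ∀ V → normSq (primVec V) ≤ T * T → 𝕍[ A ] V
      normSq-≤T²⇒∈ V s≤T² = ≤ᴿ-eventually ‖ primVec V ‖ A N₀ λ i N₀≤i →
        ℚP.≤-trans (√-≤ {T} {normSq (primVec V)} s≤T² i) (proj₁ (A≈T i N₀≤i))

      -- The primitive vectors with positive entries give distinct hypersurfaces.
      many : 2 ≤ N → ∀ K → 2 ≤ K → N * K ≤ T → ∀ Vs → (∀ V → 𝕍[ A ] V → Any (V ∼_) Vs) → K ^ N ≤ 4 * length Vs
      many 2≤N K 2≤K NK≤T Vs complete = lower (positive-primitive-vectors N K 2≤N 2≤K)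
        where
        open ℕP.≤-Reasoning
        -- The sign of `primVec` may differ between proportional coordinates, but absolute values
        -- agree, and a positive vector is recovered from them.
        absKey : Hypersurface → Vec ℕ N
        absKey V = Vec.tabulate λ i → ℤ.∣ primVec V i ∣

        realise : ∀ (a : Vec ℕ N) → PositiveUpTo K a → Primitive (λ i → + Vec.lookup a i) → Fin N → a ∈ List.map absKey Vs
        realise a pos prim i₀ = subst (_∈ List.map absKey Vs) absKey≡a
          (∈P.∈-map⁺ absKey (proj₁ found))
          where
          V : Hypersurface
          V .coord i = τ (+ Vec.lookup a i)
          V .nonzero = i₀ , λ e → ℕP.<⇒≢ (proj₁ (pos i₀)) (sym (ℤP.+-injective (τ-injective {+ Vec.lookup a i₀} {0ℤ} e)))

          primVec≡a : ∀ i → ℤ.∣ primVec V i ∣ ≡ Vec.lookup a i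
          primVec≡a = represents-unique V V (primVec-primitive V) prim (primVec-represents V)
            (1ℚ , ℚP.1≢0 , λ i → sym (ℚP.*-identityˡ (coord V i))) (Setoid.refl 𝕍 {V})

          V∈ : 𝕍[ A ] V
          V∈ = normSq-≤T²⇒∈ V (begin
            normSq (primVec V)     ≤⟨ normSq-≤ (primVec V) K (λ i → subst (_≤ K) (sym (primVec≡a i)) (proj₂ (pos i))) ⟩
            -- A second factor N makes the bound a perfect square, so that no √N occurs.
            N * (K * K)            ≤⟨ ℕP.m≤n*m (N * (K * K)) N {{ℕ.>-nonZero (ℕP.<-trans (s≤s z≤n) 2≤N)}} ⟩
            N * (N * (K * K))      ≡⟨ regroup N K ⟩
            (N * K) * (N * K)      ≤⟨ ℕP.*-mono-≤ NK≤T NK≤T ⟩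
            T * T                  ∎)
            where
            regroup : ∀ N K → N * (N * (K * K)) ≡ (N * K) * (N * K)
            regroup = solve-∀

          pick : ∀ {Vs} → Any (V ∼_) Vs → ∃ λ W → W ∈ Vs × V ∼ W
          pick (here {W} V∼W) = W , here refl , V∼W
          pick (there V∈)     = let W , W∈ , V∼W = pick V∈ in W , there W∈ , V∼W

          W = proj₁ (pick (complete V V∈))
          found = proj₂ (pick (complete V V∈))

          absKey≡a : absKey W ≡ a
          absKey≡a = trans (VecP.tabulate-cong λ i → trans (sym (primVec-cong V W (proj₂ found) i)) (primVec≡a i)) (VecP.tabulate∘lookup a)

        first : ∀ {M} → 2 ≤ M → Fin M
        first (s≤s _) = zero

        lower : (∃ λ as → Unique as × All (λ (a : Vec ℕ N) → PositiveUpTo K a × Primitive (λ i → + Vec.lookup a i)) as ×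
                 K ^ N ≤ 4 * length as) → K ^ N ≤ 4 * length Vs
        lower (as , as! , good , X≤) = begin
          K ^ N                                 ≤⟨ X≤ ⟩
          4 * length as                         ≤⟨ ℕP.*-monoʳ-≤ 4 (pigeonhole (≡P.setoid _) as! (All.map (λ {a} (pos , prim) → realise a pos prim (first 2≤N)) good)) ⟩
          4 * length (List.map absKey Vs)       ≡⟨ cong (4 *_) (ListP.length-map absKey Vs) ⟩
          4 * length Vs                         ∎

      -- If ‖a_V‖ ≤ B, the key of V lies in a fixed box. Otherwise ‖a_V‖ is beyond U, so V has a
      -- point of height at most ψ(‖a_V‖) ≤ ‖a_V‖/(q+1), and `small-zero` applies.
      few : ∀ (ψ : Func ℝ₊ ℝ₊) q U B N₁ → (∀ i → N₁ ≤ i → seq U i ℚ.≤ ι B) →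
        (∀ u → U ≤ᴿ proj₁ u → proj₁ (Func.to ψ u) ≤ᴿ fromℚ (frac 1 q) *ᴿ proj₁ u) →
        ∀ Vs → UniqueSetoid.Unique 𝕍 Vs →
        All (λ V → 𝕍[ A ] V × ¬ 𝔐[ V ]> proj₁ (Func.to ψ ‖𝐚 V ‖)) Vs →
        ¬ ¬ (length Vs * q ≤ q * suc (2 * B) ^ N + shellConstant d n d≤n * largeBox d n d≤n R)
      few ψ q U B N₁ U≤B ψ≤ Vs Vs! bad = ¬¬-All (All.map (λ {V} → classify V) bad) >>= λ cases →
        return (subst (λ l → l * q ≤ q * suc (2 * B) ^ N + shellConstant d n d≤n * largeBox d n d≤n R) (ListP.length-map key Vs)
          (bound (List.map key Vs) (UniqueSP.map⁺ 𝕍 (≡P.setoid _) (λ {V} {W} → key-injective V W) Vs!) (AllP.map⁺ cases)))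
        where
        classify : ∀ V → 𝕍[ A ] V × ¬ 𝔐[ V ]> proj₁ (Func.to ψ ‖𝐚 V ‖) →
                   ¬ ¬ (InBox B (key V) ⊎ SmallZero d n d≤n (suc q) R (key V))
        classify V (V∈ , ¬𝔐>) = by-size (normSq (primVec V) ℕP.≤? B * B)
          where
          U≤‖V‖ : ¬ normSq (primVec V) ≤ B * B → U ≤ᴿ ‖ primVec V ‖
          U≤‖V‖ s≰B² = ≤ᴿ-eventually U ‖ primVec V ‖ N₁ λ i N₁≤i →
            ℚP.≤-trans (U≤B i N₁≤i) (√-≥ {B} {normSq (primVec V)} (ℕP.<⇒≤ (ℕP.≰⇒> s≰B²)) i)

          by-size : Dec (normSq (primVec V) ≤ B * B) → ¬ ¬ (InBox B (key V) ⊎ SmallZero d n d≤n (suc q) R (key V))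
          by-size (yes s≤B²) = return (inj₁ (key-InBox V B s≤B²))
          by-size (no  s≰B²) = small-point V (proj₁ (Func.to ψ ‖𝐚 V ‖)) ¬𝔐> >>= λ (x , on , H≤ψ) →
            return (inj₂ (small-zero V x q R (proj₁ (Func.to ψ ‖𝐚 V ‖)) on H≤ψ (ψ≤ ‖𝐚 V ‖ (U≤‖V‖ s≰B²)) (normSq-≤R² V V∈)))

        bound : Bounded (λ a → InBox B a ⊎ SmallZero d n d≤n (suc q) R a) q
                        (q * suc (2 * B) ^ N + shellConstant d n d≤n * largeBox d n d≤n R)
        bound = Bounded-∪ {P = InBox B}
          (subst (λ w → Bounded (InBox B) w (q * suc (2 * B) ^ N)) (ℕP.*-identityʳ q) (Bounded-*ˡ q (Bounded-box N B)))
          (Bounded-weight (ℕP.n≤1+n q) (Bounded-smallZero d n d≤n (suc q) R))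

      large-ratio : (ψ : Func ℝ₊ ℝ₊) (ε : ℚ) → 0ℚ ℚ.< ε → ∀ q U B N₁ → (∀ i → N₁ ≤ i → seq U i ℚ.≤ ι B) →
        (∀ u → U ≤ᴿ proj₁ u → proj₁ (Func.to ψ u) ≤ᴿ fromℚ (frac 1 q) *ᴿ proj₁ u) →
        2 ≤ N → ∀ K → 2 ≤ K → N * K ≤ T →
        (∀ b l → b * q ≤ q * suc (2 * B) ^ N + shellConstant d n d≤n * largeBox d n d≤n R → K ^ N ≤ 4 * l → b * ℚ.↧ₙ ε < l) →
        ¬ ¬ (∃ λ r → HasRatio 𝕍 (Large ψ A) 𝕍[ A ] r × ℚ.∣ r ℚ.- 1ℚ ∣ ℚ.< ε)
      large-ratio ψ ε 0<ε q U B N₁ U≤B ψ≤ 2≤N K 2≤K NK≤T exceptions =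
        -- The key of every V in 𝕍(A) lies in the finite box of radius R.
        enumerate 𝕍 key key-injective 𝕍[ A ] (box N R) >>= λ (Vs , Vs! , Vs⊆ , complete) →
        from-enumeration Vs Vs! Vs⊆ (λ V V∈ → complete V V∈ (∈-box (key-InBox V R (normSq-≤R² V V∈))))
        where
        Exceeds : Hypersurface → Set
        Exceeds V = 𝔐[ V ]> proj₁ (Func.to ψ ‖𝐚 V ‖)

        open Membership 𝕍 using () renaming (_∈_ to _∈ˢ_)

        from-enumeration : ∀ Vs → UniqueSetoid.Unique 𝕍 Vs → All 𝕍[ A ] Vs → (∀ V → 𝕍[ A ] V → V ∈ˢ Vs) →
                   ¬ ¬ (∃ λ r → HasRatio 𝕍 (Large ψ A) 𝕍[ A ] r × ℚ.∣ r ℚ.- 1ℚ ∣ ℚ.< ε)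
        from-enumeration Vs Vs! Vs⊆ complete =
          ¬¬-partition 𝕍 Exceeds (𝔐>-resp-∼ ψ) Vs! >>= λ (goods , bads , goods! , bads! , lengths , good , bad , goods-complete) →
          few ψ q U B N₁ U≤B ψ≤ bads bads! (All.map (λ {V} (V∈ , ¬𝔐>) → sound V V∈ , ¬𝔐>) bad) >>= λ bads-few →
          return (ratio goods bads goods! lengths good goods-complete
            (ratio-near-1 ε 0<ε (length goods) (length bads) (length Vs) lengths
              (exceptions (length bads) (length Vs) bads-few (many 2≤N K 2≤K NK≤T Vs complete))))
          where
          sound : ∀ V → V ∈ˢ Vs → 𝕍[ A ] V
          sound = ∈⇒ 𝕍 (𝕍[]-resp-∼ A) Vs⊆

          ratio : ∀ goods bads → UniqueSetoid.Unique 𝕍 goods → length goods + length bads ≡ length Vs →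
            All (λ V → V ∈ˢ Vs × Exceeds V) goods → (∀ V → Exceeds V → V ∈ˢ Vs → V ∈ˢ goods) →
            (Σ (NonZero (length Vs)) λ l≢0 → ℚ.∣ (+ length goods ℚ./ length Vs) {{l≢0}} ℚ.- 1ℚ ∣ ℚ.< ε) →
            ∃ λ r → HasRatio 𝕍 (Large ψ A) 𝕍[ A ] r × ℚ.∣ r ℚ.- 1ℚ ∣ ℚ.< ε
          ratio goods bads goods! lengths good goods-complete (l≢0 , near-1) =
            _ , (length goods , length Vs , l≢0 ,
                 (goods , goods! , goods⇔ , refl) , (Vs , Vs! , (λ V → mk⇔ (sound V) (complete V)) , refl) , refl) , near-1
            where
            goods⇔ : ∀ V → V ∈ˢ goods ⇔ Large ψ A V
            goods⇔ V = mk⇔ (∈⇒ 𝕍 (Large-resp-∼ ψ A) (All.map (λ {V} (V∈ , 𝔐>) → sound V V∈ , 𝔐>) good) V)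
                           (λ (V∈ , 𝔐>) → goods-complete V 𝔐> (complete V V∈))

-- The number of monomials and the choice of constants

≤-length-map-++ : {A B : Set} (f : A → B) (xs : List A) (ys : List B) {a b : ℕ} →
  a ≤ length xs → b ≤ length ys → a + b ≤ length (List.map f xs ++ ys)
≤-length-map-++ f xs ys a≤ b≤ = subst (_ ≤_)
  (sym (trans (ListP.length-++ (List.map f xs)) (cong (_+ length ys) (ListP.length-map f xs)))) (ℕP.+-mono-≤ a≤ b≤)

0<length-monomials : ∀ k d → 1 ≤ length (monomials (suc k) d)
0<length-monomials k zero    = s≤s z≤n
0<length-monomials k (suc d) = ≤-length-map-++ _ (monomials (suc k) d) _ (0<length-monomials k d) z≤n

-- Some monomial is divisible by the first variable and some is not. Dimension 2 is what the density
-- of primitive vectors requires.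
2≤N : ∀ d n → 1 ≤ d → 1 ≤ n → 2 ≤ Hypersurfaces.N d n
2≤N (suc d) (suc n) _ _ = subst (2 ≤_) (length-monomials (suc n) (suc d))
  (≤-length-map-++ _ (monomials (2 + n) d) _ (0<length-monomials (suc n) d)
    (subst (1 ≤_) (sym (ListP.length-map (0 Vec.∷_) (monomials (suc n) (suc d)))) (0<length-monomials n (suc d))))

-- With K = ⌊T/N⌋ ≥ 1, the summand 4 is at most 4K and the remainder at most NK. So the box of side
-- K used from below and the one of radius 4 + T used from above are comparable.
largest-multiple : ∀ N T K₀ .{{_ : NonZero N}} → N * K₀ ≤ T → 1 ≤ K₀ →
  ∃ λ K → K₀ ≤ K × N * K ≤ T × 4 + T ≤ (2 * N + 4) * K
largest-multiple N T K₀ NK₀≤T 1≤K₀ = K , K₀≤K , subst (_≤ T) (ℕP.*-comm K N) (DivMod.m/n*n≤m T N) , (begin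
  4 + T                          ≡⟨ cong (4 ℕ.+_) (DivMod.m≡m%n+[m/n]*n T N) ⟩
  4 + (T ℕ.% N + K * N)          ≤⟨ ℕP.+-mono-≤ (ℕP.m≤m*n 4 K) (ℕP.+-monoˡ-≤ (K * N) (ℕP.≤-trans (ℕP.<⇒≤ (DivMod.m%n<n T N)) (ℕP.m≤m*n N K))) ⟩
  4 * K + (N * K + K * N)        ≡⟨ regroup N K ⟩
  (2 * N + 4) * K                ∎)
  where
  open ℕP.≤-Reasoning
  K = T ℕ./ N
  K₀≤K : K₀ ≤ K
  K₀≤K = subst (_≤ K) (trans (cong (ℕ._/ N) (ℕP.*-comm N K₀)) (DivMod.m*n/n≡m K₀ N)) (DivMod./-monoˡ-≤ N NK₀≤T)
  instance
    K-nonZero : NonZero K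
    K-nonZero = ℕ.>-nonZero (ℕP.≤-trans 1≤K₀ K₀≤K)
  regroup : ∀ N K → 4 * K + (N * K + K * N) ≡ (2 * N + 4) * K
  regroup = solve-∀

theorem1 : (d n : ℕ) → 2 ≤ d → d ≤ n → (d , n) ≢ (2 , 2) →
    (ψ : Func ℝ₊ ℝ₊) → IsLittleO ψ →
    let open Hypersurfaces d n in
    TendsTo (λ A → HasRatio 𝕍 (λ V → 𝕍[ A ] V × 𝔐[ V ]> proj₁ (Func.to ψ ‖𝐚 V ‖)) 𝕍[ A ]) 1ℚ
theorem1 d n 2≤d d≤n _ ψ ψ=o ε 0<ε = fromℚ (ι (3 + N * K₀)) , λ A A₀≤A →
  -- The 3 in the threshold for A is consumed by the approximation; T ≥ N K₀ is left, which forces K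
  -- ≥ K₀.
  let T , M≤T , N₀ , A≈T = approximate A (N * K₀) A₀≤A
      K , K₀≤K , NK≤T , R≤ = largest-multiple N T K₀ {{ℕ.>-nonZero (ℕP.<⇒≤ 2≤N′)}} M≤T (s≤s z≤n)
      2≤K = ℕP.≤-trans (s≤s (s≤s z≤n)) K₀≤K
  in large-ratio d n d≤n A T N₀ A≈T ψ ε 0<ε q U B N₁ U≤B ψ≤ 2≤N′ K 2≤K NK≤T
       (exceptions T K K₀≤K R≤)
  where
  open Hypersurfaces d n using (N)
  2≤N′ : 2 ≤ N
  2≤N′ = 2≤N d n (ℕP.<⇒≤ 2≤d) (ℕP.≤-trans (ℕP.<⇒≤ 2≤d) d≤n)

  s = shellConstant d n d≤n
  C = suc (2 * (enlarge d n d≤n * (2 * N + 4))) ^ N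
  E = ℚ.↧ₙ ε
  -- With l the size of 𝕍(A), the small zeros number at most 4sC l / q, and this q makes that less
  -- than l / (2E).
  q = 2 * E * suc (4 * (s * C))
  threshold = ψ=o (frac 1 q) (frac-mono-< 0 1 0 q (s≤s z≤n))
  U = proj₁ threshold
  ψ≤ = proj₂ threshold
  B = proj₁ (bounded-above U)
  N₁ = proj₁ (proj₂ (bounded-above U))
  U≤B = proj₂ (proj₂ (bounded-above U))
  W = suc (2 * B) ^ N
  -- K^N ≥ K > 8EW and K^N ≤ 4l give W < l / (2E), the other half of the allowance; the 2 also
  -- secures 2 ≤ K.
  K₀ = 2 + 8 * E * W

  exceptions : ∀ T K → K₀ ≤ K → 4 + T ≤ (2 * N + 4) * K → ∀ b l →
    b * q ≤ q * W + s * largeBox d n d≤n (4 + T) → K ^ N ≤ 4 * l → b * E < l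
  exceptions T K K₀≤K R≤ b l b≤ X≤4l = few-exceptions E W (4 * (s * C)) (K ^ N) b l X≥ X≤4l
    (ℕP.≤-trans b≤ (ℕP.+-monoʳ-≤ (q * W) (begin
      s * largeBox d n d≤n (4 + T)     ≤⟨ ℕP.*-monoʳ-≤ s (largeBox-≤ d n d≤n K (4 + T) {{K≢0}} R≤) ⟩
      s * (C * K ^ N)                  ≤⟨ ℕP.*-monoʳ-≤ s (ℕP.*-monoʳ-≤ C X≤4l) ⟩
      s * (C * (4 * l))                ≡⟨ regroup s C l ⟩
      4 * (s * C) * l                  ∎)))
    where
    open ℕP.≤-Reasoning
    K≢0 : NonZero K
    K≢0 = ℕ.>-nonZero (ℕP.≤-trans (s≤s z≤n) K₀≤K)
    regroup : ∀ s C l → s * (C * (4 * l)) ≡ 4 * (s * C) * l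
    regroup = solve-∀
    X≥ : suc (8 * E * W) ≤ K ^ N
    X≥ = ℕP.≤-trans (ℕP.n≤1+n (suc (8 * E * W))) (ℕP.≤-trans K₀≤K
      (subst (_≤ K ^ N) (ℕP.^-identityʳ K) (ℕP.^-monoʳ-≤ K {{K≢0}} (ℕP.<⇒≤ 2≤N′))))
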